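{- Let $0\leq\beta<\infty$ be a fixed real and let $\mathcal G$ be distributed as the Erdős–Rényi random graph $\mathcal G(n,p)$, where $p=p(n)$ satisfies $np\sim n^\alpha$ for some fixed real $0<\alpha\leq1$. Then, with high probability, for every vertex $u$ the controller of the $(\beta/(np))$-biased random walk on $\mathcal G$ can only increase the stationary probability of $u$ from $\pi(u)$ to at most $3(1+\beta)^{6/\alpha}\cdot\pi(u)$; that is, with high probability, for every vertex $u$ and every unchanging strategy $\mathbf Q$ of the $(\beta/(np))$-biased random walk on $\mathcal G$, $\pi_{\mathbf Q}(u)\le 3(1+\beta)^{6/\alpha}\,\pi(u)$.
   Context: "With high probability" means with probability tending to $1$ as $n\to\infty$; $np\sim n^\alpha$ means $np/n^\alpha\to1$. On a connected graph, let $\mathbf P$ be the transition matrix of the simple random walk (move to a uniformly random neighbour), with stationary distribution $\pi$. An unchanging strategy for the $\varepsilon$-biased random walk is a Markov chain with transition matrix $\mathbf Q=(1-\varepsilon)\mathbf P+\varepsilon\mathbf B$, where $\mathbf B$ is an arbitrary stochastic matrix, chosen by a controller, supported on the edges of the graph; $\pi_{\mathbf Q}$ denotes its stationary distribution. (Walks are considered on connected graphs only; in the stated regime $\mathcal G(n,p)$ is connected with high probability. The strategy may depend on the sampled graph.) -}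

module Defs where

open import Data.Bool.Base using (Bool; true; false; T; if_then_else_)
open import Data.Fin.Base using (Fin; zero; suc)
open import Data.Fin.Subset using (Subset; ∣_∣)
open import Data.Integer.Base using (+_)
open import Data.List.Base as List using (List; []; _∷_; cartesianProductWith; filterᵇ)
open import Data.Nat.Base as ℕ using (ℕ; zero; suc; NonZero)
import Data.Nat.Properties as ℕₚ
open import Data.Product.Base using (Σ; ∃; _×_; _,_; proj₁; proj₂)
open import Data.Rational.Base as ℚ using (ℚ; 0ℚ; 1ℚ; ½)
import Data.Rational.Properties as ℚₚ
open import Data.Rational.Solver using (module +-*-Solver)
open import Data.Vec.Base as Vec using (Vec; []; _∷_)
import Data.Vec.Functional as Vector
open import Relation.Binary.Construct.Closure.ReflexiveTransitive using (Star)
open import Relation.Binary.PropositionalEquality using (_≡_; refl; sym; trans; cong; cong₂; subst)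

------------------------------------------------------------------------
-- Real numbers: Cauchy sequences of rationals, with `_≃_` as equality

record ℝ : Set where
  constructor mkℝ
  field
    seq    : ℕ → ℚ
    cauchy : ∀ ε → 0ℚ ℚ.< ε → ∃ λ N → ∀ m n → N ℕ.≤ m → N ℕ.≤ n →
             ℚ.∣ seq m ℚ.- seq n ∣ ℚ.≤ ε
open ℝ public

infix 4 _≤_ _<_ _≃_

_≤_ : ℝ → ℝ → Set
x ≤ y = ∀ ε → 0ℚ ℚ.< ε → ∃ λ N → ∀ n → N ℕ.≤ n → seq x n ℚ.≤ seq y n ℚ.+ ε

_<_ : ℝ → ℝ → Set
x < y = ∃ λ δ → 0ℚ ℚ.< δ × ∃ λ N → ∀ n → N ℕ.≤ n → seq x n ℚ.+ δ ℚ.≤ seq y n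

_≃_ : ℝ → ℝ → Set
x ≃ y = x ≤ y × y ≤ x

private
  open ℚₚ.≤-Reasoning
  open +-*-Solver

  split-+ : ∀ a b → a ≡ (a ℚ.- b) ℚ.+ b
  split-+ = solve 2 (λ a b → a := (a :- b) :+ b) refl

  difference-+ : ∀ a b c d → (a ℚ.+ c) ℚ.- (b ℚ.+ d) ≡ (a ℚ.- b) ℚ.+ (c ℚ.- d)
  difference-+ = solve 4 (λ a b c d → (a :+ c) :- (b :+ d) := (a :- b) :+ (c :- d)) refl

  difference-neg : ∀ a b → ℚ.- a ℚ.- ℚ.- b ≡ ℚ.- (a ℚ.- b)
  difference-neg = solve 2 (λ a b → (:- a) :- (:- b) := :- (a :- b)) refl

  difference-* : ∀ a b c d → a ℚ.* c ℚ.- b ℚ.* d ≡ a ℚ.* (c ℚ.- d) ℚ.+ (a ℚ.- b) ℚ.* d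
  difference-* = solve 4 (λ a b c d → a :* c :- b :* d := a :* (c :- d) :+ (a :- b) :* d) refl

  collect : ∀ A A⁻¹ B B⁻¹ e →
    A ℚ.* (e ℚ.* A⁻¹) ℚ.+ e ℚ.* B⁻¹ ℚ.* B ≡ e ℚ.* (A ℚ.* A⁻¹) ℚ.+ e ℚ.* (B ℚ.* B⁻¹)
  collect = solve 5 (λ A A⁻¹ B B⁻¹ e →
    A :* (e :* A⁻¹) :+ e :* B⁻¹ :* B := e :* (A :* A⁻¹) :+ e :* (B :* B⁻¹)) refl

  difference-inv : ∀ a b u v → b ℚ.* v ℚ.* u ℚ.- a ℚ.* u ℚ.* v ≡ ℚ.- (a ℚ.- b) ℚ.* (u ℚ.* v)
  difference-inv = solve 4 (λ a b u v → b :* v :* u :- a :* u :* v := :- (a :- b) :* (u :* v)) refl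

  regroup : ∀ e d u v → e ℚ.* (d ℚ.* d) ℚ.* (u ℚ.* v) ≡ e ℚ.* ((d ℚ.* u) ℚ.* (d ℚ.* v))
  regroup = solve 4 (λ e d u v → e :* (d :* d) :* (u :* v) := e :* ((d :* u) :* (d :* v))) refl

  pos-* : ∀ {p q} → 0ℚ ℚ.< p → 0ℚ ℚ.< q → 0ℚ ℚ.< p ℚ.* q
  pos-* {p} {q} 0<p 0<q =
    ℚₚ.positive⁻¹ _ {{ℚₚ.pos*pos⇒pos p {{ℚ.positive 0<p}} q {{ℚ.positive 0<q}}}}

  nonZero : ∀ {p} → 0ℚ ℚ.< p → ℚ.NonZero p
  nonZero {p} 0<p = ℚₚ.pos⇒nonZero p {{ℚ.positive 0<p}}

  recip : ∀ p → 0ℚ ℚ.< p → ℚ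
  recip p 0<p = (ℚ.1/ p) {{nonZero 0<p}}

  recip-pos : ∀ p (0<p : 0ℚ ℚ.< p) → 0ℚ ℚ.< recip p 0<p
  recip-pos p 0<p = ℚₚ.positive⁻¹ _ {{ℚₚ.1/pos⇒pos p {{ℚ.positive 0<p}}}}

  recip-inverse : ∀ p (0<p : 0ℚ ℚ.< p) → p ℚ.* recip p 0<p ≡ 1ℚ
  recip-inverse p 0<p = ℚₚ.*-inverseʳ p {{nonZero 0<p}}

  0<½ : 0ℚ ℚ.< ½
  0<½ = ℚₚ.positive⁻¹ ½

  halves : ∀ ε → ½ ℚ.* ε ℚ.+ ½ ℚ.* ε ≡ ε
  halves ε = trans (sym (ℚₚ.*-distribʳ-+ ε ½ ½)) (ℚₚ.*-identityˡ ε)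

  *-mono : ∀ {a b c d} → 0ℚ ℚ.≤ a → 0ℚ ℚ.≤ d → a ℚ.≤ b → c ℚ.≤ d → a ℚ.* c ℚ.≤ b ℚ.* d
  *-mono {a} {b} {c} {d} 0≤a 0≤d a≤b c≤d = ℚₚ.≤-trans
    (ℚₚ.*-monoˡ-≤-nonNeg a {{ℚ.nonNegative 0≤a}} c≤d)
    (ℚₚ.*-monoʳ-≤-nonNeg d {{ℚ.nonNegative 0≤d}} a≤b)

  product-close : ∀ a b c d A B e (0<A : 0ℚ ℚ.< A) (0<B : 0ℚ ℚ.< B) → 0ℚ ℚ.< e →
    ℚ.∣ a ∣ ℚ.≤ A → ℚ.∣ d ∣ ℚ.≤ B →
    ℚ.∣ a ℚ.- b ∣ ℚ.≤ e ℚ.* recip B 0<B → ℚ.∣ c ℚ.- d ∣ ℚ.≤ e ℚ.* recip A 0<A →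
    ℚ.∣ a ℚ.* c ℚ.- b ℚ.* d ∣ ℚ.≤ e ℚ.+ e
  product-close a b c d A B e 0<A 0<B 0<e a≤A d≤B ab cd = begin
    ℚ.∣ a ℚ.* c ℚ.- b ℚ.* d ∣
      ≡⟨ cong ℚ.∣_∣ (difference-* a b c d) ⟩
    ℚ.∣ a ℚ.* (c ℚ.- d) ℚ.+ (a ℚ.- b) ℚ.* d ∣
      ≤⟨ ℚₚ.∣p+q∣≤∣p∣+∣q∣ (a ℚ.* (c ℚ.- d)) ((a ℚ.- b) ℚ.* d) ⟩
    ℚ.∣ a ℚ.* (c ℚ.- d) ∣ ℚ.+ ℚ.∣ (a ℚ.- b) ℚ.* d ∣
      ≡⟨ cong₂ ℚ._+_ (ℚₚ.∣p*q∣≡∣p∣*∣q∣ a (c ℚ.- d)) (ℚₚ.∣p*q∣≡∣p∣*∣q∣ (a ℚ.- b) d) ⟩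
    ℚ.∣ a ∣ ℚ.* ℚ.∣ c ℚ.- d ∣ ℚ.+ ℚ.∣ a ℚ.- b ∣ ℚ.* ℚ.∣ d ∣
      ≤⟨ ℚₚ.+-mono-≤
           (*-mono (ℚₚ.0≤∣p∣ a) (ℚₚ.<⇒≤ (pos-* 0<e (recip-pos A 0<A))) a≤A cd)
           (*-mono (ℚₚ.0≤∣p∣ (a ℚ.- b)) (ℚₚ.<⇒≤ 0<B) ab d≤B) ⟩
    A ℚ.* (e ℚ.* recip A 0<A) ℚ.+ e ℚ.* recip B 0<B ℚ.* B
      ≡⟨ collect A (recip A 0<A) B (recip B 0<B) e ⟩
    e ℚ.* (A ℚ.* recip A 0<A) ℚ.+ e ℚ.* (B ℚ.* recip B 0<B)
      ≡⟨ cong₂ ℚ._+_ (unit A 0<A) (unit B 0<B) ⟩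
    e ℚ.+ e ∎
    where
    unit : ∀ p (0<p : 0ℚ ℚ.< p) → e ℚ.* (p ℚ.* recip p 0<p) ≡ e
    unit p 0<p = trans (cong (e ℚ.*_) (recip-inverse p 0<p)) (ℚₚ.*-identityʳ e)

  inverse-close : ∀ a b u v d e → 0ℚ ℚ.< d → 0ℚ ℚ.< e → 0ℚ ℚ.< u → 0ℚ ℚ.< v →
    a ℚ.* u ≡ 1ℚ → b ℚ.* v ≡ 1ℚ → d ℚ.≤ a → d ℚ.≤ b →
    ℚ.∣ a ℚ.- b ∣ ℚ.≤ e ℚ.* (d ℚ.* d) → ℚ.∣ u ℚ.- v ∣ ℚ.≤ e
  inverse-close a b u v d e 0<d 0<e 0<u 0<v au≡1 bv≡1 d≤a d≤b ab = begin
    ℚ.∣ u ℚ.- v ∣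
      ≡⟨ cong ℚ.∣_∣ (cong₂ ℚ._-_ (unit bv≡1 u) (unit au≡1 v)) ⟩
    ℚ.∣ b ℚ.* v ℚ.* u ℚ.- a ℚ.* u ℚ.* v ∣
      ≡⟨ cong ℚ.∣_∣ (difference-inv a b u v) ⟩
    ℚ.∣ ℚ.- (a ℚ.- b) ℚ.* (u ℚ.* v) ∣
      ≡⟨ ℚₚ.∣p*q∣≡∣p∣*∣q∣ (ℚ.- (a ℚ.- b)) (u ℚ.* v) ⟩
    ℚ.∣ ℚ.- (a ℚ.- b) ∣ ℚ.* ℚ.∣ u ℚ.* v ∣
      ≡⟨ cong₂ ℚ._*_ (ℚₚ.∣-p∣≡∣p∣ (a ℚ.- b)) (ℚₚ.0≤p⇒∣p∣≡p 0≤uv) ⟩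
    ℚ.∣ a ℚ.- b ∣ ℚ.* (u ℚ.* v)
      ≤⟨ ℚₚ.*-monoʳ-≤-nonNeg (u ℚ.* v) {{ℚ.nonNegative 0≤uv}} ab ⟩
    e ℚ.* (d ℚ.* d) ℚ.* (u ℚ.* v)
      ≡⟨ regroup e d u v ⟩
    e ℚ.* ((d ℚ.* u) ℚ.* (d ℚ.* v))
      ≤⟨ ℚₚ.*-monoˡ-≤-nonNeg e {{ℚ.nonNegative (ℚₚ.<⇒≤ 0<e)}}
           (*-mono (ℚₚ.<⇒≤ (pos-* 0<d 0<u)) (ℚₚ.nonNegative⁻¹ 1ℚ)
             (bound 0<u d≤a au≡1) (bound 0<v d≤b bv≡1)) ⟩
    e ℚ.* (1ℚ ℚ.* 1ℚ)
      ≡⟨ ℚₚ.*-identityʳ e ⟩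
    e ∎
    where
    0≤uv : 0ℚ ℚ.≤ u ℚ.* v
    0≤uv = ℚₚ.<⇒≤ (pos-* 0<u 0<v)

    unit : ∀ {p} → p ≡ 1ℚ → ∀ q → q ≡ p ℚ.* q
    unit p≡1 q = trans (sym (ℚₚ.*-identityˡ q)) (cong (ℚ._* q) (sym p≡1))

    bound : ∀ {p q} → 0ℚ ℚ.< q → d ℚ.≤ p → p ℚ.* q ≡ 1ℚ → d ℚ.* q ℚ.≤ 1ℚ
    bound {p} {q} 0<q d≤p pq≡1 = subst (d ℚ.* q ℚ.≤_) pq≡1
      (ℚₚ.*-monoʳ-≤-nonNeg q {{ℚ.nonNegative (ℚₚ.<⇒≤ 0<q)}} d≤p)

  record EventuallyBounded (x : ℝ) : Set where
    field
      bound    : ℚ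
      positive : 0ℚ ℚ.< bound
      from     : ℕ
      bounded  : ∀ n → from ℕ.≤ n → ℚ.∣ seq x n ∣ ℚ.≤ bound

  eventuallyBounded : ∀ x → EventuallyBounded x
  eventuallyBounded x with cauchy x 1ℚ (ℚₚ.positive⁻¹ 1ℚ)
  ... | N , close = record
    { bound    = 1ℚ ℚ.+ ℚ.∣ seq x N ∣
    ; positive = ℚₚ.+-mono-<-≤ (ℚₚ.positive⁻¹ 1ℚ) (ℚₚ.0≤∣p∣ (seq x N))
    ; from     = N
    ; bounded  = λ n N≤n → begin
        ℚ.∣ seq x n ∣
          ≡⟨ cong ℚ.∣_∣ (split-+ (seq x n) (seq x N)) ⟩
        ℚ.∣ (seq x n ℚ.- seq x N) ℚ.+ seq x N ∣
          ≤⟨ ℚₚ.∣p+q∣≤∣p∣+∣q∣ (seq x n ℚ.- seq x N) (seq x N) ⟩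
        ℚ.∣ seq x n ℚ.- seq x N ∣ ℚ.+ ℚ.∣ seq x N ∣
          ≤⟨ ℚₚ.+-monoˡ-≤ _ (close n N N≤n ℕₚ.≤-refl) ⟩
        1ℚ ℚ.+ ℚ.∣ seq x N ∣ ∎
    }

infixl 6 _+_ _-_
infixl 7 _*_
infix  8 -_
infixr 8 _^_

fromℚ : ℚ → ℝ
fromℚ q = mkℝ (λ _ → q) λ ε 0<ε → 0 , λ _ _ _ _ →
  subst (ℚ._≤ ε) (sym (cong ℚ.∣_∣ (ℚₚ.+-inverseʳ q))) (ℚₚ.<⇒≤ 0<ε)

fromℕ : ℕ → ℝ
fromℕ n = fromℚ (+ n ℚ./ 1)

0ℝ 1ℝ : ℝ
0ℝ = fromℚ 0ℚ
1ℝ = fromℚ 1ℚ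

_+_ : ℝ → ℝ → ℝ
seq    (x + y) n = seq x n ℚ.+ seq y n
cauchy (x + y) ε 0<ε
  with cauchy x (½ ℚ.* ε) (pos-* 0<½ 0<ε) | cauchy y (½ ℚ.* ε) (pos-* 0<½ 0<ε)
... | N₁ , f | N₂ , g = N₁ ℕ.⊔ N₂ , λ m n N≤m N≤n →
  let a = seq x m ; b = seq x n ; c = seq y m ; d = seq y n in begin
  ℚ.∣ (a ℚ.+ c) ℚ.- (b ℚ.+ d) ∣
    ≡⟨ cong ℚ.∣_∣ (difference-+ a b c d) ⟩
  ℚ.∣ (a ℚ.- b) ℚ.+ (c ℚ.- d) ∣
    ≤⟨ ℚₚ.∣p+q∣≤∣p∣+∣q∣ (a ℚ.- b) (c ℚ.- d) ⟩
  ℚ.∣ a ℚ.- b ∣ ℚ.+ ℚ.∣ c ℚ.- d ∣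
    ≤⟨ ℚₚ.+-mono-≤ (f m n (ℕₚ.m⊔n≤o⇒m≤o N₁ N₂ N≤m) (ℕₚ.m⊔n≤o⇒m≤o N₁ N₂ N≤n))
                   (g m n (ℕₚ.m⊔n≤o⇒n≤o N₁ N₂ N≤m) (ℕₚ.m⊔n≤o⇒n≤o N₁ N₂ N≤n)) ⟩
  ½ ℚ.* ε ℚ.+ ½ ℚ.* ε
    ≡⟨ halves ε ⟩
  ε ∎

-_ : ℝ → ℝ
seq    (- x) n = ℚ.- seq x n
cauchy (- x) ε 0<ε with cauchy x ε 0<ε
... | N , f = N , λ m n N≤m N≤n → let a = seq x m ; b = seq x n in begin
  ℚ.∣ ℚ.- a ℚ.- ℚ.- b ∣
    ≡⟨ cong ℚ.∣_∣ (difference-neg a b) ⟩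
  ℚ.∣ ℚ.- (a ℚ.- b) ∣
    ≡⟨ ℚₚ.∣-p∣≡∣p∣ (a ℚ.- b) ⟩
  ℚ.∣ a ℚ.- b ∣
    ≤⟨ f m n N≤m N≤n ⟩
  ε ∎

_-_ : ℝ → ℝ → ℝ
x - y = x + (- y)

_*_ : ℝ → ℝ → ℝ
seq    (x * y) n = seq x n ℚ.* seq y n
cauchy (x * y) ε 0<ε = N , λ m n N≤m N≤n →
  ℚₚ.≤-trans
    (product-close (seq x m) (seq x n) (seq y m) (seq y n) A B e 0<A 0<B 0<e
      (≤A m (ℕₚ.m⊔n≤o⇒m≤o N₁ N₂ (ℕₚ.m⊔n≤o⇒m≤o (N₁ ℕ.⊔ N₂) (N₃ ℕ.⊔ N₄) N≤m)))
      (≤B n (ℕₚ.m⊔n≤o⇒n≤o N₁ N₂ (ℕₚ.m⊔n≤o⇒m≤o (N₁ ℕ.⊔ N₂) (N₃ ℕ.⊔ N₄) N≤n)))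
      (f m n (ℕₚ.m⊔n≤o⇒m≤o N₃ N₄ (ℕₚ.m⊔n≤o⇒n≤o (N₁ ℕ.⊔ N₂) (N₃ ℕ.⊔ N₄) N≤m))
             (ℕₚ.m⊔n≤o⇒m≤o N₃ N₄ (ℕₚ.m⊔n≤o⇒n≤o (N₁ ℕ.⊔ N₂) (N₃ ℕ.⊔ N₄) N≤n)))
      (g m n (ℕₚ.m⊔n≤o⇒n≤o N₃ N₄ (ℕₚ.m⊔n≤o⇒n≤o (N₁ ℕ.⊔ N₂) (N₃ ℕ.⊔ N₄) N≤m))
             (ℕₚ.m⊔n≤o⇒n≤o N₃ N₄ (ℕₚ.m⊔n≤o⇒n≤o (N₁ ℕ.⊔ N₂) (N₃ ℕ.⊔ N₄) N≤n))))
    (ℚₚ.≤-reflexive (halves ε))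
  where
  e : ℚ
  e = ½ ℚ.* ε

  0<e : 0ℚ ℚ.< e
  0<e = pos-* 0<½ 0<ε

  boundedx : EventuallyBounded x
  boundedx = eventuallyBounded x

  boundedy : EventuallyBounded y
  boundedy = eventuallyBounded y

  open EventuallyBounded boundedx renaming (bound to A; positive to 0<A; from to N₁; bounded to ≤A)
  open EventuallyBounded boundedy renaming (bound to B; positive to 0<B; from to N₂; bounded to ≤B)

  closex : ∃ λ M → ∀ m n → M ℕ.≤ m → M ℕ.≤ n →
           ℚ.∣ seq x m ℚ.- seq x n ∣ ℚ.≤ e ℚ.* recip B 0<B
  closex = cauchy x (e ℚ.* recip B 0<B) (pos-* 0<e (recip-pos B 0<B))

  closey : ∃ λ M → ∀ m n → M ℕ.≤ m → M ℕ.≤ n →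
           ℚ.∣ seq y m ℚ.- seq y n ∣ ℚ.≤ e ℚ.* recip A 0<A
  closey = cauchy y (e ℚ.* recip A 0<A) (pos-* 0<e (recip-pos A 0<A))

  N₃ N₄ N : ℕ
  N₃ = proj₁ closex
  N₄ = proj₁ closey
  N  = (N₁ ℕ.⊔ N₂) ℕ.⊔ (N₃ ℕ.⊔ N₄)

  f = proj₂ closex
  g = proj₂ closey

-- If δ > 0 is an eventual lower bound of x, the sequence 1 / max (xₙ , δ) is
-- total and eventually equal to 1 / xₙ.
inv : (x : ℝ) → 0ℝ < x → ℝ
inv x (δ , 0<δ , N , δ≤x) = mkℝ r close
  where
  t : ℕ → ℚ
  t n = seq x n ℚ.⊔ δ

  0<t : ∀ n → 0ℚ ℚ.< t n
  0<t n = ℚₚ.<-≤-trans 0<δ (ℚₚ.p≤q⊔p (seq x n) δ)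

  r : ℕ → ℚ
  r n = recip (t n) (0<t n)

  t≡x : ∀ n → N ℕ.≤ n → t n ≡ seq x n
  t≡x n N≤n = ℚₚ.p≥q⇒p⊔q≡p (subst (ℚ._≤ seq x n) (ℚₚ.+-identityˡ δ) (δ≤x n N≤n))

  close : ∀ ε → 0ℚ ℚ.< ε → ∃ λ M → ∀ m n → M ℕ.≤ m → M ℕ.≤ n → ℚ.∣ r m ℚ.- r n ∣ ℚ.≤ ε
  close ε 0<ε with cauchy x (ε ℚ.* (δ ℚ.* δ)) (pos-* 0<ε (pos-* 0<δ 0<δ))
  ... | N′ , f = N ℕ.⊔ N′ , λ m n M≤m M≤n →
    inverse-close (t m) (t n) (r m) (r n) δ ε 0<δ 0<ε
      (recip-pos (t m) (0<t m)) (recip-pos (t n) (0<t n))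
      (recip-inverse (t m) (0<t m)) (recip-inverse (t n) (0<t n))
      (ℚₚ.p≤q⊔p (seq x m) δ) (ℚₚ.p≤q⊔p (seq x n) δ)
      (subst (ℚ._≤ ε ℚ.* (δ ℚ.* δ))
        (cong ℚ.∣_∣ (sym (cong₂ ℚ._-_
          (t≡x m (ℕₚ.m⊔n≤o⇒m≤o N N′ M≤m)) (t≡x n (ℕₚ.m⊔n≤o⇒m≤o N N′ M≤n)))))
        (f m n (ℕₚ.m⊔n≤o⇒n≤o N N′ M≤m) (ℕₚ.m⊔n≤o⇒n≤o N N′ M≤n)))

infixl 7 _/_⟨_⟩

_/_⟨_⟩ : ℝ → (y : ℝ) → 0ℝ < y → ℝ
x / y ⟨ 0<y ⟩ = x * inv y 0<y

_^_ : ℝ → ℕ → ℝ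
x ^ zero  = 1ℝ
x ^ suc n = x * x ^ n

∑ : ∀ {n} → (Fin n → ℝ) → ℝ
∑ = Vector.foldr _+_ 0ℝ

TendsTo : (ℕ → ℝ) → ℝ → Set
TendsTo x L = ∀ ε → 0ℝ < ε → ∃ λ N → ∀ n → N ℕ.≤ n → L - ε ≤ x n × x n ≤ L + ε

-- y = bᵃ, for b ≥ 1 and a ≥ 0: since q ↦ b^q is monotone, y is the real that
-- lies above b^q for every rational 0 ≤ q ≤ a and below b^q for every rational
-- q ≥ a.  Here b^(r/s) is the s-th root of b^r, so that comparing it with y
-- amounts to comparing b^r with y^s.
record IsPower (b a y : ℝ) : Set where
  field
    positive : 0ℝ < y
    above    : ∀ r s .{{_ : NonZero s}} → fromℚ (+ r ℚ./ s) ≤ a → b ^ r ≤ y ^ s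
    below    : ∀ r s .{{_ : NonZero s}} → a ≤ fromℚ (+ r ℚ./ s) → y ^ s ≤ b ^ r

-- f(n) ∼ nᵃ as n → ∞.  The limit of f(n)/nᵃ is taken along n = k + 1, so that
-- the denominator is positive.
record _∼n^_ (f : ℕ → ℝ) (a : ℝ) : Set where
  field
    power   : (n : ℕ) .{{_ : NonZero n}} → ℝ
    isPower : (n : ℕ) .{{_ : NonZero n}} → IsPower (fromℕ n) a (power n)
    limit   : TendsTo
      (λ k → f (suc k) / power (suc k) ⟨ IsPower.positive (isPower (suc k)) ⟩) 1ℝ

------------------------------------------------------------------------
-- Finite simple graphs and 𝒢(n,p)

-- A simple graph on Fin n, as a strictly triangular adjacency matrix:
-- S ▷ G adds a new vertex `zero`, joined to `suc j` exactly when j ∈ S.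
infixr 5 _▷_

data Graph : ℕ → Set where
  ∅   : Graph 0
  _▷_ : ∀ {n} → Subset n → Graph n → Graph (suc n)

adj : ∀ {n} → Graph n → Fin n → Fin n → Bool
adj (S ▷ G) zero    zero    = false
adj (S ▷ G) zero    (suc j) = Vec.lookup S j
adj (S ▷ G) (suc i) zero    = Vec.lookup S i
adj (S ▷ G) (suc i) (suc j) = adj G i j

degree : ∀ {n} → Graph n → Fin n → ℕ
degree G u = ∣ Vec.tabulate (adj G u) ∣

Connected : ∀ {n} → Graph n → Set
Connected G = ∀ u v → Star (λ x y → T (adj G x y)) u v

subsets : ∀ n → List (Subset n)
subsets zero    = [] ∷ []
subsets (suc n) = cartesianProductWith _∷_ (true ∷ false ∷ []) (subsets n)

graphs : ∀ n → List (Graph n)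
graphs zero    = ∅ ∷ []
graphs (suc n) = cartesianProductWith _▷_ (subsets n) (graphs n)

edgesWeight : ∀ {n} → ℝ → Subset n → ℝ
edgesWeight p []      = 1ℝ
edgesWeight p (b ∷ S) = (if b then p else 1ℝ - p) * edgesWeight p S

-- The probability of the single graph G under 𝒢(n,p).
weight : ∀ {n} → ℝ → Graph n → ℝ
weight p ∅       = 1ℝ
weight p (S ▷ G) = edgesWeight p S * weight p G

Pr : ∀ {n} → ℝ → (Graph n → Bool) → ℝ
Pr {n} p E = List.foldr _+_ 0ℝ (List.map (weight p) (filterᵇ E (graphs n)))

-- Since E n need not be decidable, "𝒢(n,p(n)) satisfies E n with high
-- probability" says that E n contains decidable events with probability
-- tending to 1.  Classically one can take these to be E n itself.
WithHighProbability : (ℕ → ℝ) → (∀ n → Graph n → Set) → Set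
WithHighProbability p E =
  Σ (∀ n → Graph n → Bool) λ D →
    (∀ n G → T (D n G) → E n G) × TendsTo (λ n → Pr (p n) (D n)) 1ℝ

------------------------------------------------------------------------
-- Markov chains and biased random walks

Matrix : ℕ → Set
Matrix n = Fin n → Fin n → ℝ

record IsStochastic {n} (M : Matrix n) : Set where
  field
    nonNeg : ∀ u v → 0ℝ ≤ M u v
    rowSum : ∀ u → ∑ (M u) ≃ 1ℝ

record IsStationary {n} (M : Matrix n) (π : Fin n → ℝ) : Set where
  field
    nonNeg    : ∀ u → 0ℝ ≤ π u
    total     : ∑ π ≃ 1ℝ
    invariant : ∀ v → ∑ (λ u → π u * M u v) ≃ π v

-- The value at 0 is never used: a vertex with a neighbour has positive degree.
recipℕ : ℕ → ℝ
recipℕ zero    = 0ℝ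
recipℕ (suc d) = fromℚ (+ 1 ℚ./ suc d)

simpleRandomWalk : ∀ {n} → Graph n → Matrix n
simpleRandomWalk G u v = if adj G u v then recipℕ (degree G u) else 0ℝ

SupportedOnEdges : ∀ {n} → Graph n → Matrix n → Set
SupportedOnEdges G M = ∀ u v → adj G u v ≡ false → M u v ≃ 0ℝ

biasedWalk : ∀ {n} → Graph n → ℝ → Matrix n → Matrix n
biasedWalk G ε B u v = (1ℝ - ε) * simpleRandomWalk G u v + ε * B u v

-- On a vertex of degree d the (β/(np))-biased walk satisfies Q ≤ (1 + β d/(np)) P entrywise.
-- If every degree is at most t np, then π_Q = π_Q Qᵏ ≤ (1 + β t)ᵏ π_Q Pᵏ, and if the entries of
-- each column of Pᵏ agree up to a factor 2, then π_Q Pᵏ ≤ 2 π.  With k ≤ 6/α and t close to 1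
-- this is the bound; positivity of Pᵏ gives connectedness.
--
-- Such graphs are typical as soon as k > 3/α.  Let M = (A - p)/(np).  Expand tr M²ᵏ and the
-- 2k-th powers of the row sums of M over walks: in expectation only walks using every edge at
-- least twice survive, these reach at most k new vertices, and the expectations are
-- O(n (np)⁻ᵏ) and O((np)⁻ᵏ).  Since (np)ᵏ ≫ n³, by Markov all entries of Mᵏ are o(1/n) and all
-- row sums of M are o(1), which forces the entries of (A/(np))ᵏ, and then of Pᵏ, to be close
-- to 1/n.
--
-- The m-th rational approximation of Pr p E is the probability of E for the m-th rational
-- approximation of p, so the probabilistic estimates only concern rational edge probabilities.
module Submission where

open import Algebra.Bundles using (CommutativeRing)
open import Data.Bool.Base using (Bool; true; false; if_then_else_; _∧_; _∨_)
import Data.Bool.Properties as 𝔹ₚ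
open import Data.Fin.Base using (Fin; zero; suc)
import Data.Fin.Properties as Finₚ
import Data.Fin.Subset as Subset
open import Data.Fin.Subset using (Subset)
open import Data.Integer.Base as ℤ using (+_; -[1+_])
import Data.Integer.Properties as ℤₚ
open import Data.List.Base as List using (List; []; _∷_; _++_; length; cartesianProductWith; filterᵇ)
open import Data.Nat.Base as ℕ using (ℕ; zero; suc)
open import Data.Nat.DivMod using (m%n<n; m/n*n≤m; m≡m%n+[m/n]*n)
import Data.Nat.Properties as ℕₚ
open import Data.Product.Base using (∃; _×_; _,_; proj₁; proj₂)
import Data.Rational.Properties as ℚₚ
open import Data.Rational.Solver using (module +-*-Solver)
import Data.Rational.Unnormalised.Base as ℚᵘ
import Data.Rational.Unnormalised.Properties as ℚᵘₚ
open import Data.Sum.Base using (_⊎_; inj₁; inj₂)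
open import Data.Unit.Base using (tt)
open import Data.Vec.Base as Vec using ([]; _∷_)
open import Function.Base using (_∘_)
open import Relation.Binary.Construct.Closure.ReflexiveTransitive using (Star; _◅_)
open import Relation.Binary.PropositionalEquality
  using (_≡_; refl; sym; trans; cong; cong₂; subst; subst₂; module ≡-Reasoning)
open import Relation.Nullary.Decidable using (Dec; does; yes; no; _×-dec_)
open import Relation.Nullary.Negation using (contradiction)
open +-*-Solver using (solve; con; _:=_; _:+_; _:*_; _:-_; :-_)

-- The trace is a sum of n diagonal moments of order κᵏ with κ = 1/(np), and entries of Mᵏ below τ/n
-- are wanted, which costs a further n²: this is the n³ behind k > 3/α. As α ≤ 1, an integer k ≤ 3/α
-- + 1 ≤ 4/α would do; but powers of n are compared at rational exponents only, so α gives way to a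
-- rational lower bound, and 6/α covers this loss. The factor 3 is the 2 from the columns of Pᵏ
-- times 3/2 from tᵏ.
--
-- An edge used c ≥ 2 times contributes at most κ^(c/2) ι to an expectation, with ι = 1/n. Over a
-- walk of length 2k the powers of κ multiply to κᵏ, and each ι pays for the n choices of a new
-- vertex. As κ^(c/2) may be irrational, squares are bounded until the total length, which is even,
-- is known.
--
-- The order on ℝ is undecidable, but the event has to be decidable. Hence it speaks of the rational
-- matrix P and of a rational bound on the degrees, and graphs are treated over ℚ; reals enter with
-- β, p and the stationary distributions.

module Rat where

  open import Defs using (Graph; ∅; _▷_; adj; degree)
  open import Data.Rational.Base hiding (_≃_)
  open ℚₚ using (≤-refl; ≤-trans; ≤-reflexive; <⇒≤; module ≤-Reasoning)
  open import Algebra.Properties.Semiring.Sum (CommutativeRing.semiring ℚₚ.+-*-commutativeRing) public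
    using (sum; sum-cong-≗; ∑-distrib-+; ∑-comm; *-distribˡ-sum; *-distribʳ-sum)
  open import Algebra.Properties.CommutativeSemiring.Exp (CommutativeRing.commutativeSemiring ℚₚ.+-*-commutativeRing) public
    using (_^_; ^-distrib-*; ^-homo-*; ^-assocʳ)
  open import Algebra.Properties.CommutativeMonoid.Sum ℚₚ.*-1-commutativeMonoid public
    using () renaming (sum to prod; sum-cong-≗ to prod-cong; ∑-distrib-+ to prod-*; sum-replicate-zero to prod-1)

  -- Rational arithmetic

  0≤1 : 0ℚ ≤ 1ℚ
  0≤1 = ℚₚ.nonNegative⁻¹ 1ℚ

  0<1 : 0ℚ < 1ℚ
  0<1 = ℚₚ.positive⁻¹ 1ℚ

  +-nonNeg : ∀ {p q} → 0ℚ ≤ p → 0ℚ ≤ q → 0ℚ ≤ p + q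
  +-nonNeg = ℚₚ.+-mono-≤

  *-nonNeg : ∀ {p q} → 0ℚ ≤ p → 0ℚ ≤ q → 0ℚ ≤ p * q
  *-nonNeg {p} {q} 0≤p 0≤q =
    ℚₚ.nonNegative⁻¹ _ {{ℚₚ.nonNeg*nonNeg⇒nonNeg p {{nonNegative 0≤p}} q {{nonNegative 0≤q}}}}

  *-pos : ∀ {p q} → 0ℚ < p → 0ℚ < q → 0ℚ < p * q
  *-pos {p} {q} 0<p 0<q = ℚₚ.positive⁻¹ _ {{ℚₚ.pos*pos⇒pos p {{positive 0<p}} q {{positive 0<q}}}}

  square-nonNeg : ∀ p → 0ℚ ≤ p * p
  square-nonNeg p with ℚₚ.≤-total 0ℚ p
  ... | inj₁ 0≤p = *-nonNeg 0≤p 0≤p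
  ... | inj₂ p≤0 = subst (0ℚ ≤_) (solve 1 (λ p → (:- p) :* (:- p) := p :* p) refl p)
                     (*-nonNeg (ℚₚ.neg-antimono-≤ p≤0) (ℚₚ.neg-antimono-≤ p≤0))

  ≤⇒0≤- : ∀ {p q} → p ≤ q → 0ℚ ≤ q - p
  ≤⇒0≤- {p} {q} p≤q = subst (_≤ q - p) (ℚₚ.+-inverseʳ p) (ℚₚ.+-monoˡ-≤ (- p) p≤q)

  0≤-⇒≤ : ∀ {p q} → 0ℚ ≤ q - p → p ≤ q
  0≤-⇒≤ {p} {q} 0≤ = subst₂ _≤_ (ℚₚ.+-identityʳ p)
    (solve 2 (λ p q → p :+ (q :- p) := q) refl p q) (ℚₚ.+-monoʳ-≤ p 0≤)

  -- The usual form of an inequality below: the ring solver identifies the difference of the two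
  -- sides with an expression whose sign is evident.
  ≤-because : ∀ {p q d} → 0ℚ ≤ d → q - p ≡ d → p ≤ q
  ≤-because 0≤d eq = 0≤-⇒≤ (subst (0ℚ ≤_) (sym eq) 0≤d)

  *-monoˡ : ∀ {p q r} → 0ℚ ≤ r → p ≤ q → r * p ≤ r * q
  *-monoˡ {r = r} 0≤r = ℚₚ.*-monoˡ-≤-nonNeg r {{nonNegative 0≤r}}

  *-monoʳ : ∀ {p q r} → 0ℚ ≤ r → p ≤ q → p * r ≤ q * r
  *-monoʳ {r = r} 0≤r = ℚₚ.*-monoʳ-≤-nonNeg r {{nonNegative 0≤r}}

  *-mono : ∀ {p q r s} → 0ℚ ≤ p → 0ℚ ≤ s → p ≤ q → r ≤ s → p * r ≤ q * s
  *-mono 0≤p 0≤s p≤q r≤s = ≤-trans (*-monoˡ 0≤p r≤s) (*-monoʳ 0≤s p≤q)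

  *-cancelˡ : ∀ {p q r} → 0ℚ < r → r * p ≤ r * q → p ≤ q
  *-cancelˡ {r = r} 0<r = ℚₚ.*-cancelˡ-≤-pos r {{positive 0<r}}

  square-cancel-≤ : ∀ {p q} → 0ℚ ≤ q → p * p ≤ q * q → p ≤ q
  square-cancel-≤ {p} {q} 0≤q pp≤qq = ℚₚ.≮⇒≥ λ q<p → ℚₚ.<-irrefl refl (ℚₚ.<-≤-trans
    (ℚₚ.≤-<-trans (*-monoˡ 0≤q (<⇒≤ q<p))
      (ℚₚ.*-monoˡ-<-pos p {{positive (ℚₚ.≤-<-trans 0≤q q<p)}} q<p))
    pp≤qq)

  ^-nonNeg : ∀ {p} n → 0ℚ ≤ p → 0ℚ ≤ p ^ n
  ^-nonNeg zero    0≤p = 0≤1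
  ^-nonNeg (suc n) 0≤p = *-nonNeg 0≤p (^-nonNeg n 0≤p)

  ^-pos : ∀ {p} n → 0ℚ < p → 0ℚ < p ^ n
  ^-pos zero    0<p = 0<1
  ^-pos (suc n) 0<p = *-pos 0<p (^-pos n 0<p)

  ^-mono-≤ : ∀ {p q} n → 0ℚ ≤ p → p ≤ q → p ^ n ≤ q ^ n
  ^-mono-≤ zero    0≤p p≤q = ≤-refl
  ^-mono-≤ (suc n) 0≤p p≤q = *-mono 0≤p (^-nonNeg n (≤-trans 0≤p p≤q)) p≤q (^-mono-≤ n 0≤p p≤q)

  ^-≤1 : ∀ {p} n → 0ℚ ≤ p → p ≤ 1ℚ → p ^ n ≤ 1ℚ
  ^-≤1 zero    0≤p p≤1 = ≤-refl
  ^-≤1 (suc n) 0≤p p≤1 = *-mono 0≤p 0≤1 p≤1 (^-≤1 n 0≤p p≤1)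

  1≤^ : ∀ {p} n → 1ℚ ≤ p → 1ℚ ≤ p ^ n
  1≤^ zero    1≤p = ≤-refl
  1≤^ (suc n) 1≤p = *-mono 0≤1 (^-nonNeg n (≤-trans 0≤1 1≤p)) 1≤p (1≤^ n 1≤p)

  1^ : ∀ n → 1ℚ ^ n ≡ 1ℚ
  1^ zero    = refl
  1^ (suc n) = trans (ℚₚ.*-identityˡ _) (1^ n)

  ⟦_⟧ : ℕ → ℚ
  ⟦ n ⟧ = + n / 1

  toℚᵘ-/1 : ∀ i → toℚᵘ (i / 1) ℚᵘ.≃ ℚᵘ.mkℚᵘ i 0
  toℚᵘ-/1 i = ℚₚ.toℚᵘ-fromℚᵘ (ℚᵘ.mkℚᵘ i 0)

  ⟦⟧-+ : ∀ m n → ⟦ m ℕ.+ n ⟧ ≡ ⟦ m ⟧ + ⟦ n ⟧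
  ⟦⟧-+ m n = ℚₚ.toℚᵘ-injective (begin
    toℚᵘ ⟦ m ℕ.+ n ⟧                     ≈⟨ toℚᵘ-/1 (+ (m ℕ.+ n)) ⟩
    ℚᵘ.mkℚᵘ (+ (m ℕ.+ n)) 0              ≈⟨ ℚᵘ.*≡* (cong (ℤ._* + 1) (cong₂ ℤ._+_ (sym (ℤₚ.*-identityʳ (+ m))) (sym (ℤₚ.*-identityʳ (+ n))))) ⟩
    ℚᵘ.mkℚᵘ (+ m) 0 ℚᵘ.+ ℚᵘ.mkℚᵘ (+ n) 0 ≈⟨ ℚᵘₚ.+-cong (toℚᵘ-/1 (+ m)) (toℚᵘ-/1 (+ n)) ⟨
    toℚᵘ ⟦ m ⟧ ℚᵘ.+ toℚᵘ ⟦ n ⟧           ≈⟨ ℚₚ.toℚᵘ-homo-+ ⟦ m ⟧ ⟦ n ⟧ ⟨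
    toℚᵘ (⟦ m ⟧ + ⟦ n ⟧)                 ∎)
    where open ℚᵘₚ.≃-Reasoning

  ⟦⟧-suc : ∀ n → ⟦ suc n ⟧ ≡ 1ℚ + ⟦ n ⟧
  ⟦⟧-suc = ⟦⟧-+ 1

  ⟦⟧-nonNeg : ∀ n → 0ℚ ≤ ⟦ n ⟧
  ⟦⟧-nonNeg n = ℚₚ.nonNegative⁻¹ _ {{ℚₚ.normalize-nonNeg n 1}}

  ⟦⟧-pos : ∀ n .{{_ : ℕ.NonZero n}} → 0ℚ < ⟦ n ⟧
  ⟦⟧-pos n = ℚₚ.positive⁻¹ _ {{ℚₚ.normalize-pos n 1}}

  ⟦⟧-mono : ∀ {m n} → m ℕ.≤ n → ⟦ m ⟧ ≤ ⟦ n ⟧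
  ⟦⟧-mono {m} {n} m≤n = subst (⟦ m ⟧ ≤_)
    (trans (sym (⟦⟧-+ m (n ℕ.∸ m))) (cong ⟦_⟧ (ℕₚ.m+[n∸m]≡n m≤n)))
    (subst (_≤ ⟦ m ⟧ + ⟦ n ℕ.∸ m ⟧) (ℚₚ.+-identityʳ ⟦ m ⟧) (ℚₚ.+-monoʳ-≤ ⟦ m ⟧ (⟦⟧-nonNeg (n ℕ.∸ m))))

  ⟦⟧-* : ∀ m n → ⟦ m ℕ.* n ⟧ ≡ ⟦ m ⟧ * ⟦ n ⟧
  ⟦⟧-* zero    n = sym (ℚₚ.*-zeroˡ ⟦ n ⟧)
  ⟦⟧-* (suc m) n = begin
    ⟦ n ℕ.+ m ℕ.* n ⟧      ≡⟨ ⟦⟧-+ n (m ℕ.* n) ⟩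
    ⟦ n ⟧ + ⟦ m ℕ.* n ⟧    ≡⟨ cong (λ z → ⟦ n ⟧ + z) (⟦⟧-* m n) ⟩
    ⟦ n ⟧ + ⟦ m ⟧ * ⟦ n ⟧  ≡⟨ solve 2 (λ m n → n :+ m :* n := (con 1ℚ :+ m) :* n) refl ⟦ m ⟧ ⟦ n ⟧ ⟩
    (1ℚ + ⟦ m ⟧) * ⟦ n ⟧   ≡⟨ cong (_* ⟦ n ⟧) (⟦⟧-suc m) ⟨
    ⟦ suc m ⟧ * ⟦ n ⟧      ∎
    where open ≡-Reasoning

  ⟦⟧-^ : ∀ m n → ⟦ m ℕ.^ n ⟧ ≡ ⟦ m ⟧ ^ n
  ⟦⟧-^ m zero    = refl
  ⟦⟧-^ m (suc n) = trans (⟦⟧-* m (m ℕ.^ n)) (cong (⟦ m ⟧ *_) (⟦⟧-^ m n))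

  archimedean : ∀ p → ∃ λ n → p ≤ ⟦ n ⟧
  archimedean (mkℚ (+ n) d c) = n , ℚₚ.toℚᵘ-cancel-≤ (ℚᵘₚ.≤-respʳ-≃ (ℚᵘₚ.≃-sym (toℚᵘ-/1 (+ n)))
    (ℚᵘ.*≤* (ℤₚ.*-monoˡ-≤-nonNeg (+ n) (ℤ.+≤+ (ℕ.s≤s ℕ.z≤n)))))
  archimedean p@(mkℚ -[1+ n ] d c) = 0 , <⇒≤ (ℚₚ.negative⁻¹ p)

  bernoulli : ∀ {p} n → 0ℚ ≤ p → p ≤ 1ℚ → 1ℚ - ⟦ n ⟧ * p ≤ (1ℚ - p) ^ n
  bernoulli {p} zero    0≤p p≤1 = ≤-reflexive (solve 1 (λ p → con 1ℚ :- con 0ℚ :* p := con 1ℚ) refl p)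
  bernoulli {p} (suc n) 0≤p p≤1 = begin
    1ℚ - ⟦ suc n ⟧ * p         ≡⟨ cong (λ z → 1ℚ - z * p) (⟦⟧-suc n) ⟩
    1ℚ - (1ℚ + ⟦ n ⟧) * p      ≤⟨ ≤-because (*-nonNeg (⟦⟧-nonNeg n) (square-nonNeg p))
                                   (solve 2 (λ p n → (con 1ℚ :- p) :* (con 1ℚ :- n :* p) :- (con 1ℚ :- (con 1ℚ :+ n) :* p) := n :* (p :* p)) refl p ⟦ n ⟧) ⟩
    (1ℚ - p) * (1ℚ - ⟦ n ⟧ * p) ≤⟨ *-monoˡ (≤⇒0≤- p≤1) (bernoulli n 0≤p p≤1) ⟩
    (1ℚ - p) * (1ℚ - p) ^ n    ∎
    where open ≤-Reasoning

  sum-mono : ∀ {n} {f g : Fin n → ℚ} → (∀ i → f i ≤ g i) → sum f ≤ sum g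
  sum-mono {zero}  f≤g = ≤-refl
  sum-mono {suc n} f≤g = ℚₚ.+-mono-≤ (f≤g zero) (sum-mono (f≤g ∘ suc))

  sum-nonNeg : ∀ {n} {f : Fin n → ℚ} → (∀ i → 0ℚ ≤ f i) → 0ℚ ≤ sum f
  sum-nonNeg {zero}  0≤f = ≤-refl
  sum-nonNeg {suc n} 0≤f = +-nonNeg (0≤f zero) (sum-nonNeg (0≤f ∘ suc))

  sum-const : ∀ n c → sum {n} (λ _ → c) ≡ ⟦ n ⟧ * c
  sum-const zero    c = sym (ℚₚ.*-zeroˡ c)
  sum-const (suc n) c = begin
    c + sum {n} (λ _ → c)  ≡⟨ cong (λ z → c + z) (sum-const n c) ⟩
    c + ⟦ n ⟧ * c          ≡⟨ solve 2 (λ n c → c :+ n :* c := (con 1ℚ :+ n) :* c) refl ⟦ n ⟧ c ⟩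
    (1ℚ + ⟦ n ⟧) * c       ≡⟨ cong (_* c) (⟦⟧-suc n) ⟨
    ⟦ suc n ⟧ * c          ∎
    where open ≡-Reasoning

  term≤sum : ∀ {n} {f : Fin n → ℚ} → (∀ i → 0ℚ ≤ f i) → ∀ i → f i ≤ sum f
  term≤sum {suc n} {f} 0≤f zero    = subst (_≤ sum f) (ℚₚ.+-identityʳ (f zero)) (ℚₚ.+-monoʳ-≤ (f zero) (sum-nonNeg (0≤f ∘ suc)))
  term≤sum {suc n} {f} 0≤f (suc i) = subst (_≤ sum f) (ℚₚ.+-identityˡ (f (suc i))) (ℚₚ.+-mono-≤ (0≤f zero) (term≤sum (0≤f ∘ suc) i))

  -- Expectation under 𝒢(n,q)

  infix 4 _==_

  _==_ : ∀ {n} → Fin n → Fin n → Bool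
  zero  == zero  = true
  zero  == suc j = false
  suc i == zero  = false
  suc i == suc j = i == j

  ==-refl : ∀ {n} (i : Fin n) → (i == i) ≡ true
  ==-refl zero    = refl
  ==-refl (suc i) = ==-refl i

  ==⇒≡ : ∀ {n} (i j : Fin n) → (i == j) ≡ true → i ≡ j
  ==⇒≡ zero    zero    _  = refl
  ==⇒≡ (suc i) (suc j) eq = cong suc (==⇒≡ i j eq)

  ==-sym : ∀ {n} (i j : Fin n) → (i == j) ≡ (j == i)
  ==-sym zero    zero    = refl
  ==-sym zero    (suc j) = refl
  ==-sym (suc i) zero    = refl
  ==-sym (suc i) (suc j) = ==-sym i j

  -- A normalised, monotone linear functional stands for a probability measure. Expectations under
  -- 𝒢(n,q) can then be built coin by coin, and the list of all graphs enters only when `Pr` is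
  -- evaluated.
  record Expectation (A : Set) : Set where
    field
      𝔼       : (A → ℚ) → ℚ
      𝔼-cong  : ∀ {f g} → (∀ a → f a ≡ g a) → 𝔼 f ≡ 𝔼 g
      𝔼-+     : ∀ f g → 𝔼 (λ a → f a + g a) ≡ 𝔼 f + 𝔼 g
      𝔼-*     : ∀ c f → 𝔼 (λ a → c * f a) ≡ c * 𝔼 f
      𝔼-const : ∀ c → 𝔼 (λ _ → c) ≡ c
      𝔼-mono  : ∀ {f g} → (∀ a → f a ≤ g a) → 𝔼 f ≤ 𝔼 g

    𝔼-sum : ∀ {n} (f : Fin n → A → ℚ) → 𝔼 (λ a → sum (λ i → f i a)) ≡ sum (λ i → 𝔼 (f i))
    𝔼-sum {zero}  f = 𝔼-const 0ℚ
    𝔼-sum {suc n} f = trans (𝔼-+ (f zero) (λ a → sum (λ i → f (suc i) a)))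
      (cong (λ z → 𝔼 (f zero) + z) (𝔼-sum (f ∘ suc)))

    𝔼-*ʳ : ∀ f c → 𝔼 (λ a → f a * c) ≡ 𝔼 f * c
    𝔼-*ʳ f c = trans (𝔼-cong (λ a → ℚₚ.*-comm (f a) c)) (trans (𝔼-* c f) (ℚₚ.*-comm c (𝔼 f)))

  open Expectation

  point : ∀ {A} → A → Expectation A
  point a = record
    { 𝔼       = λ f → f a
    ; 𝔼-cong  = λ f≡g → f≡g a
    ; 𝔼-+     = λ f g → refl
    ; 𝔼-*     = λ c f → refl
    ; 𝔼-const = λ c → refl
    ; 𝔼-mono  = λ f≤g → f≤g a
    }

  independent : ∀ {A B C} → (A → B → C) → Expectation A → Expectation B → Expectation C
  independent h X Y = record
    { 𝔼       = λ f → 𝔼 X (λ a → 𝔼 Y (λ b → f (h a b)))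
    ; 𝔼-cong  = λ f≡g → 𝔼-cong X λ a → 𝔼-cong Y λ b → f≡g (h a b)
    ; 𝔼-+     = λ f g → trans (𝔼-cong X λ a → 𝔼-+ Y (f ∘ h a) (g ∘ h a)) (𝔼-+ X _ _)
    ; 𝔼-*     = λ c f → trans (𝔼-cong X λ a → 𝔼-* Y c (f ∘ h a)) (𝔼-* X c _)
    ; 𝔼-const = λ c → trans (𝔼-cong X λ a → 𝔼-const Y c) (𝔼-const X c)
    ; 𝔼-mono  = λ f≤g → 𝔼-mono X λ a → 𝔼-mono Y λ b → f≤g (h a b)
    }

  𝔼-product : ∀ {A B} (X : Expectation A) (Y : Expectation B) f g →
    𝔼 X (λ a → 𝔼 Y (λ b → f a * g b)) ≡ 𝔼 X f * 𝔼 Y g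
  𝔼-product X Y f g = trans (𝔼-cong X λ a → 𝔼-* Y (f a) g) (𝔼-*ʳ X f (𝔼 Y g))

  -- The product over the pairs i ≤ j, by the same triangular recursion as `Graph`, so that each
  -- edge variable occurs in exactly one factor. The diagonal is included because the centred matrix
  -- does not vanish there.
  ∏▽ : ∀ {n} → (Fin n → Fin n → ℚ) → ℚ
  ∏▽ {zero}  F = 1ℚ
  ∏▽ {suc n} F = F zero zero * prod (λ j → F zero (suc j)) * ∏▽ (λ i j → F (suc i) (suc j))

  prod-nonNeg : ∀ {n} {f : Fin n → ℚ} → (∀ i → 0ℚ ≤ f i) → 0ℚ ≤ prod f
  prod-nonNeg {zero}  0≤f = 0≤1
  prod-nonNeg {suc n} 0≤f = *-nonNeg (0≤f zero) (prod-nonNeg (0≤f ∘ suc))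

  prod-mono : ∀ {n} {f g : Fin n → ℚ} → (∀ i → 0ℚ ≤ f i) → (∀ i → f i ≤ g i) → prod f ≤ prod g
  prod-mono {zero}  0≤f f≤g = ≤-refl
  prod-mono {suc n} 0≤f f≤g = *-mono (0≤f zero)
    (prod-nonNeg (λ i → ≤-trans (0≤f (suc i)) (f≤g (suc i)))) (f≤g zero) (prod-mono (0≤f ∘ suc) (f≤g ∘ suc))

  ∏▽-cong : ∀ {n} {F G : Fin n → Fin n → ℚ} → (∀ i j → F i j ≡ G i j) → ∏▽ F ≡ ∏▽ G
  ∏▽-cong {zero}  F≡G = refl
  ∏▽-cong {suc n} F≡G = cong₂ _*_ (cong₂ _*_ (F≡G zero zero) (prod-cong (λ j → F≡G zero (suc j))))
    (∏▽-cong (λ i j → F≡G (suc i) (suc j)))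

  ∏▽-nonNeg : ∀ {n} {F : Fin n → Fin n → ℚ} → (∀ i j → 0ℚ ≤ F i j) → 0ℚ ≤ ∏▽ F
  ∏▽-nonNeg {zero}  0≤F = 0≤1
  ∏▽-nonNeg {suc n} 0≤F = *-nonNeg (*-nonNeg (0≤F zero zero) (prod-nonNeg (λ j → 0≤F zero (suc j))))
    (∏▽-nonNeg (λ i j → 0≤F (suc i) (suc j)))

  ∏▽-mono : ∀ {n} {F G : Fin n → Fin n → ℚ} → (∀ i j → 0ℚ ≤ F i j) → (∀ i j → F i j ≤ G i j) → ∏▽ F ≤ ∏▽ G
  ∏▽-mono {zero}  0≤F F≤G = ≤-refl
  ∏▽-mono {suc n} {F} {G} 0≤F F≤G = *-mono
    (*-nonNeg (0≤F zero zero) (prod-nonNeg (λ j → 0≤F zero (suc j))))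
    (∏▽-nonNeg (λ i j → 0≤G (suc i) (suc j)))
    (*-mono (0≤F zero zero) (prod-nonNeg (λ j → 0≤G zero (suc j)))
      (F≤G zero zero) (prod-mono (λ j → 0≤F zero (suc j)) (λ j → F≤G zero (suc j))))
    (∏▽-mono (λ i j → 0≤F (suc i) (suc j)) (λ i j → F≤G (suc i) (suc j)))
    where
    0≤G : ∀ i j → 0ℚ ≤ G i j
    0≤G i j = ≤-trans (0≤F i j) (F≤G i j)

  ∏▽-1 : ∀ n → ∏▽ {n} (λ _ _ → 1ℚ) ≡ 1ℚ
  ∏▽-1 zero    = refl
  ∏▽-1 (suc n) = cong₂ (λ x y → 1ℚ * x * y) (prod-1 n) (∏▽-1 n)

  ∏▽-* : ∀ {n} (F G : Fin n → Fin n → ℚ) → ∏▽ (λ i j → F i j * G i j) ≡ ∏▽ F * ∏▽ G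
  ∏▽-* {zero}  F G = refl
  ∏▽-* {suc n} F G = trans
    (cong₂ (λ x y → F zero zero * G zero zero * x * y)
      (prod-* (λ j → F zero (suc j)) (λ j → G zero (suc j)))
      (∏▽-* (λ i j → F (suc i) (suc j)) (λ i j → G (suc i) (suc j))))
    (solve 6 (λ a b c d e f → a :* b :* (c :* d) :* (e :* f) := a :* c :* e :* (b :* d :* f)) refl
      (F zero zero) (G zero zero) _ _ _ _)

  same : ∀ {n} → Fin n → Fin n → Fin n → Fin n → Bool
  same x z i j = ((x == i) ∧ (z == j)) ∨ ((x == j) ∧ (z == i))

  if-cong : ∀ {a} {A : Set a} {b c : Bool} {x y : A} → b ≡ c → (if b then x else y) ≡ (if c then x else y)
  if-cong refl = refl

  prod-single : ∀ {n} (f : Fin n → ℚ) i → prod (λ j → if i == j then f j else 1ℚ) ≡ f i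
  prod-single {suc n} f zero    = trans (cong (f zero *_) (prod-1 n)) (ℚₚ.*-identityʳ (f zero))
  prod-single {suc n} f (suc i) = trans (ℚₚ.*-identityˡ _) (prod-single (f ∘ suc) i)

  -- Only one pair i ≤ j equals {x, z} as an unordered pair. If z < x, it is (z, x), and symmetry of
  -- F turns its factor back into F x z.
  ∏▽-single : ∀ {n} (F : Fin n → Fin n → ℚ) → (∀ i j → F i j ≡ F j i) → ∀ x z →
    ∏▽ (λ i j → if same x z i j then F i j else 1ℚ) ≡ F x z
  ∏▽-single {suc n} F sym-F zero zero =
    trans (cong₂ (λ x y → F zero zero * x * y) (prod-1 n) (∏▽-1 n))
          (solve 1 (λ a → a :* con 1ℚ :* con 1ℚ := a) refl (F zero zero))
  ∏▽-single {suc n} F sym-F zero (suc z) =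
    trans (cong₂ (λ x y → 1ℚ * x * y)
            (trans (prod-cong (λ j → if-cong (𝔹ₚ.∨-identityʳ (z == j)))) (prod-single (λ j → F zero (suc j)) z))
            (∏▽-1 n))
          (solve 1 (λ a → con 1ℚ :* a :* con 1ℚ := a) refl (F zero (suc z)))
  ∏▽-single {suc n} F sym-F (suc x) zero =
    trans (cong₂ (λ x y → 1ℚ * x * y)
            (trans (prod-cong (λ j → if-cong (𝔹ₚ.∧-identityʳ (x == j)))) (prod-single (λ j → F zero (suc j)) x))
            (trans (∏▽-cong (λ i j → if-cong (cong₂ _∨_ (𝔹ₚ.∧-zeroʳ (x == i)) (𝔹ₚ.∧-zeroʳ (x == j))))) (∏▽-1 n)))
          (trans (solve 1 (λ a → con 1ℚ :* a :* con 1ℚ := a) refl (F zero (suc x))) (sym-F zero (suc x)))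
  ∏▽-single {suc n} F sym-F (suc x) (suc z) =
    trans (cong₂ (λ x y → 1ℚ * x * y)
            (trans (prod-cong (λ j → if-cong (𝔹ₚ.∧-zeroʳ (x == j)))) (prod-1 n))
            (∏▽-single (λ i j → F (suc i) (suc j)) (λ i j → sym-F (suc i) (suc j)) x z))
          (solve 1 (λ a → con 1ℚ :* con 1ℚ :* a := a) refl (F (suc x) (suc z)))

  Edges : ℕ → Set
  Edges n = List (Fin n × Fin n)

  count : ∀ {n} → Edges n → Fin n → Fin n → ℕ
  count []             i j = 0
  count ((x , z) ∷ es) i j = if same x z i j then suc (count es i j) else count es i j

  edgeProd : ∀ {n} → (Fin n → Fin n → ℚ) → Edges n → ℚ
  edgeProd M []             = 1ℚ
  edgeProd M ((x , z) ∷ es) = M x z * edgeProd M es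

  -- Collects the factors of a walk by the edge they traverse, in either direction. The factors of a
  -- walk are dependent, whereas those for distinct edges are independent.
  edgeProd≡∏▽ : ∀ {n} (M : Fin n → Fin n → ℚ) → (∀ i j → M i j ≡ M j i) → ∀ es →
    edgeProd M es ≡ ∏▽ (λ i j → M i j ^ count es i j)
  edgeProd≡∏▽ {n} M sym-M []             = sym (∏▽-1 n)
  edgeProd≡∏▽ {n} M sym-M ((x , z) ∷ es) = begin
    M x z * edgeProd M es
      ≡⟨ cong₂ _*_ (∏▽-single M sym-M x z) (sym (edgeProd≡∏▽ M sym-M es)) ⟨
    ∏▽ (λ i j → if same x z i j then M i j else 1ℚ) * ∏▽ (λ i j → M i j ^ count es i j)
      ≡⟨ ∏▽-* {n} _ _ ⟨
    ∏▽ (λ i j → (if same x z i j then M i j else 1ℚ) * M i j ^ count es i j)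
      ≡⟨ ∏▽-cong step ⟩
    ∏▽ (λ i j → M i j ^ count ((x , z) ∷ es) i j) ∎
    where
    open ≡-Reasoning
    step : ∀ i j → (if same x z i j then M i j else 1ℚ) * M i j ^ count es i j ≡ M i j ^ count ((x , z) ∷ es) i j
    step i j with same x z i j
    ... | true  = refl
    ... | false = ℚₚ.*-identityˡ _

  adj-sym : ∀ {n} (G : Graph n) i j → adj G i j ≡ adj G j i
  adj-sym (S ▷ G) zero    zero    = refl
  adj-sym (S ▷ G) zero    (suc j) = refl
  adj-sym (S ▷ G) (suc i) zero    = refl
  adj-sym (S ▷ G) (suc i) (suc j) = adj-sym G i j

  module ErdősRényi (q : ℚ) (0≤q : 0ℚ ≤ q) (q≤1 : q ≤ 1ℚ) where

    coin : Expectation Bool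
    coin = record
      { 𝔼       = λ f → q * f true + (1ℚ - q) * f false
      ; 𝔼-cong  = λ f≡g → cong₂ (λ x y → q * x + (1ℚ - q) * y) (f≡g true) (f≡g false)
      ; 𝔼-+     = λ f g → solve 5 (λ q a b c d → q :* (a :+ c) :+ (con 1ℚ :- q) :* (b :+ d) :=
                    q :* a :+ (con 1ℚ :- q) :* b :+ (q :* c :+ (con 1ℚ :- q) :* d)) refl
                    q (f true) (f false) (g true) (g false)
      ; 𝔼-*     = λ c f → solve 4 (λ q a b c → q :* (c :* a) :+ (con 1ℚ :- q) :* (c :* b) :=
                    c :* (q :* a :+ (con 1ℚ :- q) :* b)) refl q (f true) (f false) c
      ; 𝔼-const = solve 2 (λ q c → q :* c :+ (con 1ℚ :- q) :* c := c) refl q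
      ; 𝔼-mono  = λ f≤g → ℚₚ.+-mono-≤ (*-monoˡ 0≤q (f≤g true)) (*-monoˡ (≤⇒0≤- q≤1) (f≤g false))
      }

    subset : ∀ n → Expectation (Subset n)
    subset zero    = point []
    subset (suc n) = independent _∷_ coin (subset n)

    graph : ∀ n → Expectation (Graph n)
    graph zero    = point ∅
    graph (suc n) = independent _▷_ (subset n) (graph n)

    𝔼-subset : ∀ {n} (F : Fin n → Bool → ℚ) →
      𝔼 (subset n) (λ S → prod (λ j → F j (Vec.lookup S j))) ≡ prod (λ j → 𝔼 coin (F j))
    𝔼-subset {zero}  F = refl
    𝔼-subset {suc n} F = trans (𝔼-product coin (subset n) (F zero) _) (cong (𝔼 coin (F zero) *_) (𝔼-subset (F ∘ suc)))

    -- A loop is never present, so on the diagonal the edge variable is the constant `false`.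
    mean : Bool → (Bool → ℚ) → ℚ
    mean loop f = if loop then f false else 𝔼 coin f

    -- Independence of the edges: row `zero` of the product depends on the subset S alone, and the
    -- rest on the smaller graph alone.
    𝔼-graph : ∀ {n} (F : Fin n → Fin n → Bool → ℚ) →
      𝔼 (graph n) (λ G → ∏▽ (λ i j → F i j (adj G i j))) ≡ ∏▽ (λ i j → mean (i == j) (F i j))
    𝔼-graph {zero}  F = refl
    𝔼-graph {suc n} F = trans (𝔼-product (subset n) (graph n) _ _)
      (cong₂ _*_ (trans (𝔼-* (subset n) (F zero zero false) _)
                        (cong (F zero zero false *_) (𝔼-subset (λ j → F zero (suc j)))))
                 (𝔼-graph (λ i j → F (suc i) (suc j))))

  -- Moments of walk sums

  -- With next x z = z these are the powers of M applied to f; with next x z = x and f = 1 they are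
  -- the powers of the row sums.
  walkSum : ∀ {n} → (Fin n → Fin n → ℚ) → (Fin n → Fin n → Fin n) → (Fin n → ℚ) → ℕ → Fin n → ℚ
  walkSum M next f zero    x = f x
  walkSum M next f (suc l) x = sum λ z → M x z * walkSum M next f l (next x z)

  elem : ∀ {n} → Fin n → List (Fin n) → Bool
  elem z []       = false
  elem z (x ∷ xs) = (z == x) ∨ elem z xs

  verts : ∀ {n} → Edges n → List (Fin n)
  verts []             = []
  verts ((x , z) ∷ es) = x ∷ z ∷ verts es

  ∨-false : ∀ a {b} → a ∨ b ≡ false → a ≡ false × b ≡ false
  ∨-false false eq = refl , eq

  same⇒ends : ∀ {n} (x z i j : Fin n) → same x z i j ≡ true → (x ≡ i × z ≡ j) ⊎ (x ≡ j × z ≡ i)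
  same⇒ends x z i j eq with x == i in xi | z == j in zj | x == j in xj | z == i in zi
  ... | true  | true  | _    | _    = inj₁ (==⇒≡ x i xi , ==⇒≡ z j zj)
  ... | true  | false | true | true = inj₂ (==⇒≡ x j xj , ==⇒≡ z i zi)
  ... | false | _     | true | true = inj₂ (==⇒≡ x j xj , ==⇒≡ z i zi)

  count-sym : ∀ {n} (es : Edges n) i j → count es i j ≡ count es j i
  count-sym []             i j = refl
  count-sym ((x , z) ∷ es) i j rewrite 𝔹ₚ.∨-comm ((x == i) ∧ (z == j)) ((x == j) ∧ (z == i)) | count-sym es i j = refl

  count-fresh : ∀ {n} (es : Edges n) {z} → elem z (verts es) ≡ false → ∀ i → count es i z ≡ 0
  count-fresh []             fresh i = refl
  count-fresh ((a , b) ∷ es) {z} fresh i with ∨-false (z == a) fresh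
  ... | z≢a , fresh′ with ∨-false (z == b) fresh′
  ... | z≢b , fresh″ rewrite trans (==-sym a z) z≢a | trans (==-sym b z) z≢b | 𝔹ₚ.∧-zeroʳ (a == i) = count-fresh es fresh″ i

  sum-elem : ∀ {n} (hs : List (Fin n)) → sum (λ z → if elem z hs then 1ℚ else 0ℚ) ≤ ⟦ length hs ⟧
  sum-elem {n} []       = ≤-reflexive (trans (sum-const n 0ℚ) (ℚₚ.*-zeroʳ ⟦ n ⟧))
  sum-elem     (x ∷ hs) = begin
    sum (λ z → if (z == x) ∨ elem z hs then 1ℚ else 0ℚ)
      ≤⟨ sum-mono (λ z → union (z == x) (elem z hs)) ⟩
    sum (λ z → (if z == x then 1ℚ else 0ℚ) + (if elem z hs then 1ℚ else 0ℚ))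
      ≡⟨ ∑-distrib-+ (λ z → if z == x then 1ℚ else 0ℚ) _ ⟩
    sum (λ z → if z == x then 1ℚ else 0ℚ) + sum (λ z → if elem z hs then 1ℚ else 0ℚ)
      ≤⟨ ℚₚ.+-mono-≤ (≤-reflexive (singleton x)) (sum-elem hs) ⟩
    1ℚ + ⟦ length hs ⟧
      ≡⟨ ⟦⟧-suc (length hs) ⟨
    ⟦ suc (length hs) ⟧ ∎
    where
    open ≤-Reasoning
    union : ∀ a b → (if a ∨ b then 1ℚ else 0ℚ) ≤ (if a then 1ℚ else 0ℚ) + (if b then 1ℚ else 0ℚ)
    union true  true  = ≤-because 0≤1 refl
    union true  false = ≤-refl
    union false true  = ≤-refl
    union false false = ≤-refl
    singleton : ∀ {n} (x : Fin n) → sum (λ z → if z == x then 1ℚ else 0ℚ) ≡ 1ℚ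
    singleton {suc n} zero    = cong (λ z → 1ℚ + z) (trans (sum-const n 0ℚ) (ℚₚ.*-zeroʳ ⟦ n ⟧))
    singleton {suc n} (suc x) = trans (ℚₚ.+-identityˡ _) (singleton x)

  square-^ : ∀ p n → p ^ n * p ^ n ≡ (p * p) ^ n
  square-^ p n = sym (^-distrib-* p p n)

  square-≤1 : ∀ p → p * p ≤ 1ℚ → p ≤ 1ℚ × - 1ℚ ≤ p
  square-≤1 p pp≤1 = square-cancel-≤ 0≤1 pp≤1 ,
    subst (- 1ℚ ≤_) (solve 1 (λ p → :- (:- p) := p) refl p)
      (ℚₚ.neg-antimono-≤ (square-cancel-≤ 0≤1 (subst (_≤ 1ℚ) (solve 1 (λ p → p :* p := (:- p) :* (:- p)) refl p) pp≤1)))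

  -- Repeated use of an edge earns no further factor. Loops carry 1: they lead to no new vertex, and
  -- their entry -ι is deterministic, so it does not average out.
  φ : ℚ → Bool → ℕ → ℚ
  φ ι true  c       = 1ℚ
  φ ι false zero    = 1ℚ
  φ ι false (suc c) = ι

  -- ι to the number of distinct edges that are not loops
  Φ : ∀ {n} → ℚ → Edges n → ℚ
  Φ ι es = ∏▽ (λ i j → φ ι (i == j) (count es i j))

  -- Here κ = 1/(nq) and ι = 1/n.
  module Moments
    (q κ ι : ℚ) (0≤q : 0ℚ ≤ q) (q≤1 : q ≤ 1ℚ) (0≤κ : 0ℚ ≤ κ) (κ≤1 : κ ≤ 1ℚ) (qκ≡ι : q * κ ≡ ι)
    where

    open ErdősRényi q 0≤q q≤1

    0≤ι : 0ℚ ≤ ι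
    0≤ι = subst (0ℚ ≤_) qκ≡ι (*-nonNeg 0≤q 0≤κ)

    ι≤κ : ι ≤ κ
    ι≤κ = subst₂ _≤_ qκ≡ι (ℚₚ.*-identityˡ κ) (*-monoʳ 0≤κ q≤1)

    ι≤1 : ι ≤ 1ℚ
    ι≤1 = ≤-trans ι≤κ κ≤1

    φ-nonNeg : ∀ d c → 0ℚ ≤ φ ι d c
    φ-nonNeg true  c       = 0≤1
    φ-nonNeg false zero    = 0≤1
    φ-nonNeg false (suc c) = 0≤ι

    φ-suc : ∀ d c → φ ι d (suc c) ≤ φ ι d c
    φ-suc true  c       = ≤-refl
    φ-suc false zero    = ι≤1
    φ-suc false (suc c) = ≤-refl

    Φ-nonNeg : ∀ {n} (es : Edges n) → 0ℚ ≤ Φ ι es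
    Φ-nonNeg es = ∏▽-nonNeg (λ i j → φ-nonNeg (i == j) (count es i j))

    Φ-[] : ∀ n → Φ {n} ι [] ≡ 1ℚ
    Φ-[] n = trans (∏▽-cong {n} (λ i j → unit (i == j))) (∏▽-1 n)
      where
      unit : ∀ d → φ ι d 0 ≡ 1ℚ
      unit true  = refl
      unit false = refl

    Φ-∷ : ∀ {n} (es : Edges n) x z → Φ ι ((x , z) ∷ es) ≤ Φ ι es
    Φ-∷ es x z = ∏▽-mono (λ i j → φ-nonNeg (i == j) (count ((x , z) ∷ es) i j)) step
      where
      step : ∀ i j → φ ι (i == j) (count ((x , z) ∷ es) i j) ≤ φ ι (i == j) (count es i j)
      step i j with same x z i j
      ... | true  = φ-suc (i == j) (count es i j)
      ... | false = ≤-refl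

    -- Since z occurs neither as x nor as an end of an earlier edge, {x, z} is neither a loop nor a
    -- repetition, and so it adds one factor ι.
    Φ-fresh : ∀ {n} (es : Edges n) x z → elem z (x ∷ verts es) ≡ false → Φ ι ((x , z) ∷ es) ≡ ι * Φ ι es
    Φ-fresh {n} es x z fresh with ∨-false (z == x) fresh
    ... | z≢x , z∉es = begin
      Φ ι ((x , z) ∷ es)
        ≡⟨ ∏▽-cong step ⟩
      ∏▽ (λ i j → (if same x z i j then ι else 1ℚ) * φ ι (i == j) (count es i j))
        ≡⟨ ∏▽-* {n} _ _ ⟩
      ∏▽ (λ i j → if same x z i j then ι else 1ℚ) * Φ ι es
        ≡⟨ cong (_* Φ ι es) (∏▽-single (λ _ _ → ι) (λ _ _ → refl) x z) ⟩
      ι * Φ ι es ∎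
      where
      open ≡-Reasoning
      new : ∀ {d c} → d ≡ false → c ≡ 0 → φ ι d (suc c) ≡ ι * φ ι d c
      new refl refl = sym (ℚₚ.*-identityʳ ι)
      step : ∀ i j → φ ι (i == j) (count ((x , z) ∷ es) i j) ≡ (if same x z i j then ι else 1ℚ) * φ ι (i == j) (count es i j)
      step i j with same x z i j in eq
      ... | false = sym (ℚₚ.*-identityˡ _)
      ... | true with same⇒ends x z i j eq
      ...   | inj₁ (refl , refl) = new (trans (==-sym x z) z≢x) (count-fresh es z∉es x)
      ...   | inj₂ (refl , refl) = new z≢x (trans (count-sym es z x) (count-fresh es z∉es x))

    length-verts : ∀ {n} (es : Edges n) → length (verts es) ≡ length es ℕ.* 2
    length-verts []       = refl
    length-verts (e ∷ es) = cong (2 ℕ.+_) (length-verts es)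

    -- A step to a vertex met before can go to boundedly many places; a step to a new
    -- vertex costs a factor ι, which compensates the n choices.
    sum-Φ : ∀ {n} (es : Edges n) x → ⟦ n ⟧ * ι ≤ 1ℚ →
      sum (λ z → Φ ι ((x , z) ∷ es)) ≤ ⟦ 2 ℕ.+ length es ℕ.* 2 ⟧ * Φ ι es
    sum-Φ {n} es x nι≤1 = begin
      sum (λ z → Φ ι ((x , z) ∷ es))
        ≤⟨ sum-mono step ⟩
      sum (λ z → ((if elem z hs then 1ℚ else 0ℚ) + ι) * Φ ι es)
        ≡⟨ *-distribʳ-sum (Φ ι es) (λ z → (if elem z hs then 1ℚ else 0ℚ) + ι) ⟨
      sum (λ z → (if elem z hs then 1ℚ else 0ℚ) + ι) * Φ ι es
        ≡⟨ cong (_* Φ ι es) (trans (∑-distrib-+ (λ z → if elem z hs then 1ℚ else 0ℚ) (λ _ → ι))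
             (cong (λ y → sum (λ z → if elem z hs then 1ℚ else 0ℚ) + y) (sum-const n ι))) ⟩
      (sum (λ z → if elem z hs then 1ℚ else 0ℚ) + ⟦ n ⟧ * ι) * Φ ι es
        -- `hs` has 1 + 2 |es| entries, possibly repeated; all new vertices together add n ι ≤ 1.
        ≤⟨ *-monoʳ (Φ-nonNeg es) (ℚₚ.+-mono-≤ (sum-elem hs) nι≤1) ⟩
      (⟦ length hs ⟧ + 1ℚ) * Φ ι es
        ≡⟨ cong (_* Φ ι es) (trans (ℚₚ.+-comm ⟦ length hs ⟧ 1ℚ) (sym (⟦⟧-suc (length hs)))) ⟩
      ⟦ 2 ℕ.+ length (verts es) ⟧ * Φ ι es
        ≡⟨ cong (λ l → ⟦ 2 ℕ.+ l ⟧ * Φ ι es) (length-verts es) ⟩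
      ⟦ 2 ℕ.+ length es ℕ.* 2 ⟧ * Φ ι es ∎
      where
      open ≤-Reasoning
      hs : List (Fin n)
      hs = x ∷ verts es
      step : ∀ z → Φ ι ((x , z) ∷ es) ≤ ((if elem z hs then 1ℚ else 0ℚ) + ι) * Φ ι es
      step z with elem z hs in eq
      ... | true  = ≤-trans (Φ-∷ es x z) (≤-because (*-nonNeg 0≤ι (Φ-nonNeg es))
                      (solve 2 (λ i f → (con 1ℚ :+ i) :* f :- f := i :* f) refl ι (Φ ι es)))
      ... | false = ≤-trans (≤-reflexive (Φ-fresh es x z eq)) (≤-reflexive (cong (_* Φ ι es) (sym (ℚₚ.+-identityˡ ι))))

    entry : Bool → ℚ
    entry e = ((if e then 1ℚ else 0ℚ) - q) * κ

    loop-bound : ∀ c → entry false ^ c * entry false ^ c ≤ κ ^ c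
    loop-bound c = begin
      entry false ^ c * entry false ^ c  ≡⟨ square-^ (entry false) c ⟩
      (entry false * entry false) ^ c    ≤⟨ ^-mono-≤ c (square-nonNeg (entry false)) base ⟩
      κ ^ c                              ∎
      where
      open ≤-Reasoning
      base : entry false * entry false ≤ κ
      base = begin
        entry false * entry false  ≡⟨ solve 2 (λ q k → (con 0ℚ :- q) :* k :* ((con 0ℚ :- q) :* k) := (q :* k) :* (q :* k)) refl q κ ⟩
        (q * κ) * (q * κ)          ≡⟨ cong₂ _*_ qκ≡ι qκ≡ι ⟩
        ι * ι                      ≤⟨ *-mono 0≤ι 0≤κ ι≤1 ι≤κ ⟩
        1ℚ * κ                     ≡⟨ ℚₚ.*-identityˡ κ ⟩
        κ                          ∎

    -- The mean is κᶜ w with w = q (1 - q)ᶜ + (1 - q) (-q)ᶜ. As c ≥ 2, |w| ≤ q, so its absolute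
    -- value is at most q κᶜ = ι κᶜ⁻¹, and 2 (c - 1) ≥ c allows κ²ᶜ⁻² to be replaced by κᶜ in the
    -- square.
    multiple-bound : ∀ m → let c = 2 ℕ.+ m ; y = 𝔼 coin (λ e → entry e ^ c) in y * y ≤ κ ^ c * (ι * ι)
    multiple-bound m = begin
      y * y                           ≡⟨ cong₂ _*_ y≡ y≡ ⟩
      (κ * κ * κ ^ m * w) * (κ * κ * κ ^ m * w)
        ≡⟨ solve 3 (λ k l w → (k :* k :* l :* w) :* (k :* k :* l :* w) := (k :* k :* l :* l) :* (k :* k) :* (w :* w)) refl κ (κ ^ m) w ⟩
      (κ * κ * κ ^ m * κ ^ m) * (κ * κ) * (w * w)
        ≤⟨ *-mono (*-nonNeg (*-nonNeg (*-nonNeg (*-nonNeg 0≤κ 0≤κ) 0≤κᵐ) 0≤κᵐ) (*-nonNeg 0≤κ 0≤κ)) (square-nonNeg q)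
             (*-monoʳ (*-nonNeg 0≤κ 0≤κ) (*-monoˡ (*-nonNeg (*-nonNeg 0≤κ 0≤κ) 0≤κᵐ) (^-≤1 m 0≤κ κ≤1))) ww≤qq ⟩
      (κ * κ * κ ^ m * 1ℚ) * (κ * κ) * (q * q)
        ≡⟨ solve 3 (λ k l q → (k :* k :* l :* con 1ℚ) :* (k :* k) :* (q :* q) := k :* (k :* l) :* ((q :* k) :* (q :* k))) refl κ (κ ^ m) q ⟩
      κ * (κ * κ ^ m) * ((q * κ) * (q * κ))
        ≡⟨ cong (κ * (κ * κ ^ m) *_) (cong₂ _*_ qκ≡ι qκ≡ι) ⟩
      κ * (κ * κ ^ m) * (ι * ι) ∎
      where
      open ≤-Reasoning
      y u v w : ℚ
      y = 𝔼 coin (λ e → entry e ^ (2 ℕ.+ m))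
      u = (1ℚ - q) ^ m
      v = (0ℚ - q) ^ m
      w = q * ((1ℚ - q) * (1ℚ - q)) * u + (1ℚ - q) * (q * q) * v

      0≤κᵐ : 0ℚ ≤ κ ^ m
      0≤κᵐ = ^-nonNeg m 0≤κ

      y≡ : y ≡ κ * κ * κ ^ m * w
      y≡ = trans (cong₂ (λ a b → q * (entry true * (entry true * a)) + (1ℚ - q) * (entry false * (entry false * b)))
                   (^-distrib-* (1ℚ - q) κ m) (^-distrib-* (0ℚ - q) κ m))
        (solve 5 (λ q k l u v →
           q :* ((con 1ℚ :- q) :* k :* ((con 1ℚ :- q) :* k :* (u :* l))) :+ (con 1ℚ :- q) :* ((con 0ℚ :- q) :* k :* ((con 0ℚ :- q) :* k :* (v :* l))) :=
           k :* k :* l :* (q :* ((con 1ℚ :- q) :* (con 1ℚ :- q)) :* u :+ (con 1ℚ :- q) :* (q :* q) :* v)) refl q κ (κ ^ m) u v)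

      0≤1-q : 0ℚ ≤ 1ℚ - q
      0≤1-q = ≤⇒0≤- q≤1

      u≤1 : u ≤ 1ℚ
      u≤1 = ^-≤1 m 0≤1-q (≤-because 0≤q (solve 1 (λ q → con 1ℚ :- (con 1ℚ :- q) := q) refl q))

      vv≤1 : v * v ≤ 1ℚ
      vv≤1 = subst (_≤ 1ℚ) (sym (square-^ (0ℚ - q) m)) (^-≤1 m (square-nonNeg (0ℚ - q))
        (≤-trans (≤-reflexive (solve 1 (λ q → (con 0ℚ :- q) :* (con 0ℚ :- q) := q :* q) refl q)) (*-mono 0≤q 0≤1 q≤1 q≤1)))

      -- Since 0 ≤ u ≤ 1 and |v| ≤ 1, both q - w and q + w are q times a sum of nonnegative terms;
      -- together they give w² ≤ q².
      w≤q : 0ℚ ≤ q - w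
      w≤q = subst (0ℚ ≤_) (solve 3 (λ q u v → q :* (q :+ (con 1ℚ :- q) :* (con 1ℚ :- q) :* (con 1ℚ :- u) :+ (con 1ℚ :- q) :* q :* (con 1ℚ :- v)) :=
          q :- (q :* ((con 1ℚ :- q) :* (con 1ℚ :- q)) :* u :+ (con 1ℚ :- q) :* (q :* q) :* v)) refl q u v)
        (*-nonNeg 0≤q (+-nonNeg (+-nonNeg 0≤q (*-nonNeg (*-nonNeg 0≤1-q 0≤1-q) (≤⇒0≤- u≤1)))
          (*-nonNeg (*-nonNeg 0≤1-q 0≤q) (≤⇒0≤- (proj₁ (square-≤1 v vv≤1))))))

      -q≤w : 0ℚ ≤ q + w
      -q≤w = subst (0ℚ ≤_) (solve 3 (λ q u v → q :* ((con 1ℚ :- q) :+ q :* q :+ (con 1ℚ :- q) :* (con 1ℚ :- q) :* u :+ (con 1ℚ :- q) :* q :* (v :- :- con 1ℚ)) :=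
          q :+ (q :* ((con 1ℚ :- q) :* (con 1ℚ :- q)) :* u :+ (con 1ℚ :- q) :* (q :* q) :* v)) refl q u v)
        (*-nonNeg 0≤q (+-nonNeg (+-nonNeg (+-nonNeg 0≤1-q (*-nonNeg 0≤q 0≤q)) (*-nonNeg (*-nonNeg 0≤1-q 0≤1-q) (^-nonNeg m 0≤1-q)))
          (*-nonNeg (*-nonNeg 0≤1-q 0≤q) (≤⇒0≤- (proj₂ (square-≤1 v vv≤1))))))

      ww≤qq : w * w ≤ q * q
      ww≤qq = ≤-because (*-nonNeg w≤q -q≤w) (solve 2 (λ q w → q :* q :- w :* w := (q :- w) :* (q :+ w)) refl q w)

    -- An edge used exactly once contributes the mean of a centred variable, which is zero.
    mean-bound : ∀ d c → let y = mean d (λ e → entry e ^ c) in y * y ≤ κ ^ c * (φ ι d c * φ ι d c)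
    mean-bound true  c = ≤-trans (loop-bound c) (≤-reflexive (sym (ℚₚ.*-identityʳ (κ ^ c))))
    mean-bound false 0 = ≤-reflexive (cong₂ _*_ (𝔼-const coin 1ℚ) (𝔼-const coin 1ℚ))
    mean-bound false 1 = ≤-trans (≤-reflexive (trans (cong₂ _*_ centred centred) (ℚₚ.*-zeroˡ 0ℚ)))
      (*-nonNeg (^-nonNeg 1 0≤κ) (*-nonNeg 0≤ι 0≤ι))
      where
      centred : 𝔼 coin (λ e → entry e ^ 1) ≡ 0ℚ
      centred = solve 2 (λ q k → q :* ((con 1ℚ :- q) :* k :* con 1ℚ) :+ (con 1ℚ :- q) :* ((con 0ℚ :- q) :* k :* con 1ℚ) := con 0ℚ) refl q κ
    mean-bound false (suc (suc m)) = multiple-bound m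

    centred : ∀ {n} → Graph n → Fin n → Fin n → ℚ
    centred G i j = entry (adj G i j)

    κ^length : ∀ {n} (es : Edges n) → κ ^ length es ≡ ∏▽ (λ i j → κ ^ count es i j)
    κ^length es = trans (constant es) (edgeProd≡∏▽ (λ _ _ → κ) (λ _ _ → refl) es)
      where
      constant : ∀ es → κ ^ length es ≡ edgeProd (λ _ _ → κ) es
      constant []       = refl
      constant (e ∷ es) = cong (κ *_) (constant es)

    -- The factors `mean` may be negative and their bounds κ^(c/2) irrational. Squaring removes both
    -- difficulties, and the inequality is then multiplied up over the pairs.
    edge-moment² : ∀ {n} (es : Edges n) → let y = 𝔼 (graph n) (λ G → edgeProd (centred G) es) in
      y * y ≤ κ ^ length es * (Φ ι es * Φ ι es)
    edge-moment² {n} es = begin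
      y * y
        ≡⟨ cong₂ _*_ y≡ y≡ ⟩
      ∏▽ (λ i j → mean (i == j) (λ e → entry e ^ count es i j)) * ∏▽ (λ i j → mean (i == j) (λ e → entry e ^ count es i j))
        ≡⟨ ∏▽-* {n} _ _ ⟨
      ∏▽ (λ i j → mean (i == j) (λ e → entry e ^ count es i j) * mean (i == j) (λ e → entry e ^ count es i j))
        ≤⟨ ∏▽-mono (λ i j → square-nonNeg (mean (i == j) (λ e → entry e ^ count es i j))) (λ i j → mean-bound (i == j) (count es i j)) ⟩
      ∏▽ (λ i j → κ ^ count es i j * (φ ι (i == j) (count es i j) * φ ι (i == j) (count es i j)))
        ≡⟨ ∏▽-* {n} _ _ ⟩
      ∏▽ (λ i j → κ ^ count es i j) * ∏▽ (λ i j → φ ι (i == j) (count es i j) * φ ι (i == j) (count es i j))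
        ≡⟨ cong₂ _*_ (sym (κ^length es)) (∏▽-* {n} _ _) ⟩
      κ ^ length es * (Φ ι es * Φ ι es) ∎
      where
      open ≤-Reasoning
      y : ℚ
      y = 𝔼 (graph n) (λ G → edgeProd (centred G) es)
      y≡ : y ≡ ∏▽ (λ i j → mean (i == j) (λ e → entry e ^ count es i j))
      y≡ = trans (𝔼-cong (graph n) (λ G → edgeProd≡∏▽ (centred G) (λ i j → cong entry (adj-sym G i j)) es))
                 (𝔼-graph (λ i j e → entry e ^ count es i j))

    -- With 2k edges in all, the square bound is the square of a rational number, and the root can
    -- be taken.
    edge-moment : ∀ {n} k (es : Edges n) → length es ≡ k ℕ.+ k →
      𝔼 (graph n) (λ G → edgeProd (centred G) es) ≤ κ ^ k * Φ ι es
    edge-moment k es len = square-cancel-≤ (*-nonNeg (^-nonNeg k 0≤κ) (Φ-nonNeg es)) (≤-trans (edge-moment² es)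
      (≤-reflexive (trans (cong (_* (Φ ι es * Φ ι es)) (trans (cong (κ ^_) len) (^-homo-* κ k k)))
        (solve 2 (λ a f → a :* a :* (f :* f) := a :* f :* (a :* f)) refl (κ ^ k) (Φ ι es)))))

  -- The product of the constants of `sum-Φ` along l further steps, where m edges have been
  -- traversed before.
  walkConst : ℕ → ℕ → ℕ
  walkConst zero    m = 1
  walkConst (suc l) m = (2 ℕ.+ m ℕ.* 2) ℕ.* walkConst l (suc m)

  module _
    (q κ ι : ℚ) (0≤q : 0ℚ ≤ q) (q≤1 : q ≤ 1ℚ) (0≤κ : 0ℚ ≤ κ) (κ≤1 : κ ≤ 1ℚ) (qκ≡ι : q * κ ≡ ι)
    where

    open ErdősRényi q 0≤q q≤1
    open Moments q κ ι 0≤q q≤1 0≤κ κ≤1 qκ≡ι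

    -- The expectation can be evaluated only when all 2k edges are known, so the induction on the
    -- remaining length carries the traversed edges in `es` and sums out the last vertex on the way
    -- back. It works for every `next`: `sum-Φ` allows any x as the start of the new edge, hence the
    -- edges need not form a path.
    walk-moment-from : ∀ {n} → ⟦ n ⟧ * ι ≤ 1ℚ → ∀ (next : Fin n → Fin n → Fin n) (f : Fin n → ℚ) →
      (∀ x → 0ℚ ≤ f x) → (∀ x → f x ≤ 1ℚ) → ∀ k l (es : Edges n) x → l ℕ.+ length es ≡ k ℕ.+ k →
      𝔼 (graph n) (λ G → edgeProd (centred G) es * walkSum (centred G) next f l x) ≤
      ⟦ walkConst l (length es) ⟧ * (κ ^ k * Φ ι es)
    walk-moment-from {n} nι≤1 next f 0≤f f≤1 k zero es x len = begin
      𝔼 (graph n) (λ G → edgeProd (centred G) es * f x)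
        ≡⟨ 𝔼-*ʳ (graph n) _ (f x) ⟩
      𝔼 (graph n) (λ G → edgeProd (centred G) es) * f x
        ≤⟨ *-monoʳ (0≤f x) (edge-moment k es len) ⟩
      κ ^ k * Φ ι es * f x
        ≤⟨ *-monoˡ (*-nonNeg (^-nonNeg k 0≤κ) (Φ-nonNeg es)) (f≤1 x) ⟩
      κ ^ k * Φ ι es * 1ℚ
        ≡⟨ ℚₚ.*-comm (κ ^ k * Φ ι es) 1ℚ ⟩
      1ℚ * (κ ^ k * Φ ι es) ∎
      where open ≤-Reasoning
    walk-moment-from {n} nι≤1 next f 0≤f f≤1 k (suc l) es x len = begin
      𝔼 (graph n) (λ G → edgeProd (centred G) es * sum (λ z → centred G x z * W G z))
        ≡⟨ 𝔼-cong (graph n) (λ G → trans (*-distribˡ-sum (edgeProd (centred G) es) (λ z → centred G x z * W G z))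
             (sum-cong-≗ (λ z → solve 3 (λ a b c → a :* (b :* c) := b :* a :* c) refl (edgeProd (centred G) es) (centred G x z) (W G z)))) ⟩
      𝔼 (graph n) (λ G → sum (λ z → edgeProd (centred G) ((x , z) ∷ es) * W G z))
        ≡⟨ 𝔼-sum (graph n) (λ z G → edgeProd (centred G) ((x , z) ∷ es) * W G z) ⟩
      sum (λ z → 𝔼 (graph n) (λ G → edgeProd (centred G) ((x , z) ∷ es) * W G z))
        ≤⟨ sum-mono (λ z → walk-moment-from nι≤1 next f 0≤f f≤1 k l ((x , z) ∷ es) (next x z) (trans (ℕₚ.+-suc l (length es)) len)) ⟩
      sum (λ z → ⟦ C ⟧ * (κ ^ k * Φ ι ((x , z) ∷ es)))
        ≡⟨ sum-cong-≗ (λ z → sym (ℚₚ.*-assoc ⟦ C ⟧ (κ ^ k) (Φ ι ((x , z) ∷ es)))) ⟩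
      sum (λ z → ⟦ C ⟧ * κ ^ k * Φ ι ((x , z) ∷ es))
        ≡⟨ *-distribˡ-sum (⟦ C ⟧ * κ ^ k) (λ z → Φ ι ((x , z) ∷ es)) ⟨
      ⟦ C ⟧ * κ ^ k * sum (λ z → Φ ι ((x , z) ∷ es))
        ≤⟨ *-monoˡ (*-nonNeg (⟦⟧-nonNeg C) (^-nonNeg k 0≤κ)) (sum-Φ es x nι≤1) ⟩
      ⟦ C ⟧ * κ ^ k * (⟦ c ⟧ * Φ ι es)
        ≡⟨ solve 4 (λ C p c f → C :* p :* (c :* f) := c :* C :* (p :* f)) refl ⟦ C ⟧ (κ ^ k) ⟦ c ⟧ (Φ ι es) ⟩
      ⟦ c ⟧ * ⟦ C ⟧ * (κ ^ k * Φ ι es)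
        ≡⟨ cong (_* (κ ^ k * Φ ι es)) (⟦⟧-* c C) ⟨
      ⟦ c ℕ.* C ⟧ * (κ ^ k * Φ ι es) ∎
      where
      open ≤-Reasoning
      c C : ℕ
      c = 2 ℕ.+ length es ℕ.* 2
      C = walkConst l (suc (length es))
      W : Graph n → Fin n → ℚ
      W G z = walkSum (centred G) next f l (next x z)

    walk-moment : ∀ {n} → ⟦ n ⟧ * ι ≤ 1ℚ → ∀ (next : Fin n → Fin n → Fin n) (f : Fin n → ℚ) →
      (∀ x → 0ℚ ≤ f x) → (∀ x → f x ≤ 1ℚ) → ∀ k x →
      𝔼 (graph n) (λ G → walkSum (centred G) next f (k ℕ.+ k) x) ≤ ⟦ walkConst (k ℕ.+ k) 0 ⟧ * κ ^ k
    walk-moment {n} nι≤1 next f 0≤f f≤1 k x = begin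
      𝔼 (graph n) (λ G → walkSum (centred G) next f (k ℕ.+ k) x)
        ≡⟨ 𝔼-cong (graph n) (λ G → sym (ℚₚ.*-identityˡ _)) ⟩
      𝔼 (graph n) (λ G → 1ℚ * walkSum (centred G) next f (k ℕ.+ k) x)
        ≤⟨ walk-moment-from nι≤1 next f 0≤f f≤1 k (k ℕ.+ k) [] x (ℕₚ.+-identityʳ (k ℕ.+ k)) ⟩
      ⟦ walkConst (k ℕ.+ k) 0 ⟧ * (κ ^ k * Φ {n} ι [])
        ≡⟨ cong (⟦ walkConst (k ℕ.+ k) 0 ⟧ *_) (trans (cong (κ ^ k *_) (Φ-[] n)) (ℚₚ.*-identityʳ (κ ^ k))) ⟩
      ⟦ walkConst (k ℕ.+ k) 0 ⟧ * κ ^ k ∎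
      where open ≤-Reasoning

  -- Powers of nearly constant matrices

  δ[_,_] : ∀ {n} → Fin n → Fin n → ℚ
  δ[ x , y ] = if x == y then 1ℚ else 0ℚ

  pow : ∀ {n} → (Fin n → Fin n → ℚ) → ℕ → Fin n → Fin n → ℚ
  pow M l x y = walkSum M (λ _ z → z) (λ z → δ[ z , y ]) l x

  sum-zero : ∀ n → sum {n} (λ _ → 0ℚ) ≡ 0ℚ
  sum-zero n = trans (sum-const n 0ℚ) (ℚₚ.*-zeroʳ ⟦ n ⟧)

  δ-sum : ∀ {n} x (f : Fin n → ℚ) → sum (λ z → δ[ x , z ] * f z) ≡ f x
  δ-sum {suc n} zero    f = trans (cong₂ _+_ (ℚₚ.*-identityˡ (f zero))
      (trans (sum-cong-≗ (λ z → ℚₚ.*-zeroˡ (f (suc z)))) (sum-zero n)))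
    (ℚₚ.+-identityʳ (f zero))
  δ-sum {suc n} (suc x) f = trans (cong₂ _+_ (ℚₚ.*-zeroˡ (f zero)) (δ-sum x (f ∘ suc))) (ℚₚ.+-identityˡ (f (suc x)))

  sum-swap : ∀ {m n} (f : Fin m → ℚ) (g : Fin m → Fin n → ℚ) (h : Fin n → ℚ) →
    sum (λ i → f i * sum (λ j → g i j * h j)) ≡ sum (λ j → sum (λ i → f i * g i j) * h j)
  sum-swap f g h = begin
    sum (λ i → f i * sum (λ j → g i j * h j))
      ≡⟨ sum-cong-≗ (λ i → trans (*-distribˡ-sum (f i) (λ j → g i j * h j)) (sum-cong-≗ (λ j → sym (ℚₚ.*-assoc (f i) (g i j) (h j))))) ⟩
    sum (λ i → sum (λ j → f i * g i j * h j))
      ≡⟨ ∑-comm (λ i j → f i * g i j * h j) ⟩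
    sum (λ j → sum (λ i → f i * g i j * h j))
      ≡⟨ sum-cong-≗ (λ j → sym (*-distribʳ-sum (h j) (λ i → f i * g i j))) ⟩
    sum (λ j → sum (λ i → f i * g i j) * h j) ∎
    where open ≡-Reasoning

  module _ {n} (M : Fin n → Fin n → ℚ) where

    pow-+ : ∀ a b x y → pow M (a ℕ.+ b) x y ≡ sum (λ z → pow M a x z * pow M b z y)
    pow-+ zero    b x y = sym (δ-sum x (λ z → pow M b z y))
    pow-+ (suc a) b x y = trans (sum-cong-≗ (λ w → cong (M x w *_) (pow-+ a b w y)))
      (sum-swap (M x) (pow M a) (λ z → pow M b z y))

    pow-1 : ∀ x y → pow M 1 x y ≡ M x y
    pow-1 x y = trans (sum-cong-≗ (λ z → trans (cong (M x z *_) (if-cong (==-sym z y))) (ℚₚ.*-comm (M x z) _)))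
      (δ-sum y (M x))

    pow-sucʳ : ∀ l x y → pow M (suc l) x y ≡ sum (λ z → pow M l x z * M z y)
    pow-sucʳ l x y = trans (cong (λ m → pow M m x y) (sym (ℕₚ.+-comm l 1)))
      (trans (pow-+ l 1 x y) (sum-cong-≗ (λ z → cong (pow M l x z *_) (pow-1 z y))))

    pow-nonNeg : (∀ x y → 0ℚ ≤ M x y) → ∀ l x y → 0ℚ ≤ pow M l x y
    pow-nonNeg 0≤M zero    x y with x == y
    ... | true  = 0≤1
    ... | false = ≤-refl
    pow-nonNeg 0≤M (suc l) x y = sum-nonNeg (λ z → *-nonNeg (0≤M x z) (pow-nonNeg 0≤M l z y))

    pow-mono : ∀ {N : Fin n → Fin n → ℚ} → (∀ x y → 0ℚ ≤ M x y) → (∀ x y → M x y ≤ N x y) →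
      ∀ l x y → pow M l x y ≤ pow N l x y
    pow-mono 0≤M M≤N zero    x y = ≤-refl
    pow-mono 0≤M M≤N (suc l) x y = sum-mono (λ z →
      *-mono (0≤M x z) (≤-trans (pow-nonNeg 0≤M l z y) (pow-mono 0≤M M≤N l z y)) (M≤N x z) (pow-mono 0≤M M≤N l z y))

    pow-scale : ∀ c l x y → pow (λ x y → c * M x y) l x y ≡ c ^ l * pow M l x y
    pow-scale c zero    x y = sym (ℚₚ.*-identityˡ _)
    pow-scale c (suc l) x y = trans
      (sum-cong-≗ (λ z → trans (cong (c * M x z *_) (pow-scale c l z y))
        (solve 4 (λ c m d p → c :* m :* (d :* p) := c :* d :* (m :* p)) refl c (M x z) (c ^ l) (pow M l z y))))
      (sym (*-distribˡ-sum (c * c ^ l) (λ z → M x z * pow M l z y)))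

    -- Every step starts again from x, so the sums over the steps separate.
    star : ∀ l x → walkSum M (λ x _ → x) (λ _ → 1ℚ) l x ≡ sum (M x) ^ l
    star zero    x = refl
    star (suc l) x = trans (sum-cong-≗ (λ z → cong (M x z *_) (star l x))) (sym (*-distribʳ-sum (sum (M x) ^ l) (M x)))

    module _ (sym-M : ∀ x y → M x y ≡ M y x) where

      pow-sym : ∀ l x y → pow M l x y ≡ pow M l y x
      pow-sym zero    x y = if-cong (==-sym x y)
      pow-sym (suc l) x y = trans (sum-cong-≗ (λ z → trans (cong₂ _*_ (sym-M x z) (pow-sym l z y)) (ℚₚ.*-comm (M z x) (pow M l y z))))
        (sym (pow-sucʳ l y x))

      -- This makes the trace of M²ᵏ the sum of the squares of all entries of Mᵏ, which therefore
      -- dominates each of them.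
      pow-diagonal : ∀ k x → pow M (k ℕ.+ k) x x ≡ sum (λ u → pow M k x u * pow M k x u)
      pow-diagonal k x = trans (pow-+ k k x x) (sum-cong-≗ (λ u → cong (pow M k x u *_) (pow-sym k u x)))

      rowSum-pow : ∀ l u → sum (λ z → pow M l z u) ≡ walkSum M (λ _ z → z) (λ _ → 1ℚ) l u
      rowSum-pow zero    u = trans (sum-cong-≗ (λ z → trans (if-cong (==-sym z u)) (sym (ℚₚ.*-identityʳ δ[ u , z ])))) (δ-sum u (λ _ → 1ℚ))
      rowSum-pow (suc l) u = begin
        sum (λ z → pow M (suc l) z u)
          ≡⟨ sum-cong-≗ (λ z → pow-sym (suc l) z u) ⟩
        sum (λ z → sum (λ w → M u w * pow M l w z))
          ≡⟨ ∑-comm (λ z w → M u w * pow M l w z) ⟩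
        sum (λ w → sum (λ z → M u w * pow M l w z))
          ≡⟨ sum-cong-≗ (λ w → sym (*-distribˡ-sum (M u w) (pow M l w))) ⟩
        sum (λ w → M u w * sum (pow M l w))
          ≡⟨ sum-cong-≗ (λ w → cong (M u w *_) (trans (sum-cong-≗ (pow-sym l w)) (rowSum-pow l w))) ⟩
        walkSum M (λ _ z → z) (λ _ → 1ℚ) (suc l) u ∎
        where open ≡-Reasoning

  ∣sum∣≤ : ∀ {n} (f : Fin n → ℚ) → ∣ sum f ∣ ≤ sum (λ i → ∣ f i ∣)
  ∣sum∣≤ {zero}  f = ≤-refl
  ∣sum∣≤ {suc n} f = ≤-trans (ℚₚ.∣p+q∣≤∣p∣+∣q∣ (f zero) (sum (f ∘ suc))) (ℚₚ.+-monoʳ-≤ ∣ f zero ∣ (∣sum∣≤ (f ∘ suc)))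

  p≤∣p∣ : ∀ p → p ≤ ∣ p ∣
  p≤∣p∣ p with ℚₚ.≤-total 0ℚ p
  ... | inj₁ 0≤p = ≤-reflexive (sym (ℚₚ.0≤p⇒∣p∣≡p 0≤p))
  ... | inj₂ p≤0 = ≤-trans p≤0 (ℚₚ.0≤∣p∣ p)

  ∣p∣≤⇒ : ∀ {p} b → ∣ p ∣ ≤ b → (- b ≤ p) × (p ≤ b)
  ∣p∣≤⇒ {p} b ∣p∣≤b =
    subst (- b ≤_) (solve 1 (λ p → :- (:- p) := p) refl p)
      (ℚₚ.neg-antimono-≤ (≤-trans (p≤∣p∣ (- p)) (subst (_≤ b) (sym (ℚₚ.∣-p∣≡∣p∣ p)) ∣p∣≤b))) ,
    ≤-trans (p≤∣p∣ p) ∣p∣≤b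

  2ℚ 3ℚ : ℚ
  2ℚ = ⟦ 2 ⟧
  3ℚ = ⟦ 3 ⟧

  -- Write aʲ = Mʲ + eⱼ.  Then eⱼ₊₁ = a eⱼ + ι 1ᵀMʲ (with ι = 1/n), where a has row sums close to 1
  -- and Mʲ has small column sums for j ≥ 1, so that eⱼ stays close to the constant matrix e₁ = ι.
  module Flat {n} (a M : Fin n → Fin n → ℚ) (ι δ τ : ℚ) (k : ℕ)
    (0≤a : ∀ x z → 0ℚ ≤ a x z) (a≡ : ∀ x z → a x z ≡ M x z + ι) (sym-M : ∀ x z → M x z ≡ M z x)
    (nι≡1 : ⟦ n ⟧ * ι ≡ 1ℚ) (0≤ι : 0ℚ ≤ ι)
    (0≤δ : 0ℚ ≤ δ) (3ᵏδ≤τ : 3ℚ ^ k * δ ≤ τ) (kτ≤ : ⟦ k ⟧ * τ ≤ + 1 / 100) (τ≤ : τ ≤ + 1 / 100)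
    (rows : ∀ x → ∣ sum (M x) ∣ ≤ δ)
    where

    0≤3 : 0ℚ ≤ 3ℚ
    0≤3 = ⟦⟧-nonNeg 3

    1≤3 : 1ℚ ≤ 3ℚ
    1≤3 = ⟦⟧-mono {1} {3} (ℕ.s≤s ℕ.z≤n)

    δ≤τ : δ ≤ τ
    δ≤τ = ≤-trans (subst (_≤ 3ℚ ^ k * δ) (ℚₚ.*-identityˡ δ) (*-monoʳ 0≤δ (1≤^ k 1≤3))) 3ᵏδ≤τ

    0≤τ : 0ℚ ≤ τ
    0≤τ = ≤-trans 0≤δ δ≤τ

    δ≤1 : δ ≤ 1ℚ
    δ≤1 = ≤-trans δ≤τ (≤-trans τ≤ (≤-because (ℚₚ.nonNegative⁻¹ (+ 99 / 100)) refl))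

    -- By symmetry of M these are the column sums of the powers of M, as `rowSum-pow` shows.
    s : ℕ → Fin n → ℚ
    s = walkSum M (λ _ z → z) (λ _ → 1ℚ)

    sum-ι : sum {n} (λ _ → ι) ≡ 1ℚ
    sum-ι = trans (sum-const n ι) nι≡1

    row-a : ∀ x → sum (a x) ≡ sum (M x) + 1ℚ
    row-a x = trans (sum-cong-≗ (a≡ x)) (trans (∑-distrib-+ (M x) (λ _ → ι)) (cong (λ y → sum (M x) + y) sum-ι))

    -- Entrywise |M| ≤ a + ι, where a row of a sums to at most 1 + δ ≤ 2 and the ι sum to 1. Every
    -- further power of M thus enlarges the column sums by a factor at most 3, which is why 3ᵏ δ ≤ τ
    -- is assumed.
    sum-∣M∣ : ∀ x → sum (λ z → ∣ M x z ∣) ≤ 3ℚ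
    sum-∣M∣ x = begin
      sum (λ z → ∣ M x z ∣)
        ≤⟨ sum-mono (λ z → entry z) ⟩
      sum (λ z → a x z + ι)
        ≡⟨ trans (∑-distrib-+ (a x) (λ _ → ι)) (cong₂ _+_ (row-a x) sum-ι) ⟩
      sum (M x) + 1ℚ + 1ℚ
        ≤⟨ ℚₚ.+-monoˡ-≤ 1ℚ (ℚₚ.+-monoˡ-≤ 1ℚ (≤-trans (p≤∣p∣ _) (≤-trans (rows x) δ≤1))) ⟩
      3ℚ ∎
      where
      open ≤-Reasoning
      entry : ∀ z → ∣ M x z ∣ ≤ a x z + ι
      entry z = begin
        ∣ M x z ∣         ≡⟨ cong ∣_∣ (trans (solve 2 (λ m i → m := m :+ i :- i) refl (M x z) ι) (cong (_- ι) (sym (a≡ x z)))) ⟩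
        ∣ a x z - ι ∣     ≤⟨ ℚₚ.∣p-q∣≤∣p∣+∣q∣ (a x z) ι ⟩
        ∣ a x z ∣ + ∣ ι ∣ ≡⟨ cong₂ _+_ (ℚₚ.0≤p⇒∣p∣≡p (0≤a x z)) (ℚₚ.0≤p⇒∣p∣≡p 0≤ι) ⟩
        a x z + ι         ∎

    s-bound : ∀ j u → ∣ s (suc j) u ∣ ≤ 3ℚ ^ j * δ
    s-bound zero    u = subst₂ _≤_ (cong ∣_∣ (sum-cong-≗ (λ z → sym (ℚₚ.*-identityʳ (M u z))))) (sym (ℚₚ.*-identityˡ δ)) (rows u)
    s-bound (suc j) u = begin
      ∣ sum (λ w → M u w * s (suc j) w) ∣
        ≤⟨ ∣sum∣≤ (λ w → M u w * s (suc j) w) ⟩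
      sum (λ w → ∣ M u w * s (suc j) w ∣)
        ≤⟨ sum-mono (λ w → ≤-trans (≤-reflexive (ℚₚ.∣p*q∣≡∣p∣*∣q∣ (M u w) (s (suc j) w))) (*-monoˡ (ℚₚ.0≤∣p∣ (M u w)) (s-bound j w))) ⟩
      sum (λ w → ∣ M u w ∣ * (3ℚ ^ j * δ))
        ≡⟨ *-distribʳ-sum (3ℚ ^ j * δ) (λ w → ∣ M u w ∣) ⟨
      sum (λ w → ∣ M u w ∣) * (3ℚ ^ j * δ)
        ≤⟨ *-monoʳ (*-nonNeg (^-nonNeg j 0≤3) 0≤δ) (sum-∣M∣ u) ⟩
      3ℚ * (3ℚ ^ j * δ)
        ≡⟨ ℚₚ.*-assoc 3ℚ (3ℚ ^ j) δ ⟨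
      3ℚ ^ suc j * δ ∎
      where open ≤-Reasoning

    s-bound-τ : ∀ j → j ℕ.≤ k → ∀ u → ∣ s (suc j) u ∣ ≤ τ
    s-bound-τ j j≤k u = ≤-trans (s-bound j u) (≤-trans (*-monoʳ 0≤δ 3ʲ≤3ᵏ) 3ᵏδ≤τ)
      where
      3ʲ≤3ᵏ : 3ℚ ^ j ≤ 3ℚ ^ k
      3ʲ≤3ᵏ = subst₂ _≤_ (ℚₚ.*-identityʳ (3ℚ ^ j)) (trans (sym (^-homo-* 3ℚ j (k ℕ.∸ j))) (cong (3ℚ ^_) (ℕₚ.m+[n∸m]≡n j≤k)))
        (*-monoˡ (^-nonNeg j 0≤3) (1≤^ (k ℕ.∸ j) 1≤3))

    e : ℕ → Fin n → Fin n → ℚ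
    e j x u = pow a j x u - pow M j x u

    e-suc : ∀ j x u → e (suc j) x u ≡ sum (λ z → a x z * e j z u) + ι * s j u
    e-suc j x u = begin
      sum (λ z → a x z * pow a j z u) - sum B
        ≡⟨ cong (_- sum B) (trans (sum-cong-≗ split) (∑-distrib-+ (λ z → A z + B z) (λ z → ι * pow M j z u))) ⟩
      sum (λ z → A z + B z) + sum (λ z → ι * pow M j z u) - sum B
        ≡⟨ cong₂ (λ y w → y + w - sum B) (∑-distrib-+ A B)
             (trans (sym (*-distribˡ-sum ι (λ z → pow M j z u))) (cong (ι *_) (rowSum-pow M sym-M j u))) ⟩
      sum A + sum B + ι * s j u - sum B
        ≡⟨ solve 3 (λ p q r → p :+ q :+ r :- q := p :+ r) refl (sum A) (sum B) (ι * s j u) ⟩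
      sum A + ι * s j u ∎
      where
      open ≡-Reasoning
      A B : Fin n → ℚ
      A z = a x z * e j z u
      B z = M x z * pow M j z u
      split : ∀ z → a x z * pow a j z u ≡ a x z * e j z u + M x z * pow M j z u + ι * pow M j z u
      split z = trans (solve 3 (λ a p m → a :* p := a :* (p :- m) :+ a :* m) refl (a x z) (pow a j z u) (pow M j z u))
        (trans (cong (λ y → a x z * e j z u + y * pow M j z u) (a≡ x z))
          (solve 4 (λ b m i p → b :+ (m :+ i) :* p := b :+ m :* p :+ i :* p) refl (a x z * e j z u) (M x z) ι (pow M j z u)))

    -- The induction starts at e₁ = ι, since the column sums of M⁰ are 1 and not small. A step
    -- multiplies by a row sum within τ of 1 and adds at most ι τ in absolute value. With T = i τ,
    -- the lower bound loses at most 2 τ, as (1 - τ)(1 - 2T) - τ ≥ 1 - 2(T + τ). For the upper bound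
    -- the slope 3 leaves room for the product 3 T τ, as 3T ≤ 1.
    e-bounds : ∀ i → i ℕ.≤ k → ∀ x u →
      ((1ℚ - 2ℚ * (⟦ i ⟧ * τ)) * ι ≤ e (suc i) x u) × (e (suc i) x u ≤ (1ℚ + 3ℚ * (⟦ i ⟧ * τ)) * ι)
    e-bounds zero    i≤k x u = ≤-reflexive (trans (solve 2 (λ t i → (con 1ℚ :- con 2ℚ :* (con 0ℚ :* t)) :* i := i) refl τ ι) (sym e₁)) ,
        ≤-reflexive (trans e₁ (solve 2 (λ t i → i := (con 1ℚ :+ con 3ℚ :* (con 0ℚ :* t)) :* i) refl τ ι))
      where
      e₁ : e 1 x u ≡ ι
      e₁ = trans (e-suc 0 x u) (trans (cong₂ _+_
        (trans (sum-cong-≗ (λ z → trans (cong (a x z *_) (ℚₚ.+-inverseʳ δ[ z , u ])) (ℚₚ.*-zeroʳ (a x z)))) (sum-zero n))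
        (ℚₚ.*-identityʳ ι)) (ℚₚ.+-identityˡ ι))
    e-bounds (suc i) i<k x u = lower , upper
      where
      open ≤-Reasoning
      T : ℚ
      T = ⟦ i ⟧ * τ

      T-suc : ⟦ suc i ⟧ * τ ≡ T + τ
      T-suc = trans (cong (_* τ) (⟦⟧-suc i)) (solve 2 (λ i t → (con 1ℚ :+ i) :* t := i :* t :+ t) refl ⟦ i ⟧ τ)

      0≤T : 0ℚ ≤ T
      0≤T = *-nonNeg (⟦⟧-nonNeg i) 0≤τ

      T≤ : T ≤ + 1 / 100
      T≤ = ≤-trans (*-monoʳ 0≤τ (⟦⟧-mono (ℕₚ.<⇒≤ i<k))) kτ≤

      0≤1-3T : 0ℚ ≤ 1ℚ - 3ℚ * T
      0≤1-3T = ≤⇒0≤- (≤-trans (*-monoˡ 0≤3 T≤) (≤-because (ℚₚ.nonNegative⁻¹ (+ 97 / 100)) refl))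

      0≤1-2T : 0ℚ ≤ 1ℚ - 2ℚ * T
      0≤1-2T = ≤⇒0≤- (≤-trans (*-monoˡ (⟦⟧-nonNeg 2) T≤) (≤-because (ℚₚ.nonNegative⁻¹ (+ 98 / 100)) refl))

      rec : ∀ z → ((1ℚ - 2ℚ * T) * ι ≤ e (suc i) z u) × (e (suc i) z u ≤ (1ℚ + 3ℚ * T) * ι)
      rec z = e-bounds i (ℕₚ.<⇒≤ i<k) z u

      row : (- δ ≤ sum (M x)) × (sum (M x) ≤ δ)
      row = ∣p∣≤⇒ δ (rows x)

      sτ : (- τ ≤ s (suc i) u) × (s (suc i) u ≤ τ)
      sτ = ∣p∣≤⇒ τ (s-bound-τ i (ℕₚ.<⇒≤ i<k) u)

      r : ℚ
      r = sum (M x)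

      upper : e (suc (suc i)) x u ≤ (1ℚ + 3ℚ * (⟦ suc i ⟧ * τ)) * ι
      upper = begin
        e (suc (suc i)) x u
          ≡⟨ e-suc (suc i) x u ⟩
        sum (λ z → a x z * e (suc i) z u) + ι * s (suc i) u
          ≤⟨ ℚₚ.+-mono-≤ (sum-mono (λ z → *-monoˡ (0≤a x z) (proj₂ (rec z)))) (*-monoˡ 0≤ι (proj₂ sτ)) ⟩
        sum (λ z → a x z * ((1ℚ + 3ℚ * T) * ι)) + ι * τ
          ≡⟨ cong (λ y → y + ι * τ) (trans (sym (*-distribʳ-sum ((1ℚ + 3ℚ * T) * ι) (a x))) (cong (_* ((1ℚ + 3ℚ * T) * ι)) (row-a x))) ⟩
        (r + 1ℚ) * ((1ℚ + 3ℚ * T) * ι) + ι * τ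
          ≤⟨ ≤-because
               (+-nonNeg (*-nonNeg (*-nonNeg (≤⇒0≤- (≤-trans (proj₂ row) δ≤τ)) (+-nonNeg 0≤1 (*-nonNeg 0≤3 0≤T))) 0≤ι) (*-nonNeg (*-nonNeg 0≤τ 0≤ι) 0≤1-3T))
               (solve 4 (λ r T i t → (con 1ℚ :+ con 3ℚ :* (T :+ t)) :* i :- ((r :+ con 1ℚ) :* ((con 1ℚ :+ con 3ℚ :* T) :* i) :+ i :* t) :=
                  (t :- r) :* (con 1ℚ :+ con 3ℚ :* T) :* i :+ t :* i :* (con 1ℚ :- con 3ℚ :* T)) refl r T ι τ) ⟩
        (1ℚ + 3ℚ * (T + τ)) * ι
          ≡⟨ cong (λ y → (1ℚ + 3ℚ * y) * ι) T-suc ⟨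
        (1ℚ + 3ℚ * (⟦ suc i ⟧ * τ)) * ι ∎

      lower : (1ℚ - 2ℚ * (⟦ suc i ⟧ * τ)) * ι ≤ e (suc (suc i)) x u
      lower = begin
        (1ℚ - 2ℚ * (⟦ suc i ⟧ * τ)) * ι
          ≡⟨ cong (λ y → (1ℚ - 2ℚ * y) * ι) T-suc ⟩
        (1ℚ - 2ℚ * (T + τ)) * ι
          ≤⟨ ≤-because
               (+-nonNeg (*-nonNeg (*-nonNeg (≤⇒0≤- (≤-trans (ℚₚ.neg-antimono-≤ δ≤τ) (proj₁ row))) 0≤1-2T) 0≤ι)
                 (*-nonNeg (*-nonNeg (*-nonNeg (⟦⟧-nonNeg 2) 0≤τ) 0≤T) 0≤ι))
               (solve 4 (λ r T i t → (r :+ con 1ℚ) :* ((con 1ℚ :- con 2ℚ :* T) :* i) :+ i :* (:- t) :- (con 1ℚ :- con 2ℚ :* (T :+ t)) :* i :=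
                  (r :- :- t) :* (con 1ℚ :- con 2ℚ :* T) :* i :+ con 2ℚ :* t :* T :* i) refl r T ι τ) ⟩
        (r + 1ℚ) * ((1ℚ - 2ℚ * T) * ι) + ι * (- τ)
          ≡⟨ cong (λ y → y + ι * (- τ)) (trans (sym (*-distribʳ-sum ((1ℚ - 2ℚ * T) * ι) (a x))) (cong (_* ((1ℚ - 2ℚ * T) * ι)) (row-a x))) ⟨
        sum (λ z → a x z * ((1ℚ - 2ℚ * T) * ι)) + ι * (- τ)
          ≤⟨ ℚₚ.+-mono-≤ (sum-mono (λ z → *-monoˡ (0≤a x z) (proj₁ (rec z)))) (*-monoˡ 0≤ι (proj₁ sτ)) ⟩
        sum (λ z → a x z * e (suc i) z u) + ι * s (suc i) u
          ≡⟨ e-suc (suc i) x u ⟨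
        e (suc (suc i)) x u ∎

    module _ .{{_ : ℕ.NonZero k}} (small : ∀ x u → ∣ pow M k x u ∣ ≤ τ * ι) where

      private
        bounds : ∀ x u → ((1ℚ - 2ℚ * (⟦ k ⟧ * τ)) * ι ≤ e k x u) × (e k x u ≤ (1ℚ + 3ℚ * (⟦ k ⟧ * τ)) * ι)
        bounds = go k ℕₚ.≤-refl
          where
          go : ∀ k′ .{{_ : ℕ.NonZero k′}} → k′ ℕ.≤ k → ∀ x u →
            ((1ℚ - 2ℚ * (⟦ k′ ⟧ * τ)) * ι ≤ e k′ x u) × (e k′ x u ≤ (1ℚ + 3ℚ * (⟦ k′ ⟧ * τ)) * ι)
          go (suc i) i<k x u with e-bounds i (ℕₚ.<⇒≤ i<k) x u
          ... | lo , hi =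
            ≤-trans (*-monoʳ 0≤ι (ℚₚ.+-monoʳ-≤ 1ℚ (ℚₚ.neg-antimono-≤ (*-monoˡ (⟦⟧-nonNeg 2) T≤)))) lo ,
            ≤-trans hi (*-monoʳ 0≤ι (ℚₚ.+-monoʳ-≤ 1ℚ (*-monoˡ 0≤3 T≤)))
            where
            T≤ : ⟦ i ⟧ * τ ≤ ⟦ suc i ⟧ * τ
            T≤ = *-monoʳ 0≤τ (⟦⟧-mono (ℕₚ.n≤1+n i))

      -- e_k loses at most 2/100 and Mᵏ at most 1/100 of ι, which leaves 97/100. In `pow-a-upper`
      -- the corresponding sum is 1 + 3/100 + 1/100.
      pow-a-lower : ∀ x u → (+ 19 / 20) * ι ≤ pow a k x u
      pow-a-lower x u = begin
        (+ 19 / 20) * ι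
          ≤⟨ ≤-because (+-nonNeg (+-nonNeg (*-nonNeg (ℚₚ.nonNegative⁻¹ (+ 1 / 50)) 0≤ι)
               (*-nonNeg (*-nonNeg (⟦⟧-nonNeg 2) (≤⇒0≤- kτ≤)) 0≤ι)) (*-nonNeg (≤⇒0≤- τ≤) 0≤ι))
               (solve 3 (λ T t i → (con 1ℚ :- con 2ℚ :* T) :* i :+ :- (t :* i) :- con (+ 19 / 20) :* i :=
                 con (+ 1 / 50) :* i :+ con 2ℚ :* (con (+ 1 / 100) :- T) :* i :+ (con (+ 1 / 100) :- t) :* i) refl (⟦ k ⟧ * τ) τ ι) ⟩
        (1ℚ - 2ℚ * (⟦ k ⟧ * τ)) * ι + - (τ * ι)
          ≤⟨ ℚₚ.+-mono-≤ (proj₁ (bounds x u)) (proj₁ (∣p∣≤⇒ (τ * ι) (small x u))) ⟩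
        e k x u + pow M k x u
          ≡⟨ solve 2 (λ p m → p :- m :+ m := p) refl (pow a k x u) (pow M k x u) ⟩
        pow a k x u ∎
        where open ≤-Reasoning

      pow-a-upper : ∀ x u → pow a k x u ≤ (+ 21 / 20) * ι
      pow-a-upper x u = begin
        pow a k x u
          ≡⟨ solve 2 (λ p m → p :- m :+ m := p) refl (pow a k x u) (pow M k x u) ⟨
        e k x u + pow M k x u
          ≤⟨ ℚₚ.+-mono-≤ (proj₂ (bounds x u)) (proj₂ (∣p∣≤⇒ (τ * ι) (small x u))) ⟩
        (1ℚ + 3ℚ * (⟦ k ⟧ * τ)) * ι + τ * ι
          ≤⟨ ≤-because (+-nonNeg (+-nonNeg (*-nonNeg (ℚₚ.nonNegative⁻¹ (+ 1 / 100)) 0≤ι) (*-nonNeg (*-nonNeg 0≤3 (≤⇒0≤- kτ≤)) 0≤ι)) (*-nonNeg (≤⇒0≤- τ≤) 0≤ι))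
               (solve 3 (λ T t i → con (+ 21 / 20) :* i :- ((con 1ℚ :+ con 3ℚ :* T) :* i :+ t :* i) :=
                 con (+ 1 / 100) :* i :+ con 3ℚ :* (con (+ 1 / 100) :- T) :* i :+ (con (+ 1 / 100) :- t) :* i) refl (⟦ k ⟧ * τ) τ ι) ⟩
        (+ 21 / 20) * ι ∎
        where open ≤-Reasoning

      module _ (P : Fin n → Fin n → ℚ) (0≤P : ∀ x z → 0ℚ ≤ P x z)
        (P≤a : ∀ x z → (1ℚ - δ) * P x z ≤ a x z) (a≤P : ∀ x z → a x z ≤ (1ℚ + δ) * P x z)
        where

        private
          0≤1-δ : 0ℚ ≤ 1ℚ - δ
          0≤1-δ = ≤⇒0≤- δ≤1

          g h : ℚ
          g = (1ℚ - δ) ^ k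
          h = (1ℚ + δ) ^ k

          g≥ : + 99 / 100 ≤ g
          g≥ = ≤-trans (≤-because (≤⇒0≤- (≤-trans (*-monoˡ (⟦⟧-nonNeg k) δ≤τ) kτ≤))
                 (solve 1 (λ t → con 1ℚ :- t :- con (+ 99 / 100) := con (+ 1 / 100) :- t) refl (⟦ k ⟧ * δ)))
               (bernoulli k 0≤δ δ≤1)

          0≤g : 0ℚ ≤ g
          0≤g = ^-nonNeg k 0≤1-δ

          -- Bernoulli's inequality bounds g = (1 - δ)ᵏ from below; this product transfers the
          -- control to h = (1 + δ)ᵏ.
          gh≤1 : g * h ≤ 1ℚ
          gh≤1 = subst (_≤ 1ℚ) (^-distrib-* (1ℚ - δ) (1ℚ + δ) k) (^-≤1 k (*-nonNeg 0≤1-δ (+-nonNeg 0≤1 0≤δ))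
            (≤-because (square-nonNeg δ) (solve 1 (λ d → con 1ℚ :- (con 1ℚ :- d) :* (con 1ℚ :+ d) := d :* d) refl δ)))

          scaled-upper : ∀ x u → g * pow P k x u ≤ pow a k x u
          scaled-upper x u = subst (_≤ pow a k x u) (pow-scale P (1ℚ - δ) k x u)
            (pow-mono (λ x z → (1ℚ - δ) * P x z) (λ x z → *-nonNeg 0≤1-δ (0≤P x z)) P≤a k x u)

          scaled-lower : ∀ x u → pow a k x u ≤ h * pow P k x u
          scaled-lower x u = subst (pow a k x u ≤_) (pow-scale P (1ℚ + δ) k x u) (pow-mono a 0≤a a≤P k x u)

        pow-P-lower : ∀ x u → (+ 99 / 100) * ((+ 19 / 20) * ι) ≤ pow P k x u
        pow-P-lower x u = begin
          (+ 99 / 100) * ((+ 19 / 20) * ι)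
            ≤⟨ *-mono (ℚₚ.nonNegative⁻¹ (+ 99 / 100)) (pow-nonNeg a 0≤a k x u) g≥ (pow-a-lower x u) ⟩
          g * pow a k x u
            ≤⟨ *-monoˡ 0≤g (scaled-lower x u) ⟩
          g * (h * pow P k x u)
            ≡⟨ ℚₚ.*-assoc g h (pow P k x u) ⟨
          g * h * pow P k x u
            ≤⟨ *-monoʳ (pow-nonNeg P 0≤P k x u) gh≤1 ⟩
          1ℚ * pow P k x u
            ≡⟨ ℚₚ.*-identityˡ _ ⟩
          pow P k x u ∎
          where open ≤-Reasoning

        pow-P-ratio : ∀ x y u → pow P k x u ≤ 2ℚ * pow P k y u
        pow-P-ratio x y u = *-cancelˡ (ℚₚ.positive⁻¹ (+ 99 / 100)) (begin
          (+ 99 / 100) * pow P k x u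
            ≤⟨ *-monoʳ (pow-nonNeg P 0≤P k x u) g≥ ⟩
          g * pow P k x u
            ≤⟨ ≤-trans (scaled-upper x u) (pow-a-upper x u) ⟩
          (+ 21 / 20) * ι
            -- A comparison of numbers: 1.05 against roughly 1.86, so the ratio 2 is far from tight.
            ≤⟨ *-monoʳ 0≤ι (ℚₚ.≤ᵇ⇒≤ {+ 21 / 20} {(+ 99 / 100) * (2ℚ * ((+ 99 / 100) * (+ 19 / 20)))} _) ⟩
          (+ 99 / 100) * (2ℚ * ((+ 99 / 100) * (+ 19 / 20))) * ι
            ≡⟨ solve 1 (λ i → con (+ 99 / 100) :* (con 2ℚ :* (con (+ 99 / 100) :* con (+ 19 / 20))) :* i :=
                 con (+ 99 / 100) :* (con 2ℚ :* (con (+ 99 / 100) :* (con (+ 19 / 20) :* i)))) refl ι ⟩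
          (+ 99 / 100) * (2ℚ * ((+ 99 / 100) * ((+ 19 / 20) * ι)))
            ≤⟨ *-monoˡ (ℚₚ.nonNegative⁻¹ (+ 99 / 100)) (*-monoˡ (⟦⟧-nonNeg 2) (pow-P-lower y u)) ⟩
          (+ 99 / 100) * (2ℚ * pow P k y u) ∎)
          where open ≤-Reasoning

  -- Typical graphs

  sum-tabulate : ∀ {n} (b : Fin n → Bool) → sum (λ z → if b z then 1ℚ else 0ℚ) ≡ ⟦ Subset.∣ Vec.tabulate b ∣ ⟧
  sum-tabulate {zero}  b = refl
  sum-tabulate {suc n} b with b zero
  ... | true  = trans (cong (λ y → 1ℚ + y) (sum-tabulate (b ∘ suc))) (sym (⟦⟧-suc Subset.∣ Vec.tabulate (b ∘ suc) ∣))
  ... | false = trans (ℚₚ.+-identityˡ _) (sum-tabulate (b ∘ suc))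

  reciprocal : ℕ → ℚ
  reciprocal zero    = 0ℚ
  reciprocal (suc d) = + 1 / suc d

  reciprocal-inverse : ∀ d .{{_ : ℕ.NonZero d}} → ⟦ d ⟧ * reciprocal d ≡ 1ℚ
  reciprocal-inverse d@(suc d-1) = ℚₚ.toℚᵘ-injective (begin
    toℚᵘ (⟦ d ⟧ * reciprocal d)
      ≈⟨ ℚₚ.toℚᵘ-homo-* ⟦ d ⟧ (reciprocal d) ⟩
    toℚᵘ ⟦ d ⟧ ℚᵘ.* toℚᵘ (reciprocal d)
      ≈⟨ ℚᵘₚ.*-cong (toℚᵘ-/1 (+ d)) (ℚₚ.toℚᵘ-fromℚᵘ (ℚᵘ.mkℚᵘ (+ 1) d-1)) ⟩
    ℚᵘ.mkℚᵘ (+ d) 0 ℚᵘ.* ℚᵘ.mkℚᵘ (+ 1) d-1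
      ≈⟨ ℚᵘ.*≡* (cong +_ (trans (ℕₚ.*-identityʳ (d ℕ.* 1)) (trans (ℕₚ.*-identityʳ d) (sym (trans (ℕₚ.*-identityˡ _) (ℕₚ.*-identityˡ d)))))) ⟩
    ℚᵘ.1ℚᵘ ∎)
    where open ℚᵘₚ.≃-Reasoning

  reciprocal-nonNeg : ∀ d → 0ℚ ≤ reciprocal d
  reciprocal-nonNeg zero    = ≤-refl
  reciprocal-nonNeg (suc d) = ℚₚ.nonNegative⁻¹ _ {{ℚₚ.normalize-nonNeg 1 (suc d)}}

  ^-mono-< : ∀ {p q} n .{{_ : ℕ.NonZero n}} → 0ℚ ≤ p → p < q → p ^ n < q ^ n
  ^-mono-< {p} {q} (suc n) 0≤p p<q = ℚₚ.≤-<-trans (*-monoˡ 0≤p (^-mono-≤ n 0≤p (<⇒≤ p<q)))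
    (ℚₚ.*-monoˡ-<-pos (q ^ n) {{positive (^-pos n (ℚₚ.≤-<-trans 0≤p p<q))}} p<q)

  ^-cancel-≤ : ∀ {p q} n .{{_ : ℕ.NonZero n}} → 0ℚ ≤ q → p ^ n ≤ q ^ n → p ≤ q
  ^-cancel-≤ n 0≤q pⁿ≤qⁿ = ℚₚ.≮⇒≥ λ q<p → ℚₚ.<-irrefl refl (ℚₚ.<-≤-trans (^-mono-< n 0≤q q<p) pⁿ≤qⁿ)

  ∣p∣*∣p∣ : ∀ p → ∣ p ∣ * ∣ p ∣ ≡ p * p
  ∣p∣*∣p∣ p = trans (sym (ℚₚ.∣p*q∣≡∣p∣*∣q∣ p p)) (ℚₚ.0≤p⇒∣p∣≡p (square-nonNeg p))

  ∣p∣≤-square : ∀ {p b} → 0ℚ ≤ b → p * p ≤ b * b → ∣ p ∣ ≤ b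
  ∣p∣≤-square {p} {b} 0≤b pp≤bb = square-cancel-≤ 0≤b (subst (_≤ b * b) (sym (∣p∣*∣p∣ p)) pp≤bb)

  ^-double : ∀ p k → p ^ (k ℕ.+ k) ≡ (p * p) ^ k
  ^-double p k = trans (^-homo-* p k k) (square-^ p k)

  ∣p∣≤-even : ∀ {p b} k .{{_ : ℕ.NonZero k}} → 0ℚ ≤ b → p ^ (k ℕ.+ k) ≤ b ^ (k ℕ.+ k) → ∣ p ∣ ≤ b
  ∣p∣≤-even {p} {b} k 0≤b p²ᵏ≤b²ᵏ = ∣p∣≤-square 0≤b (^-cancel-≤ k (square-nonNeg b) (subst₂ _≤_ (^-double p k) (^-double b k) p²ᵏ≤b²ᵏ))

  even-nonNeg : ∀ p k → 0ℚ ≤ p ^ (k ℕ.+ k)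
  even-nonNeg p k = subst (0ℚ ≤_) (sym (^-double p k)) (^-nonNeg k (square-nonNeg p))

  if-nonNeg : ∀ (b : Bool) {p} → 0ℚ ≤ p → 0ℚ ≤ (if b then p else 0ℚ)
  if-nonNeg true  0≤p = 0≤p
  if-nonNeg false 0≤p = ≤-refl

  *-if-≤ : ∀ (b : Bool) {c p r} → c * p ≤ r → c * (if b then p else 0ℚ) ≤ (if b then r else 0ℚ)
  *-if-≤ true      cp≤r = cp≤r
  *-if-≤ false {c} cp≤r = ≤-reflexive (ℚₚ.*-zeroʳ c)

  if-≤-* : ∀ (b : Bool) {c p r} → r ≤ c * p → (if b then r else 0ℚ) ≤ c * (if b then p else 0ℚ)
  if-≤-* true      r≤cp = r≤cp
  if-≤-* false {c} r≤cp = ≤-reflexive (sym (ℚₚ.*-zeroʳ c))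

  if-centred : ∀ (b : Bool) {q κ ι} → q * κ ≡ ι → (if b then κ else 0ℚ) ≡ ((if b then 1ℚ else 0ℚ) - q) * κ + ι
  if-centred true  {q} {κ} refl = solve 2 (λ q k → k := (con 1ℚ :- q) :* k :+ q :* k) refl q κ
  if-centred false {q} {κ} refl = solve 2 (λ q k → con 0ℚ := (con 0ℚ :- q) :* k :+ q :* k) refl q κ

  -- Degree 0 would make the deviation from 1 equal to -1, below -δ.
  reciprocal-inverse-near : ∀ d {δ κ} → δ < 1ℚ → - δ ≤ ⟦ d ⟧ * κ - 1ℚ → ⟦ d ⟧ * reciprocal d ≡ 1ℚ
  reciprocal-inverse-near (suc d)       δ<1 -δ≤ = reciprocal-inverse (suc d)
  reciprocal-inverse-near zero {δ} {κ} δ<1 -δ≤ = contradiction refl (ℚₚ.<⇒≢ (ℚₚ.<-≤-trans (ℚₚ.neg-antimono-< δ<1) (subst (- δ ≤_)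
    (solve 1 (λ k → con 0ℚ :* k :- con 1ℚ := :- con 1ℚ) refl κ) -δ≤)))

  -- Markov's inequality before expectations are taken: where A fails, z > 1 and the left side is
  -- negative.
  ≤-indicator : ∀ {A : Set} (A? : Dec A) {z} → 0ℚ ≤ z → (z ≤ 1ℚ → A) → 1ℚ - z ≤ (if does A? then 1ℚ else 0ℚ)
  ≤-indicator (yes _) {z} 0≤z _ = ≤-because 0≤z (solve 1 (λ z → con 1ℚ :- (con 1ℚ :- z) := z) refl z)
  ≤-indicator (no ¬A) {z} _   f = ≤-because (≤⇒0≤- (<⇒≤ (ℚₚ.≰⇒> (¬A ∘ f))))
    (solve 1 (λ z → con 0ℚ :- (con 1ℚ :- z) := z :- con 1ℚ) refl z)

  -- `simpleRandomWalk` with entries in ℚ, so that its powers can be compared by a decision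
  -- procedure.
  walkMatrix : ∀ {n} → Graph n → Fin n → Fin n → ℚ
  walkMatrix G x z = if adj G x z then reciprocal (degree G x) else 0ℚ

  walkMatrix-nonNeg : ∀ {n} (G : Graph n) x z → 0ℚ ≤ walkMatrix G x z
  walkMatrix-nonNeg G x z = if-nonNeg (adj G x z) (reciprocal-nonNeg (degree G x))

  -- What the stationary bound needs of a graph, in terms of finitely many comparisons of rationals.
  -- Here c stands for t np; the last condition is there for connectedness.
  Good : ∀ {n} → ℚ → ℕ → Graph n → Set
  Good c k G =
    (∀ v → ⟦ degree G v ⟧ ≤ c) ×
    (∀ x y u → pow (walkMatrix G) k x u ≤ 2ℚ * pow (walkMatrix G) k y u) ×
    (∀ x u → 0ℚ < pow (walkMatrix G) k x u)

  good? : ∀ {n} c k (G : Graph n) → Dec (Good c k G)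
  good? c k G =
    Finₚ.all? (λ v → ⟦ degree G v ⟧ ℚₚ.≤? c) ×-dec
    Finₚ.all? (λ x → Finₚ.all? λ y → Finₚ.all? λ u → pow (walkMatrix G) k x u ℚₚ.≤? 2ℚ * pow (walkMatrix G) k y u) ×-dec
    Finₚ.all? (λ x → Finₚ.all? λ u → 0ℚ ℚₚ.<? pow (walkMatrix G) k x u)

  module _ {n} (q κ ι δ τ c : ℚ) (k : ℕ) .{{_ : ℕ.NonZero k}}
    (0≤q : 0ℚ ≤ q) (q≤1 : q ≤ 1ℚ) (0≤κ : 0ℚ ≤ κ) (κ≤1 : κ ≤ 1ℚ) (qκ≡ι : q * κ ≡ ι)
    (nι≡1 : ⟦ n ⟧ * ι ≡ 1ℚ) (0<ι : 0ℚ < ι)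
    (0≤δ : 0ℚ ≤ δ) (3ᵏδ≤τ : 3ℚ ^ k * δ ≤ τ) (kτ≤ : ⟦ k ⟧ * τ ≤ + 1 / 100) (τ≤ : τ ≤ + 1 / 100)
    (c≥ : (1ℚ + δ) * (⟦ n ⟧ * q) ≤ c)
    where

    open ErdősRényi q 0≤q q≤1
    open Moments q κ ι 0≤q q≤1 0≤κ κ≤1 qκ≡ι

    private
      0≤τι : 0ℚ ≤ τ * ι
      0≤τι = *-nonNeg (≤-trans (*-nonNeg (^-nonNeg k (⟦⟧-nonNeg 3)) 0≤δ) 3ᵏδ≤τ) (<⇒≤ 0<ι)

      δ<1 : δ < 1ℚ
      δ<1 = ℚₚ.≤-<-trans (≤-trans (subst (_≤ 3ℚ ^ k * δ) (ℚₚ.*-identityˡ δ) (*-monoʳ 0≤δ (1≤^ k (⟦⟧-mono {1} {3} (ℕ.s≤s ℕ.z≤n))))) (≤-trans 3ᵏδ≤τ τ≤))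
        (*<* (ℤ.+<+ (ℕ.s≤s (ℕ.s≤s ℕ.z≤n))))

    module _ (G : Graph n) where

      rowSum-centred : ∀ x → sum (centred G x) ≡ ⟦ degree G x ⟧ * κ - 1ℚ
      rowSum-centred x = begin
        sum (λ z → ((if adj G x z then 1ℚ else 0ℚ) - q) * κ)
          ≡⟨ sum-cong-≗ (λ z → trans (ℚₚ.*-distribʳ-+ κ (if adj G x z then 1ℚ else 0ℚ) (- q))
               (cong (λ y → (if adj G x z then 1ℚ else 0ℚ) * κ + y) (trans (sym (ℚₚ.neg-distribˡ-* q κ)) (cong -_ qκ≡ι)))) ⟩
        sum (λ z → (if adj G x z then 1ℚ else 0ℚ) * κ + (- ι))
          ≡⟨ ∑-distrib-+ (λ z → (if adj G x z then 1ℚ else 0ℚ) * κ) (λ _ → - ι) ⟩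
        sum (λ z → (if adj G x z then 1ℚ else 0ℚ) * κ) + sum {n} (λ _ → - ι)
          ≡⟨ cong₂ _+_ (trans (sym (*-distribʳ-sum κ (λ z → if adj G x z then 1ℚ else 0ℚ))) (cong (_* κ) (sum-tabulate (adj G x))))
               (trans (sum-const n (- ι)) (trans (sym (ℚₚ.neg-distribʳ-* ⟦ n ⟧ ι)) (cong -_ nι≡1))) ⟩
        ⟦ degree G x ⟧ * κ - 1ℚ ∎
        where open ≡-Reasoning

      Typical : Set
      Typical = (∀ x u → ∣ pow (centred G) k x u ∣ ≤ τ * ι) × (∀ x → ∣ sum (centred G x) ∣ ≤ δ)

      typical⇒good : Typical → Good c k G
      typical⇒good (small , rows) = degrees , F.pow-P-ratio small P (walkMatrix-nonNeg G) P≤a a≤P ,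
        λ x u → ℚₚ.<-≤-trans (*-pos (ℚₚ.positive⁻¹ (+ 99 / 100)) (*-pos (ℚₚ.positive⁻¹ (+ 19 / 20)) 0<ι))
          (F.pow-P-lower small P (walkMatrix-nonNeg G) P≤a a≤P x u)
        where
        P a : Fin n → Fin n → ℚ
        P = walkMatrix G
        a x z = if adj G x z then κ else 0ℚ

        d : Fin n → ℚ
        d x = ⟦ degree G x ⟧

        0≤a : ∀ x z → 0ℚ ≤ a x z
        0≤a x z = if-nonNeg (adj G x z) 0≤κ

        a≡ : ∀ x z → a x z ≡ centred G x z + ι
        a≡ x z = if-centred (adj G x z) qκ≡ι

        module F = Flat a (centred G) ι δ τ k 0≤a a≡ (λ i j → cong entry (adj-sym G i j)) nι≡1 (<⇒≤ 0<ι) 0≤δ 3ᵏδ≤τ kτ≤ τ≤ rows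

        nearly : ∀ x → (- δ ≤ d x * κ - 1ℚ) × (d x * κ - 1ℚ ≤ δ)
        nearly x = ∣p∣≤⇒ δ (subst (λ r → ∣ r ∣ ≤ δ) (rowSum-centred x) (rows x))

        νκ≡1 : ⟦ n ⟧ * q * κ ≡ 1ℚ
        νκ≡1 = trans (ℚₚ.*-assoc ⟦ n ⟧ q κ) (trans (cong (⟦ n ⟧ *_) qκ≡ι) nι≡1)

        degrees : ∀ x → d x ≤ c
        degrees x = begin
          d x                           ≡⟨ ℚₚ.*-identityʳ (d x) ⟨
          d x * 1ℚ                      ≡⟨ cong (d x *_) νκ≡1 ⟨
          d x * (⟦ n ⟧ * q * κ)         ≡⟨ solve 3 (λ d m k → d :* (m :* k) := (con 1ℚ :+ (d :* k :- con 1ℚ)) :* m) refl (d x) (⟦ n ⟧ * q) κ ⟩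
          (1ℚ + (d x * κ - 1ℚ)) * (⟦ n ⟧ * q) ≤⟨ *-monoʳ (*-nonNeg (⟦⟧-nonNeg n) 0≤q) (ℚₚ.+-monoʳ-≤ 1ℚ (proj₂ (nearly x))) ⟩
          (1ℚ + δ) * (⟦ n ⟧ * q)        ≤⟨ c≥ ⟩
          c                             ∎
          where open ≤-Reasoning

        inverse : ∀ x → d x * reciprocal (degree G x) ≡ 1ℚ
        inverse x = reciprocal-inverse-near (degree G x) {δ} {κ} δ<1 (proj₁ (nearly x))

        -- So row x of a is d x * κ times row x of P, and d x * κ is within δ of 1.
        κ≡ : ∀ x → κ ≡ d x * κ * reciprocal (degree G x)
        κ≡ x = trans (sym (ℚₚ.*-identityˡ κ)) (trans (cong (_* κ) (sym (inverse x)))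
          (solve 3 (λ d r k → d :* r :* k := d :* k :* r) refl (d x) (reciprocal (degree G x)) κ))

        P≤a : ∀ x z → (1ℚ - δ) * P x z ≤ a x z
        P≤a x z = *-if-≤ (adj G x z) {1ℚ - δ} {reciprocal (degree G x)} {κ} (subst ((1ℚ - δ) * reciprocal (degree G x) ≤_) (sym (κ≡ x))
          (*-monoʳ {1ℚ - δ} {d x * κ} {reciprocal (degree G x)} (reciprocal-nonNeg (degree G x))
            (≤-because (≤⇒0≤- (proj₁ (nearly x))) (solve 2 (λ y d → y :- (con 1ℚ :- d) := y :- con 1ℚ :- :- d) refl (d x * κ) δ))))

        a≤P : ∀ x z → a x z ≤ (1ℚ + δ) * P x z
        a≤P x z = if-≤-* (adj G x z) {1ℚ + δ} {reciprocal (degree G x)} {κ} (subst (_≤ (1ℚ + δ) * reciprocal (degree G x)) (sym (κ≡ x))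
          (*-monoʳ {d x * κ} {1ℚ + δ} {reciprocal (degree G x)} (reciprocal-nonNeg (degree G x))
            (≤-because (≤⇒0≤- (proj₂ (nearly x))) (solve 2 (λ y d → con 1ℚ :+ d :- y := d :- (y :- con 1ℚ)) refl (d x * κ) δ))))

      trace rowMoment : ℚ
      trace     = sum (λ x → pow (centred G) (k ℕ.+ k) x x)
      rowMoment = sum (λ x → walkSum (centred G) (λ x _ → x) (λ _ → 1ℚ) (k ℕ.+ k) x)

      trace≡ : trace ≡ sum (λ x → sum (λ u → pow (centred G) k x u * pow (centred G) k x u))
      trace≡ = sum-cong-≗ (pow-diagonal (centred G) (λ i j → cong entry (adj-sym G i j)) k)

      rowMoment≡ : rowMoment ≡ sum (λ x → sum (centred G x) ^ (k ℕ.+ k))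
      rowMoment≡ = sum-cong-≗ (star (centred G) (k ℕ.+ k))

      trace-nonNeg : 0ℚ ≤ trace
      trace-nonNeg = subst (0ℚ ≤_) (sym trace≡) (sum-nonNeg λ x → sum-nonNeg λ u → square-nonNeg (pow (centred G) k x u))

      rowMoment-nonNeg : 0ℚ ≤ rowMoment
      rowMoment-nonNeg = subst (0ℚ ≤_) (sym rowMoment≡) (sum-nonNeg λ x → even-nonNeg (sum (centred G x)) k)

      -- Both moments are sums of squares or even powers, so each single term obeys the bound on the
      -- sum.
      moments⇒typical : trace ≤ (τ * ι) * (τ * ι) → rowMoment ≤ δ ^ (k ℕ.+ k) → Typical
      moments⇒typical tr≤ row≤ =
        (λ x u → ∣p∣≤-square 0≤τι (≤-trans (≤-trans
          (term≤sum (λ u → square-nonNeg (pow (centred G) k x u)) u)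
          (term≤sum (λ x → sum-nonNeg λ u → square-nonNeg (pow (centred G) k x u)) x))
          (subst (_≤ (τ * ι) * (τ * ι)) trace≡ tr≤))) ,
        (λ x → ∣p∣≤-even k 0≤δ (≤-trans (term≤sum (λ x → even-nonNeg (sum (centred G x)) k) x)
          (subst (_≤ δ ^ (k ℕ.+ k)) rowMoment≡ row≤)))

    module _ (τ⁻¹ δ⁻¹ : ℚ) (ττ⁻¹≡1 : τ * τ⁻¹ ≡ 1ℚ) (δδ⁻¹≡1 : δ * δ⁻¹ ≡ 1ℚ) where

      private
        -- w₁ and w₂ are the inverses of the thresholds (τ ι)² and δ²ᵏ. In the weighted sum Z both
        -- thresholds become 1, so one use of Markov's inequality covers the entries of Mᵏ and the
        -- row sums together.
        w₁ w₂ C : ℚ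
        w₁ = (⟦ n ⟧ * τ⁻¹) * (⟦ n ⟧ * τ⁻¹)
        w₂ = δ⁻¹ ^ (k ℕ.+ k)
        C  = ⟦ walkConst (k ℕ.+ k) 0 ⟧

        0≤w₂ : 0ℚ ≤ w₂
        0≤w₂ = even-nonNeg δ⁻¹ k

        0≤w₁ : 0ℚ ≤ w₁
        0≤w₁ = square-nonNeg (⟦ n ⟧ * τ⁻¹)

        Z : Graph n → ℚ
        Z G = w₁ * trace G + w₂ * rowMoment G

        unscale : ∀ {w s t} → s * w ≡ 1ℚ → 0ℚ ≤ s → w * t ≤ 1ℚ → t ≤ s
        unscale {w} {s} {t} sw≡1 0≤s wt≤1 = begin
          t            ≡⟨ ℚₚ.*-identityˡ t ⟨
          1ℚ * t       ≡⟨ cong (_* t) sw≡1 ⟨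
          s * w * t    ≡⟨ ℚₚ.*-assoc s w t ⟩
          s * (w * t)  ≤⟨ *-monoˡ 0≤s wt≤1 ⟩
          s * 1ℚ       ≡⟨ ℚₚ.*-identityʳ s ⟩
          s            ∎
          where open ≤-Reasoning

        w₁-inverse : (τ * ι) * (τ * ι) * w₁ ≡ 1ℚ
        w₁-inverse = trans (solve 4 (λ t i n s → (t :* i) :* (t :* i) :* ((n :* s) :* (n :* s)) :=
            (n :* i) :* (t :* s) :* ((n :* i) :* (t :* s))) refl τ ι ⟦ n ⟧ τ⁻¹)
          (cong₂ (λ y w → y * w * (y * w)) nι≡1 ττ⁻¹≡1)

        w₂-inverse : δ ^ (k ℕ.+ k) * w₂ ≡ 1ℚ
        w₂-inverse = trans (sym (^-distrib-* δ δ⁻¹ (k ℕ.+ k))) (trans (cong (_^ (k ℕ.+ k)) δδ⁻¹≡1) (1^ (k ℕ.+ k)))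

        Z-nonNeg : ∀ G → 0ℚ ≤ Z G
        Z-nonNeg G = +-nonNeg (*-nonNeg 0≤w₁ (trace-nonNeg G)) (*-nonNeg 0≤w₂ (rowMoment-nonNeg G))

        Z≤1⇒good : ∀ G → Z G ≤ 1ℚ → Good c k G
        Z≤1⇒good G Z≤1 = typical⇒good G (moments⇒typical G
          (unscale w₁-inverse (square-nonNeg (τ * ι))
            (≤-trans (≤-because (*-nonNeg 0≤w₂ (rowMoment-nonNeg G)) (solve 2 (λ a b → a :+ b :- a := b) refl (w₁ * trace G) (w₂ * rowMoment G))) Z≤1))
          (unscale w₂-inverse (even-nonNeg δ k)
            (≤-trans (≤-because (*-nonNeg 0≤w₁ (trace-nonNeg G)) (solve 2 (λ a b → a :+ b :- b := a) refl (w₁ * trace G) (w₂ * rowMoment G))) Z≤1)))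

        markov : ∀ G → 1ℚ - Z G ≤ (if does (good? c k G) then 1ℚ else 0ℚ)
        markov G = ≤-indicator (good? c k G) (Z-nonNeg G) (Z≤1⇒good G)

        nι≤1 : ⟦ n ⟧ * ι ≤ 1ℚ
        nι≤1 = ≤-reflexive nι≡1

        δ-range : (x y : Fin n) → (0ℚ ≤ δ[ x , y ]) × (δ[ x , y ] ≤ 1ℚ)
        δ-range x y with x == y
        ... | true  = 0≤1 , ≤-refl
        ... | false = ≤-refl , 0≤1

        𝔼-sum-bound : ∀ (f : Fin n → Graph n → ℚ) → (∀ x → 𝔼 (graph n) (f x) ≤ C * κ ^ k) → 𝔼 (graph n) (λ G → sum (λ x → f x G)) ≤ ⟦ n ⟧ * (C * κ ^ k)
        𝔼-sum-bound f bound = ≤-trans (≤-reflexive (𝔼-sum (graph n) f)) (≤-trans (sum-mono bound) (≤-reflexive (sum-const n (C * κ ^ k))))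

        𝔼-trace : 𝔼 (graph n) trace ≤ ⟦ n ⟧ * (C * κ ^ k)
        𝔼-trace = 𝔼-sum-bound (λ x G → pow (centred G) (k ℕ.+ k) x x) λ x →
          walk-moment q κ ι 0≤q q≤1 0≤κ κ≤1 qκ≡ι nι≤1 (λ _ z → z) (λ z → δ[ z , x ]) (λ z → proj₁ (δ-range z x)) (λ z → proj₂ (δ-range z x)) k x

        𝔼-rowMoment : 𝔼 (graph n) rowMoment ≤ ⟦ n ⟧ * (C * κ ^ k)
        𝔼-rowMoment = 𝔼-sum-bound (λ x G → walkSum (centred G) (λ x _ → x) (λ _ → 1ℚ) (k ℕ.+ k) x) λ x →
          walk-moment q κ ι 0≤q q≤1 0≤κ κ≤1 qκ≡ι nι≤1 (λ x _ → x) (λ _ → 1ℚ) (λ _ → 0≤1) (λ _ → ≤-refl) k x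

      good-probability : ∀ ε → 1ℚ ≤ ⟦ n ⟧ → ⟦ n ⟧ * ⟦ n ⟧ * ⟦ n ⟧ * κ ^ k ≤ ε →
        1ℚ - ⟦ walkConst (k ℕ.+ k) 0 ⟧ * (τ⁻¹ * τ⁻¹ + δ⁻¹ ^ (k ℕ.+ k)) * ε ≤ 𝔼 (graph n) (λ G → if does (good? c k G) then 1ℚ else 0ℚ)
      good-probability ε 1≤n n³κᵏ≤ε = begin
        1ℚ - C * (τ⁻¹ * τ⁻¹ + w₂) * ε
          ≤⟨ ℚₚ.+-monoʳ-≤ 1ℚ (ℚₚ.neg-antimono-≤ 𝔼Z≤) ⟩
        1ℚ - 𝔼 (graph n) Z
          ≡⟨ 𝔼-complement ⟨
        𝔼 (graph n) (λ G → 1ℚ - Z G)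
          ≤⟨ 𝔼-mono (graph n) markov ⟩
        𝔼 (graph n) (λ G → if does (good? c k G) then 1ℚ else 0ℚ) ∎
        where
        open ≤-Reasoning
        N : ℚ
        N = ⟦ n ⟧
        𝔼-complement : 𝔼 (graph n) (λ G → 1ℚ - Z G) ≡ 1ℚ - 𝔼 (graph n) Z
        𝔼-complement = trans (𝔼-cong (graph n) (λ G → solve 1 (λ z → con 1ℚ :- z := con 1ℚ :+ (:- con 1ℚ) :* z) refl (Z G)))
          (trans (𝔼-+ (graph n) (λ _ → 1ℚ) (λ G → - 1ℚ * Z G))
          (trans (cong₂ _+_ (𝔼-const (graph n) 1ℚ) (𝔼-* (graph n) (- 1ℚ) Z))
          (solve 1 (λ z → con 1ℚ :+ (:- con 1ℚ) :* z := con 1ℚ :- z) refl (𝔼 (graph n) Z))))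
        0≤Cn : 0ℚ ≤ C * (N * κ ^ k)
        0≤Cn = *-nonNeg (⟦⟧-nonNeg (walkConst (k ℕ.+ k) 0)) (*-nonNeg (⟦⟧-nonNeg n) (^-nonNeg k 0≤κ))
        𝔼Z≤ : 𝔼 (graph n) Z ≤ C * (τ⁻¹ * τ⁻¹ + w₂) * ε
        𝔼Z≤ = begin
          𝔼 (graph n) Z
            ≡⟨ trans (𝔼-+ (graph n) (λ G → w₁ * trace G) (λ G → w₂ * rowMoment G)) (cong₂ _+_ (𝔼-* (graph n) w₁ trace) (𝔼-* (graph n) w₂ rowMoment)) ⟩
          w₁ * 𝔼 (graph n) trace + w₂ * 𝔼 (graph n) rowMoment
            ≤⟨ ℚₚ.+-mono-≤ (*-monoˡ 0≤w₁ 𝔼-trace) (*-monoˡ 0≤w₂ 𝔼-rowMoment) ⟩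
          w₁ * (N * (C * κ ^ k)) + w₂ * (N * (C * κ ^ k))
            -- The trace brings n from its terms and n² from w₁. The row moments bring n only; n² ≥
            -- 1 lifts them to the same n³ κᵏ.
            ≤⟨ ≤-because (*-nonNeg (*-nonNeg 0≤w₂ 0≤Cn) (≤⇒0≤- (*-mono 0≤1 (⟦⟧-nonNeg n) 1≤n 1≤n)))
                 (solve 5 (λ N t C K w → C :* (t :* t :+ w) :* (N :* N :* N :* K) :- ((N :* t) :* (N :* t) :* (N :* (C :* K)) :+ w :* (N :* (C :* K))) :=
                   w :* (C :* (N :* K)) :* (N :* N :- con 1ℚ :* con 1ℚ)) refl N τ⁻¹ C (κ ^ k) w₂) ⟩
          C * (τ⁻¹ * τ⁻¹ + w₂) * (N * N * N * κ ^ k)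
            ≤⟨ *-monoˡ (*-nonNeg (⟦⟧-nonNeg (walkConst (k ℕ.+ k) 0)) (+-nonNeg (square-nonNeg τ⁻¹) 0≤w₂)) n³κᵏ≤ε ⟩
          C * (τ⁻¹ * τ⁻¹ + w₂) * ε ∎

open import Defs
open import Data.Bool.Base using (T)
open import Data.Rational.Base as ℚ using (ℚ; 0ℚ; 1ℚ; ½)
open Rat using (⟦_⟧; sum; pow; δ[_,_]; p≤∣p∣; 2ℚ; 3ℚ; walkMatrix; reciprocal; Good; _==_; ==⇒≡; walkConst; Expectation; module ErdősRényi)
  renaming (_^_ to _^ℚ_)
open Expectation

-- Real arithmetic

≤-eventually : ∀ {x y} N → (∀ m → N ℕ.≤ m → seq x m ℚ.≤ seq y m) → x ≤ y
≤-eventually {x} {y} N x≤y ε 0<ε = N , λ m N≤m →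
  subst (ℚ._≤ seq y m ℚ.+ ε) (ℚₚ.+-identityʳ (seq x m)) (ℚₚ.+-mono-≤ (x≤y m N≤m) (ℚₚ.<⇒≤ 0<ε))

≤-pointwise : ∀ {x y} → (∀ m → seq x m ℚ.≤ seq y m) → x ≤ y
≤-pointwise {x} {y} x≤y = ≤-eventually {x} {y} 0 (λ m _ → x≤y m)

≤-≗ : ∀ {x y} → (∀ m → seq x m ≡ seq y m) → x ≤ y
≤-≗ {x} {y} x≡y = ≤-pointwise {x} {y} (λ m → ℚₚ.≤-reflexive (x≡y m))

≤-refl : ∀ {x} → x ≤ x
≤-refl {x} = ≤-≗ {x} {x} (λ _ → refl)

private
  0<½ : 0ℚ ℚ.< ½
  0<½ = ℚₚ.positive⁻¹ ½

  half : ∀ {ε} → 0ℚ ℚ.< ε → 0ℚ ℚ.< ½ ℚ.* ε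
  half = Rat.*-pos 0<½

≤-trans : ∀ {x y z} → x ≤ y → y ≤ z → x ≤ z
≤-trans {x} {y} {z} x≤y y≤z ε 0<ε with x≤y (½ ℚ.* ε) (half 0<ε) | y≤z (½ ℚ.* ε) (half 0<ε)
... | M , f | N , g = M ℕ.⊔ N , λ m M⊔N≤m → begin
  seq x m                             ≤⟨ f m (ℕₚ.m⊔n≤o⇒m≤o M N M⊔N≤m) ⟩
  seq y m ℚ.+ ½ ℚ.* ε                 ≤⟨ ℚₚ.+-monoˡ-≤ (½ ℚ.* ε) (g m (ℕₚ.m⊔n≤o⇒n≤o M N M⊔N≤m)) ⟩
  seq z m ℚ.+ ½ ℚ.* ε ℚ.+ ½ ℚ.* ε     ≡⟨ solve 2 (λ z e → z :+ con ½ :* e :+ con ½ :* e := z :+ e) refl (seq z m) ε ⟩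
  seq z m ℚ.+ ε                       ∎
  where open ℚₚ.≤-Reasoning

+-mono-≤ : ∀ {x y u v} → x ≤ y → u ≤ v → x + u ≤ y + v
+-mono-≤ {x} {y} {u} {v} x≤y u≤v ε 0<ε with x≤y (½ ℚ.* ε) (half 0<ε) | u≤v (½ ℚ.* ε) (half 0<ε)
... | M , f | N , g = M ℕ.⊔ N , λ m M⊔N≤m → begin
  seq x m ℚ.+ seq u m
    ≤⟨ ℚₚ.+-mono-≤ (f m (ℕₚ.m⊔n≤o⇒m≤o M N M⊔N≤m)) (g m (ℕₚ.m⊔n≤o⇒n≤o M N M⊔N≤m)) ⟩
  (seq y m ℚ.+ ½ ℚ.* ε) ℚ.+ (seq v m ℚ.+ ½ ℚ.* ε)
    ≡⟨ solve 3 (λ y v e → (y :+ con ½ :* e) :+ (v :+ con ½ :* e) := y :+ v :+ e) refl (seq y m) (seq v m) ε ⟩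
  seq y m ℚ.+ seq v m ℚ.+ ε ∎
  where open ℚₚ.≤-Reasoning

+-nonNeg : ∀ {x y} → 0ℝ ≤ x → 0ℝ ≤ y → 0ℝ ≤ x + y
+-nonNeg {x} {y} = +-mono-≤ {0ℝ} {x} {0ℝ} {y}

≤⇒0≤- : ∀ {x y} → x ≤ y → 0ℝ ≤ y - x
≤⇒0≤- {x} {y} x≤y = ≤-trans {0ℝ} {x - x} {y - x}
  (≤-≗ {0ℝ} {x - x} (λ m → sym (ℚₚ.+-inverseʳ (seq x m))))
  (+-mono-≤ {x} {y} {(- x)} {(- x)} x≤y (≤-refl { - x}))

-- Operations on reals act term by term, so a ring identity is checked on rational terms, and only
-- the sign of d is a statement about reals.
≤-because : ∀ {x y d} → 0ℝ ≤ d → (∀ m → seq y m ℚ.- seq x m ≡ seq d m) → x ≤ y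
≤-because {x} {y} {d} 0≤d eq = ≤-trans {x} {x + d} {y}
  (≤-trans {x} {x + 0ℝ} {x + d} (≤-≗ {x} {x + 0ℝ} (λ m → sym (ℚₚ.+-identityʳ (seq x m))))
    (+-mono-≤ {x} {x} {0ℝ} {d} (≤-refl {x}) 0≤d))
  (≤-≗ {x + d} {y} (λ m → trans (cong (λ z → seq x m ℚ.+ z) (sym (eq m)))
    (solve 2 (λ x y → x :+ (y :- x) := y) refl (seq x m) (seq y m))))

upperBound : ∀ x → ∃ λ B → 0ℚ ℚ.≤ B × ∃ λ N → ∀ m → N ℕ.≤ m → seq x m ℚ.≤ B
upperBound x with cauchy x 1ℚ Rat.0<1
... | N , close = 1ℚ ℚ.+ ℚ.∣ seq x N ∣ , Rat.+-nonNeg Rat.0≤1 (ℚₚ.0≤∣p∣ (seq x N)) , N , λ m N≤m → begin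
  seq x m                               ≡⟨ solve 2 (λ a b → a := a :- b :+ b) refl (seq x m) (seq x N) ⟩
  seq x m ℚ.- seq x N ℚ.+ seq x N       ≤⟨ ℚₚ.+-mono-≤ (ℚₚ.≤-trans (p≤∣p∣ _) (close m N N≤m ℕₚ.≤-refl)) (p≤∣p∣ (seq x N)) ⟩
  1ℚ ℚ.+ ℚ.∣ seq x N ∣                  ∎
  where open ℚₚ.≤-Reasoning

inverse : ∀ p → 0ℚ ℚ.< p → ∃ λ r → 0ℚ ℚ.< r × p ℚ.* r ≡ 1ℚ
inverse p 0<p = (ℚ.1/ p) {{ℚₚ.pos⇒nonZero p {{ℚ.positive 0<p}}}} ,
  ℚₚ.positive⁻¹ _ {{ℚₚ.1/pos⇒pos p {{ℚ.positive 0<p}}}} ,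
  ℚₚ.*-inverseʳ p {{ℚₚ.pos⇒nonZero p {{ℚ.positive 0<p}}}}

-- With S = A + B + 1 + ε and e = ε / S: a b ≥ - e (a + b + e) ≥ - e S = - ε.
product-lower : ∀ a b A B ε e → (A ℚ.+ B ℚ.+ 1ℚ ℚ.+ ε) ℚ.* e ≡ ε → 0ℚ ℚ.≤ e → e ℚ.≤ 1ℚ → 0ℚ ℚ.≤ ε →
  a ℚ.≤ A → b ℚ.≤ B → 0ℚ ℚ.≤ a ℚ.+ e → 0ℚ ℚ.≤ b ℚ.+ e → 0ℚ ℚ.≤ a ℚ.* b ℚ.+ ε
product-lower a b A B ε e Se≡ε 0≤e e≤1 0≤ε a≤A b≤B 0≤a+e 0≤b+e = begin
  0ℚ
    ≤⟨ Rat.+-nonNeg (Rat.*-nonNeg 0≤a+e 0≤b+e) (Rat.*-nonNeg 0≤e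
         (Rat.+-nonNeg (Rat.+-nonNeg (Rat.+-nonNeg (Rat.≤⇒0≤- a≤A) (Rat.≤⇒0≤- b≤B)) (Rat.≤⇒0≤- e≤1)) 0≤ε)) ⟩
  (a ℚ.+ e) ℚ.* (b ℚ.+ e) ℚ.+ e ℚ.* ((A ℚ.- a) ℚ.+ (B ℚ.- b) ℚ.+ (1ℚ ℚ.- e) ℚ.+ ε)
    ≡⟨ identity a b e A B ε ⟩
  a ℚ.* b ℚ.+ (A ℚ.+ B ℚ.+ 1ℚ ℚ.+ ε) ℚ.* e
    ≡⟨ cong (λ z → a ℚ.* b ℚ.+ z) Se≡ε ⟩
  a ℚ.* b ℚ.+ ε ∎
  where
  open ℚₚ.≤-Reasoning
  identity : ∀ a b e A B ε → (a ℚ.+ e) ℚ.* (b ℚ.+ e) ℚ.+ e ℚ.* ((A ℚ.- a) ℚ.+ (B ℚ.- b) ℚ.+ (1ℚ ℚ.- e) ℚ.+ ε) ≡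
    a ℚ.* b ℚ.+ (A ℚ.+ B ℚ.+ 1ℚ ℚ.+ ε) ℚ.* e
  identity = solve 6 (λ a b e A B E → (a :+ e) :* (b :+ e) :+ e :* ((A :- a) :+ (B :- b) :+ (con 1ℚ :- e) :+ E) := a :* b :+ (A :+ B :+ con 1ℚ :+ E) :* e) refl

*-nonNeg : ∀ {x y} → 0ℝ ≤ x → 0ℝ ≤ y → 0ℝ ≤ x * y
*-nonNeg {x} {y} 0≤x 0≤y ε 0<ε = conclude (upperBound x) (upperBound y)
  where
  conclude : (∃ λ A → 0ℚ ℚ.≤ A × ∃ λ N → ∀ m → N ℕ.≤ m → seq x m ℚ.≤ A) →
             (∃ λ B → 0ℚ ℚ.≤ B × ∃ λ N → ∀ m → N ℕ.≤ m → seq y m ℚ.≤ B) →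
             ∃ λ N → ∀ m → N ℕ.≤ m → 0ℚ ℚ.≤ seq x m ℚ.* seq y m ℚ.+ ε
  conclude (A , 0≤A , N₁ , x≤A) (B , 0≤B , N₂ , y≤B) = (N₁ ℕ.⊔ N₂) ℕ.⊔ (N₃ ℕ.⊔ N₄) , λ m N≤m →
    let N₁₂≤m = ℕₚ.m⊔n≤o⇒m≤o (N₁ ℕ.⊔ N₂) (N₃ ℕ.⊔ N₄) N≤m
        N₃₄≤m = ℕₚ.m⊔n≤o⇒n≤o (N₁ ℕ.⊔ N₂) (N₃ ℕ.⊔ N₄) N≤m
    in product-lower (seq x m) (seq y m) A B ε e Se≡ε (ℚₚ.<⇒≤ 0<e) e≤1 (ℚₚ.<⇒≤ 0<ε)
        (x≤A m (ℕₚ.m⊔n≤o⇒m≤o N₁ N₂ N₁₂≤m)) (y≤B m (ℕₚ.m⊔n≤o⇒n≤o N₁ N₂ N₁₂≤m))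
        (proj₂ lowerx m (ℕₚ.m⊔n≤o⇒m≤o N₃ N₄ N₃₄≤m)) (proj₂ lowery m (ℕₚ.m⊔n≤o⇒n≤o N₃ N₄ N₃₄≤m))
    where
    S : ℚ
    S = A ℚ.+ B ℚ.+ 1ℚ ℚ.+ ε

    0<S : 0ℚ ℚ.< S
    0<S = ℚₚ.+-mono-≤-< (Rat.+-nonNeg (Rat.+-nonNeg 0≤A 0≤B) Rat.0≤1) 0<ε

    S⁻¹ : ∃ λ r → 0ℚ ℚ.< r × S ℚ.* r ≡ 1ℚ
    S⁻¹ = inverse S 0<S

    e : ℚ
    e = ε ℚ.* proj₁ S⁻¹

    0<e : 0ℚ ℚ.< e
    0<e = Rat.*-pos 0<ε (proj₁ (proj₂ S⁻¹))

    Se≡ε : S ℚ.* e ≡ ε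
    Se≡ε = trans (rearrange S ε (proj₁ S⁻¹)) (trans (cong (ε ℚ.*_) (proj₂ (proj₂ S⁻¹))) (ℚₚ.*-identityʳ ε))
      where
      rearrange : ∀ s e r → s ℚ.* (e ℚ.* r) ≡ e ℚ.* (s ℚ.* r)
      rearrange = solve 3 (λ s e r → s :* (e :* r) := e :* (s :* r)) refl

    e≤1 : e ℚ.≤ 1ℚ
    e≤1 = Rat.*-cancelˡ 0<S (subst₂ ℚ._≤_ (sym Se≡ε) (sym (ℚₚ.*-identityʳ S))
      (Rat.≤-because (Rat.+-nonNeg (Rat.+-nonNeg 0≤A 0≤B) Rat.0≤1)
        (solve 3 (λ a b e → a :+ b :+ con 1ℚ :+ e :- e := a :+ b :+ con 1ℚ) refl A B ε)))

    lowerx : ∃ λ N → ∀ m → N ℕ.≤ m → 0ℚ ℚ.≤ seq x m ℚ.+ e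
    lowerx = 0≤x e 0<e

    lowery : ∃ λ N → ∀ m → N ℕ.≤ m → 0ℚ ℚ.≤ seq y m ℚ.+ e
    lowery = 0≤y e 0<e

    N₃ N₄ : ℕ
    N₃ = proj₁ lowerx
    N₄ = proj₁ lowery

*-monoˡ : ∀ {x y z} → 0ℝ ≤ z → x ≤ y → z * x ≤ z * y
*-monoˡ {x} {y} {z} 0≤z x≤y = ≤-because {z * x} {z * y} {z * (y - x)}
  (*-nonNeg {z} {y - x} 0≤z (≤⇒0≤- {x} {y} x≤y))
  (λ m → solve 3 (λ x y z → z :* y :- z :* x := z :* (y :- x)) refl (seq x m) (seq y m) (seq z m))

*-monoʳ : ∀ {x y z} → 0ℝ ≤ z → x ≤ y → x * z ≤ y * z
*-monoʳ {x} {y} {z} 0≤z x≤y = ≤-because {x * z} {y * z} {z * (y - x)}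
  (*-nonNeg {z} {y - x} 0≤z (≤⇒0≤- {x} {y} x≤y))
  (λ m → solve 3 (λ x y z → y :* z :- x :* z := z :* (y :- x)) refl (seq x m) (seq y m) (seq z m))

*-mono : ∀ {x y z w} → 0ℝ ≤ x → 0ℝ ≤ w → x ≤ y → z ≤ w → x * z ≤ y * w
*-mono {x} {y} {z} {w} 0≤x 0≤w x≤y z≤w = ≤-trans {x * z} {x * w} {y * w}
  (*-monoˡ {z} {w} {x} 0≤x z≤w) (*-monoʳ {x} {y} {w} 0≤w x≤y)

fromℚ-mono : ∀ {p q} → p ℚ.≤ q → fromℚ p ≤ fromℚ q
fromℚ-mono {p} {q} p≤q = ≤-pointwise {fromℚ p} {fromℚ q} (λ _ → p≤q)

^-nonNeg : ∀ {x} n → 0ℝ ≤ x → 0ℝ ≤ x ^ n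
^-nonNeg     zero    0≤x = fromℚ-mono Rat.0≤1
^-nonNeg {x} (suc n) 0≤x = *-nonNeg {x} {x ^ n} 0≤x (^-nonNeg {x} n 0≤x)

^-mono-≤ : ∀ {x y} n → 0ℝ ≤ x → x ≤ y → x ^ n ≤ y ^ n
^-mono-≤         zero    0≤x x≤y = ≤-refl {1ℝ}
^-mono-≤ {x} {y} (suc n) 0≤x x≤y = *-mono {x} {y} {x ^ n} {y ^ n} 0≤x
  (^-nonNeg {y} n (≤-trans {0ℝ} {x} {y} 0≤x x≤y)) x≤y (^-mono-≤ {x} {y} n 0≤x x≤y)

seq-^ : ∀ x n m → seq (x ^ n) m ≡ seq x m ^ℚ n
seq-^ x zero    m = refl
seq-^ x (suc n) m = cong (seq x m ℚ.*_) (seq-^ x n m)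

seq-∑ : ∀ {n} (f : Fin n → ℝ) m → seq (∑ f) m ≡ sum (λ i → seq (f i) m)
seq-∑ {zero}  f m = refl
seq-∑ {suc n} f m = cong (λ z → seq (f zero) m ℚ.+ z) (seq-∑ (f ∘ suc) m)

∑-mono : ∀ {n} {f g : Fin n → ℝ} → (∀ i → f i ≤ g i) → ∑ f ≤ ∑ g
∑-mono {zero}          f≤g = ≤-refl {0ℝ}
∑-mono {suc n} {f} {g} f≤g = +-mono-≤ {f zero} {g zero} {∑ (f ∘ suc)} {∑ (g ∘ suc)} (f≤g zero) (∑-mono {n} {f ∘ suc} {g ∘ suc} (f≤g ∘ suc))

∑-nonNeg : ∀ {n} {f : Fin n → ℝ} → (∀ i → 0ℝ ≤ f i) → 0ℝ ≤ ∑ f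
∑-nonNeg {zero}      0≤f = ≤-refl {0ℝ}
∑-nonNeg {suc n} {f} 0≤f = +-nonNeg {f zero} {∑ (f ∘ suc)} (0≤f zero) (∑-nonNeg {n} {f ∘ suc} (0≤f ∘ suc))

term≤∑ : ∀ {n} {f : Fin n → ℝ} → (∀ i → 0ℝ ≤ f i) → ∀ i → f i ≤ ∑ f
term≤∑ {suc n} {f} 0≤f zero    = ≤-because {f zero} {∑ f} {∑ (f ∘ suc)} (∑-nonNeg {n} {f ∘ suc} (0≤f ∘ suc))
  (λ m → solve 2 (λ a b → a :+ b :- a := b) refl (seq (f zero) m) (seq (∑ (f ∘ suc)) m))
term≤∑ {suc n} {f} 0≤f (suc i) = ≤-trans {f (suc i)} {∑ (f ∘ suc)} {∑ f} (term≤∑ {n} {f ∘ suc} (0≤f ∘ suc) i)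
  (≤-because {∑ (f ∘ suc)} {∑ f} {f zero} (0≤f zero)
    (λ m → solve 2 (λ a b → a :+ b :- b := a) refl (seq (f zero) m) (seq (∑ (f ∘ suc)) m)))

-- Once the terms of x are at least δ, the maximum inside `inv` is the term itself, and the product
-- is exactly 1.
*-inv : ∀ x (0<x : 0ℝ < x) → ∃ λ N → ∀ m → N ℕ.≤ m → seq x m ℚ.* seq (inv x 0<x) m ≡ 1ℚ
*-inv x (δ , 0<δ , N , δ≤x) = N , λ m N≤m → trans (cong (ℚ._* seq (inv x (δ , 0<δ , N , δ≤x)) m) (sym (t≡x m N≤m)))
  (ℚₚ.*-inverseʳ (seq x m ℚ.⊔ δ) {{ℚₚ.pos⇒nonZero (seq x m ℚ.⊔ δ) {{ℚ.positive (ℚₚ.<-≤-trans 0<δ (ℚₚ.p≤q⊔p (seq x m) δ))}}}})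
  where
  t≡x : ∀ m → N ℕ.≤ m → seq x m ℚ.⊔ δ ≡ seq x m
  t≡x m N≤m = ℚₚ.p≥q⇒p⊔q≡p (subst (ℚ._≤ seq x m) (ℚₚ.+-identityˡ δ) (δ≤x m N≤m))

inv-seq-nonNeg : ∀ x (0<x : 0ℝ < x) m → 0ℚ ℚ.≤ seq (inv x 0<x) m
inv-seq-nonNeg x (δ , 0<δ , N , δ≤x) m = ℚₚ.<⇒≤ (ℚₚ.positive⁻¹ _
  {{ℚₚ.1/pos⇒pos (seq x m ℚ.⊔ δ) {{ℚ.positive (ℚₚ.<-≤-trans 0<δ (ℚₚ.p≤q⊔p (seq x m) δ))}}}})

inv-nonNeg : ∀ x (0<x : 0ℝ < x) → 0ℝ ≤ inv x 0<x
inv-nonNeg x 0<x = ≤-pointwise {0ℝ} {inv x 0<x} (inv-seq-nonNeg x 0<x)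

*inv≤1 : ∀ x (0<x : 0ℝ < x) → x * inv x 0<x ≤ 1ℝ
*inv≤1 x 0<x with *-inv x 0<x
... | N , eq = ≤-eventually {x * inv x 0<x} {1ℝ} N (λ m N≤m → ℚₚ.≤-reflexive (eq m N≤m))

-- Distributions moved by a matrix

if-recipℕ : ∀ (b : Bool) d m → seq (if b then recipℕ d else 0ℝ) m ≡ (if b then reciprocal d else 0ℚ)
if-recipℕ true  zero    m = refl
if-recipℕ true  (suc d) m = refl
if-recipℕ false d       m = refl

push : ∀ {n} → (Fin n → ℝ) → (Fin n → Fin n → ℚ) → Fin n → ℝ
push μ A v = ∑ (λ u → μ u * fromℚ (A u v))

seq-push : ∀ {n} (μ : Fin n → ℝ) A v m → seq (push μ A v) m ≡ sum (λ u → seq (μ u) m ℚ.* A u v)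
seq-push μ A v m = seq-∑ (λ u → μ u * fromℚ (A u v)) m

push-nonNeg : ∀ {n} (μ : Fin n → ℝ) A → (∀ u → 0ℝ ≤ μ u) → (∀ u v → 0ℚ ℚ.≤ A u v) → ∀ v → 0ℝ ≤ push μ A v
push-nonNeg {n} μ A 0≤μ 0≤A v = ∑-nonNeg {n} {λ u → μ u * fromℚ (A u v)} (λ u → *-nonNeg {μ u} {fromℚ (A u v)} (0≤μ u) (fromℚ-mono (0≤A u v)))

push-mono : ∀ {n} (μ ν : Fin n → ℝ) A → (∀ u → μ u ≤ ν u) → (∀ u v → 0ℚ ℚ.≤ A u v) → ∀ v → push μ A v ≤ push ν A v
push-mono {n} μ ν A μ≤ν 0≤A v = ∑-mono {n} {λ u → μ u * fromℚ (A u v)} {λ u → ν u * fromℚ (A u v)}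
  (λ u → *-monoʳ {μ u} {ν u} {fromℚ (A u v)} (fromℚ-mono (0≤A u v)) (μ≤ν u))

push-scale : ∀ {n} c (μ : Fin n → ℝ) A v m → seq (push (λ u → c * μ u) A v) m ≡ seq (c * push μ A v) m
push-scale c μ A v m = begin
  seq (push (λ u → c * μ u) A v) m                              ≡⟨ seq-push (λ u → c * μ u) A v m ⟩
  sum (λ u → seq c m ℚ.* seq (μ u) m ℚ.* A u v)                 ≡⟨ Rat.sum-cong-≗ (λ u → ℚₚ.*-assoc (seq c m) (seq (μ u) m) (A u v)) ⟩
  sum (λ u → seq c m ℚ.* (seq (μ u) m ℚ.* A u v))               ≡⟨ Rat.*-distribˡ-sum (seq c m) (λ u → seq (μ u) m ℚ.* A u v) ⟨
  seq c m ℚ.* sum (λ u → seq (μ u) m ℚ.* A u v)                 ≡⟨ cong (seq c m ℚ.*_) (seq-push μ A v m) ⟨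
  seq (c * push μ A v) m                                        ∎
  where open ≡-Reasoning

push-pow-zero : ∀ {n} (μ : Fin n → ℝ) A v m → seq (push μ (pow A 0) v) m ≡ seq (μ v) m
push-pow-zero μ A v m = trans (seq-push μ (pow A 0) v m)
  (trans (Rat.sum-cong-≗ (λ u → trans (ℚₚ.*-comm (seq (μ u) m) δ[ u , v ]) (cong (ℚ._* seq (μ u) m) (Rat.if-cong (Rat.==-sym u v)))))
         (Rat.δ-sum v (λ u → seq (μ u) m)))

push-pow-suc : ∀ {n} (μ : Fin n → ℝ) A j v m →
  seq (push (push μ (pow A j)) A v) m ≡ seq (push μ (pow A (suc j)) v) m
push-pow-suc μ A j v m = begin
  seq (push (push μ (pow A j)) A v) m
    ≡⟨ seq-push (push μ (pow A j)) A v m ⟩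
  sum (λ u → seq (push μ (pow A j) u) m ℚ.* A u v)
    ≡⟨ Rat.sum-cong-≗ (λ u → cong (ℚ._* A u v) (seq-push μ (pow A j) u m)) ⟩
  sum (λ u → sum (λ w → seq (μ w) m ℚ.* pow A j w u) ℚ.* A u v)
    ≡⟨ Rat.sum-swap (λ w → seq (μ w) m) (pow A j) (λ u → A u v) ⟨
  sum (λ w → seq (μ w) m ℚ.* sum (λ u → pow A j w u ℚ.* A u v))
    ≡⟨ Rat.sum-cong-≗ (λ w → cong (seq (μ w) m ℚ.*_) (Rat.pow-sucʳ A j w v)) ⟨
  sum (λ w → seq (μ w) m ℚ.* pow A (suc j) w v)
    ≡⟨ seq-push μ (pow A (suc j)) v m ⟨
  seq (push μ (pow A (suc j)) v) m ∎
  where open ≡-Reasoning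

ℕ-induction : (P : ℕ → Set) → P 0 → (∀ j → P j → P (suc j)) → ∀ j → P j
ℕ-induction P base step zero    = base
ℕ-induction P base step (suc j) = step j (ℕ-induction P base step j)

module _ {n} (A : Fin n → Fin n → ℚ) (0≤A : ∀ u v → 0ℚ ℚ.≤ A u v) where

  -- A nonnegative A preserves inequalities, so the hypothesis can be substituted into its own right
  -- side. In this way no power of Q has to be formed.
  push-pow-upper : ∀ (μ : Fin n → ℝ) c → 0ℝ ≤ c → (∀ v → μ v ≤ c * push μ A v) →
    ∀ j v → μ v ≤ c ^ j * push μ (pow A j) v
  push-pow-upper μ c 0≤c μ≤ = ℕ-induction (λ j → ∀ v → μ v ≤ c ^ j * push μ (pow A j) v) base step
    where
    open ≡-Reasoning
    base : ∀ v → μ v ≤ c ^ 0 * push μ (pow A 0) v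
    base v = ≤-≗ {μ v} {c ^ 0 * push μ (pow A 0) v} (λ m → sym (trans (ℚₚ.*-identityˡ _) (push-pow-zero μ A v m)))

    step : ∀ j → (∀ v → μ v ≤ c ^ j * push μ (pow A j) v) → ∀ v → μ v ≤ c ^ suc j * push μ (pow A (suc j)) v
    step j μ≤μⱼ v = ≤-trans {μ v} {c * push μ A v} {c ^ suc j * push μ (pow A (suc j)) v} (μ≤ v)
      (≤-trans {c * push μ A v} {c * push (λ u → c ^ j * push μ (pow A j) u) A v} {c ^ suc j * push μ (pow A (suc j)) v}
        (*-monoˡ {push μ A v} {push (λ u → c ^ j * push μ (pow A j) u) A v} {c} 0≤c (push-mono μ (λ u → c ^ j * push μ (pow A j) u) A μ≤μⱼ 0≤A v))
        (≤-≗ {c * push (λ u → c ^ j * push μ (pow A j) u) A v} {c ^ suc j * push μ (pow A (suc j)) v} same))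
      where
      same : ∀ m → seq (c * push (λ u → c ^ j * push μ (pow A j) u) A v) m ≡ seq (c ^ suc j * push μ (pow A (suc j)) v) m
      same m = begin
        seq c m ℚ.* seq (push (λ u → c ^ j * push μ (pow A j) u) A v) m
          ≡⟨ cong (seq c m ℚ.*_) (push-scale (c ^ j) (push μ (pow A j)) A v m) ⟩
        seq c m ℚ.* (seq (c ^ j) m ℚ.* seq (push (push μ (pow A j)) A v) m)
          ≡⟨ cong (λ z → seq c m ℚ.* (seq (c ^ j) m ℚ.* z)) (push-pow-suc μ A j v m) ⟩
        seq c m ℚ.* (seq (c ^ j) m ℚ.* seq (push μ (pow A (suc j)) v) m)
          ≡⟨ ℚₚ.*-assoc (seq c m) (seq (c ^ j) m) (seq (push μ (pow A (suc j)) v) m) ⟨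
        seq c m ℚ.* seq (c ^ j) m ℚ.* seq (push μ (pow A (suc j)) v) m ∎

  push-pow-lower : ∀ (π : Fin n → ℝ) → (∀ v → push π A v ≤ π v) → ∀ j v → push π (pow A j) v ≤ π v
  push-pow-lower π ≤π = ℕ-induction (λ j → ∀ v → push π (pow A j) v ≤ π v)
    (λ v → ≤-≗ {push π (pow A 0) v} {π v} (push-pow-zero π A v))
    (λ j ≤πⱼ v → ≤-trans {push π (pow A (suc j)) v} {push (push π (pow A j)) A v} {π v}
      (≤-≗ {push π (pow A (suc j)) v} {push (push π (pow A j)) A v} (λ m → sym (push-pow-suc π A j v m)))
      (≤-trans {push (push π (pow A j)) A v} {push π A v} {π v}
        (push-mono (push π (pow A j)) π A ≤πⱼ 0≤A v) (≤π v)))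

  -- S = (μ Aᵏ)(u) is an average of column u, hence at most twice each entry of that column.
  -- Averaging these bounds with the weights π gives 2 (π Aᵏ)(u), and π Aᵏ ≤ π.
  push-pow-ratio : ∀ k → (∀ x y u → pow A k x u ℚ.≤ 2ℚ ℚ.* pow A k y u) →
    (μ π : Fin n → ℝ) → (∀ u → 0ℝ ≤ μ u) → ∑ μ ≤ 1ℝ → (∀ u → 0ℝ ≤ π u) → 1ℝ ≤ ∑ π → (∀ v → push π A v ≤ π v) →
    ∀ u → push μ (pow A k) u ≤ fromℚ 2ℚ * π u
  push-pow-ratio k ratio μ π 0≤μ ∑μ≤1 0≤π 1≤∑π ≤π u =
    ≤-trans {S} {S * ∑ π} {fromℚ 2ℚ * π u} S≤S∑π
      (≤-trans {S * ∑ π} {∑ (λ y → π y * S)} {fromℚ 2ℚ * π u}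
        (≤-≗ {S * ∑ π} {∑ (λ y → π y * S)} λ m → begin
          seq S m ℚ.* seq (∑ π) m              ≡⟨ cong (seq S m ℚ.*_) (seq-∑ π m) ⟩
          seq S m ℚ.* sum (λ y → seq (π y) m)  ≡⟨ Rat.*-distribˡ-sum (seq S m) (λ y → seq (π y) m) ⟩
          sum (λ y → seq S m ℚ.* seq (π y) m)  ≡⟨ Rat.sum-cong-≗ (λ y → ℚₚ.*-comm (seq S m) (seq (π y) m)) ⟩
          sum (λ y → seq (π y) m ℚ.* seq S m)  ≡⟨ seq-∑ (λ y → π y * S) m ⟨
          seq (∑ (λ y → π y * S)) m            ∎)
        (≤-trans {∑ (λ y → π y * S)} {∑ (λ y → π y * fromℚ (2ℚ ℚ.* pow A k y u))} {fromℚ 2ℚ * π u}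
          (∑-mono {n} {λ y → π y * S} {λ y → π y * fromℚ (2ℚ ℚ.* pow A k y u)}
            (λ y → *-monoˡ {S} {fromℚ (2ℚ ℚ.* pow A k y u)} {π y} (0≤π y) (S≤ y)))
          (≤-trans {∑ (λ y → π y * fromℚ (2ℚ ℚ.* pow A k y u))} {fromℚ 2ℚ * push π (pow A k) u} {fromℚ 2ℚ * π u}
            (≤-≗ {∑ (λ y → π y * fromℚ (2ℚ ℚ.* pow A k y u))} {fromℚ 2ℚ * push π (pow A k) u} λ m → begin
              seq (∑ (λ y → π y * fromℚ (2ℚ ℚ.* pow A k y u))) m
                ≡⟨ seq-∑ (λ y → π y * fromℚ (2ℚ ℚ.* pow A k y u)) m ⟩
              sum (λ y → seq (π y) m ℚ.* (2ℚ ℚ.* pow A k y u))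
                ≡⟨ Rat.sum-cong-≗ (λ y → solve 3 (λ a b c → a :* (b :* c) := b :* (a :* c)) refl (seq (π y) m) 2ℚ (pow A k y u)) ⟩
              sum (λ y → 2ℚ ℚ.* (seq (π y) m ℚ.* pow A k y u))
                ≡⟨ Rat.*-distribˡ-sum 2ℚ (λ y → seq (π y) m ℚ.* pow A k y u) ⟨
              2ℚ ℚ.* sum (λ y → seq (π y) m ℚ.* pow A k y u)
                ≡⟨ cong (2ℚ ℚ.*_) (seq-push π (pow A k) u m) ⟨
              seq (fromℚ 2ℚ * push π (pow A k) u) m ∎)
            (*-monoˡ {push π (pow A k) u} {π u} {fromℚ 2ℚ} (fromℚ-mono (Rat.⟦⟧-nonNeg 2)) (push-pow-lower π ≤π k u)))))
    where
    open ≡-Reasoning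
    S : ℝ
    S = push μ (pow A k) u

    0≤Aᵏ : ∀ x y → 0ℚ ℚ.≤ pow A k x y
    0≤Aᵏ = Rat.pow-nonNeg A 0≤A k

    S≤S∑π : S ≤ S * ∑ π
    S≤S∑π = ≤-trans {S} {S * 1ℝ} {S * ∑ π} (≤-≗ {S} {S * 1ℝ} (λ m → sym (ℚₚ.*-identityʳ (seq S m))))
      (*-monoˡ {1ℝ} {∑ π} {S} (push-nonNeg μ (pow A k) 0≤μ 0≤Aᵏ u) 1≤∑π)

    S≤ : ∀ y → S ≤ fromℚ (2ℚ ℚ.* pow A k y u)
    S≤ y = ≤-trans {S} {∑ (λ x → μ x * fromℚ b)} {fromℚ b}
      (∑-mono {n} {λ x → μ x * fromℚ (pow A k x u)} {λ x → μ x * fromℚ b}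
        (λ x → *-monoˡ {fromℚ (pow A k x u)} {fromℚ b} {μ x} (0≤μ x) (fromℚ-mono (ratio x y u))))
      (≤-trans {∑ (λ x → μ x * fromℚ b)} {∑ μ * fromℚ b} {fromℚ b}
        (≤-≗ {∑ (λ x → μ x * fromℚ b)} {∑ μ * fromℚ b} λ m → begin
          seq (∑ (λ x → μ x * fromℚ b)) m   ≡⟨ seq-∑ (λ x → μ x * fromℚ b) m ⟩
          sum (λ x → seq (μ x) m ℚ.* b)     ≡⟨ Rat.*-distribʳ-sum b (λ x → seq (μ x) m) ⟨
          sum (λ x → seq (μ x) m) ℚ.* b     ≡⟨ cong (ℚ._* b) (seq-∑ μ m) ⟨
          seq (∑ μ * fromℚ b) m             ∎)
        (≤-trans {∑ μ * fromℚ b} {1ℝ * fromℚ b} {fromℚ b}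
          (*-monoʳ {∑ μ} {1ℝ} {fromℚ b} (fromℚ-mono (Rat.*-nonNeg (Rat.⟦⟧-nonNeg 2) (0≤Aᵏ y u))) ∑μ≤1)
          (≤-≗ {1ℝ * fromℚ b} {fromℚ b} (λ _ → ℚₚ.*-identityˡ b))))
      where
      b : ℚ
      b = 2ℚ ℚ.* pow A k y u

-- In terms of x = np and i = 1/x the difference of the two sides is, for an edge,
--   (1 + βt)/d - ((1 - βi)/d + βiB) = β (i (t x - d)/d + t (1 - x i)/d + i (1 - B) + i/d).
biased-entry : ∀ (b : Bool) d (β x i B : ℝ) (t : ℚ) → 0ℝ ≤ β → 0ℝ ≤ i → 0ℚ ℚ.≤ t → x * i ≤ 1ℝ →
  fromℚ ⟦ d ⟧ ≤ fromℚ t * x → B ≤ 1ℝ → (b ≡ false → B ≃ 0ℝ) → (b ≡ true → ℕ.NonZero d) →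
  (1ℝ - β * i) * (if b then recipℕ d else 0ℝ) + β * i * B ≤ (1ℝ + β * fromℚ t) * fromℚ (if b then reciprocal d else 0ℚ)
biased-entry false d β x i B t 0≤β 0≤i 0≤t xi≤1 d≤tx B≤1 B≃0 d≢0 =
  ≤-because {(1ℝ - β * i) * 0ℝ + β * i * B} {(1ℝ + β * fromℚ t) * 0ℝ} {β * i * (0ℝ - B)}
    (*-nonNeg {β * i} {0ℝ - B} (*-nonNeg {β} {i} 0≤β 0≤i) (≤⇒0≤- {B} {0ℝ} (proj₁ (B≃0 refl))))
    (λ m → identity (seq β m) (seq i m) (seq B m) t)
  where
  identity : ∀ β i B t → (1ℚ ℚ.+ β ℚ.* t) ℚ.* 0ℚ ℚ.- ((1ℚ ℚ.- β ℚ.* i) ℚ.* 0ℚ ℚ.+ β ℚ.* i ℚ.* B) ≡ β ℚ.* i ℚ.* (0ℚ ℚ.- B)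
  identity = solve 4 (λ β i B t → (con 1ℚ :+ β :* t) :* con 0ℚ :- ((con 1ℚ :- β :* i) :* con 0ℚ :+ β :* i :* B) := β :* i :* (con 0ℚ :- B)) refl
biased-entry true zero    β x i B t 0≤β 0≤i 0≤t xi≤1 d≤tx B≤1 B≃0 d≢0 with () ← ℕ.NonZero.nonZero (d≢0 refl)
biased-entry true d@(suc _) β x i B t 0≤β 0≤i 0≤t xi≤1 d≤tx B≤1 B≃0 d≢0 =
  ≤-because {(1ℝ - β * i) * fromℚ r + β * i * B} {(1ℝ + β * fromℚ t) * fromℚ r} {β * (e₁ + e₂ + e₃ + e₄)}
    (*-nonNeg {β} {e₁ + e₂ + e₃ + e₄} 0≤β
      (+-nonNeg {e₁ + e₂ + e₃} {e₄}
        (+-nonNeg {e₁ + e₂} {e₃}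
          (+-nonNeg {e₁} {e₂}
            (*-nonNeg {fromℚ r * i} {fromℚ t * x - fromℚ ⟦ d ⟧} 0≤ri (≤⇒0≤- {fromℚ ⟦ d ⟧} {fromℚ t * x} d≤tx))
            (*-nonNeg {fromℚ (r ℚ.* t)} {1ℝ - x * i} (fromℚ-mono (Rat.*-nonNeg 0≤r 0≤t)) (≤⇒0≤- {x * i} {1ℝ} xi≤1)))
          (*-nonNeg {i} {fromℚ (r ℚ.* ⟦ d ⟧) - B} 0≤i (≤⇒0≤- {B} {fromℚ (r ℚ.* ⟦ d ⟧)}
            (≤-trans {B} {1ℝ} {fromℚ (r ℚ.* ⟦ d ⟧)} B≤1
              (fromℚ-mono (ℚₚ.≤-reflexive (sym (trans (ℚₚ.*-comm r ⟦ d ⟧) (Rat.reciprocal-inverse d)))))))))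
        0≤ri))
    (λ m → identity (seq β m) (seq i m) (seq B m) t r (seq x m) ⟦ d ⟧)
  where
  r : ℚ
  r = reciprocal d

  0≤r : 0ℚ ℚ.≤ r
  0≤r = Rat.reciprocal-nonNeg d

  0≤ri : 0ℝ ≤ fromℚ r * i
  0≤ri = *-nonNeg {fromℚ r} {i} (fromℚ-mono 0≤r) 0≤i

  e₁ e₂ e₃ e₄ : ℝ
  e₁ = fromℚ r * i * (fromℚ t * x - fromℚ ⟦ d ⟧)
  e₂ = fromℚ (r ℚ.* t) * (1ℝ - x * i)
  e₃ = i * (fromℚ (r ℚ.* ⟦ d ⟧) - B)
  e₄ = fromℚ r * i

  identity : ∀ β i B t r x d → (1ℚ ℚ.+ β ℚ.* t) ℚ.* r ℚ.- ((1ℚ ℚ.- β ℚ.* i) ℚ.* r ℚ.+ β ℚ.* i ℚ.* B) ≡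
    β ℚ.* (r ℚ.* i ℚ.* (t ℚ.* x ℚ.- d) ℚ.+ r ℚ.* t ℚ.* (1ℚ ℚ.- x ℚ.* i) ℚ.+ i ℚ.* (r ℚ.* d ℚ.- B) ℚ.+ r ℚ.* i)
  identity = solve 7 (λ β i B t r x d → (con 1ℚ :+ β :* t) :* r :- ((con 1ℚ :- β :* i) :* r :+ β :* i :* B) :=
    β :* (r :* i :* (t :* x :- d) :+ r :* t :* (con 1ℚ :- x :* i) :+ i :* (r :* d :- B) :+ r :* i)) refl

-- Walks on good graphs

sum-pos⇒∃ : ∀ {n} (f : Fin n → ℚ) → 0ℚ ℚ.< sum f → ∃ λ i → 0ℚ ℚ.< f i
sum-pos⇒∃ {zero}  f 0<sum = contradiction 0<sum (ℚₚ.<-irrefl refl)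
sum-pos⇒∃ {suc n} f 0<sum with 0ℚ ℚₚ.<? f zero
... | yes 0<f₀ = zero , 0<f₀
... | no  0≮f₀ with sum-pos⇒∃ (f ∘ suc) (ℚₚ.<-≤-trans 0<sum
        (subst (sum f ℚ.≤_) (ℚₚ.+-identityˡ _) (ℚₚ.+-monoˡ-≤ (sum (f ∘ suc)) (ℚₚ.≮⇒≥ 0≮f₀))))
...   | i , 0<fᵢ = suc i , 0<fᵢ

pos-*⇒pos : ∀ {p q} → 0ℚ ℚ.≤ p → 0ℚ ℚ.≤ q → 0ℚ ℚ.< p ℚ.* q → 0ℚ ℚ.< p × 0ℚ ℚ.< q
pos-*⇒pos {p} {q} 0≤p 0≤q 0<pq =
  ℚₚ.≰⇒> (λ p≤0 → ℚₚ.<-irrefl refl (ℚₚ.<-≤-trans 0<pq (subst (p ℚ.* q ℚ.≤_) (ℚₚ.*-zeroˡ q) (Rat.*-monoʳ 0≤q p≤0)))) ,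
  ℚₚ.≰⇒> (λ q≤0 → ℚₚ.<-irrefl refl (ℚₚ.<-≤-trans 0<pq (subst (p ℚ.* q ℚ.≤_) (ℚₚ.*-zeroʳ p) (Rat.*-monoˡ 0≤p q≤0))))

if-pos⇒T : ∀ (b : Bool) {p} → 0ℚ ℚ.< (if b then p else 0ℚ) → T b
if-pos⇒T true  _   = tt
if-pos⇒T false 0<0 = contradiction 0<0 (ℚₚ.<-irrefl refl)

δ-pos⇒≡ : ∀ {n} (x u : Fin n) → 0ℚ ℚ.< δ[ x , u ] → x ≡ u
δ-pos⇒≡ x u with x == u in eq
... | true  = λ _ → ==⇒≡ x u eq
... | false = λ 0<0 → contradiction 0<0 (ℚₚ.<-irrefl refl)

walk⇒Star : ∀ {n} (G : Graph n) l x u → 0ℚ ℚ.< pow (walkMatrix G) l x u → Star (λ y z → T (adj G y z)) x u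
walk⇒Star G zero    x u 0<p = subst (Star _ x) (δ-pos⇒≡ x u 0<p) Star.ε
walk⇒Star G (suc l) x u 0<p with sum-pos⇒∃ (λ z → walkMatrix G x z ℚ.* pow (walkMatrix G) l z u) 0<p
... | z , 0<step with pos-*⇒pos (Rat.walkMatrix-nonNeg G x z) (Rat.pow-nonNeg (walkMatrix G) (Rat.walkMatrix-nonNeg G) l z u) 0<step
... | 0<P , 0<rest = if-pos⇒T (adj G x z) 0<P ◅ walk⇒Star G l z u 0<rest

good⇒connected : ∀ {n c k} (G : Graph n) → Good c k G → Connected G
good⇒connected {k = k} G (_ , _ , 0<P) x u = walk⇒Star G k x u (0<P x u)

adjacent⇒degree : ∀ {n} (G : Graph n) x z → adj G x z ≡ true → ℕ.NonZero (degree G x)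
adjacent⇒degree G x z adjacent = ℕ.≢-nonZero λ d≡0 → contradiction refl (ℚₚ.<⇒≢ (ℚₚ.<-≤-trans Rat.0<1 (begin
  1ℚ                                           ≡⟨ cong (λ b → if b then 1ℚ else 0ℚ) adjacent ⟨
  (if adj G x z then 1ℚ else 0ℚ)               ≤⟨ Rat.term≤sum (λ z → Rat.if-nonNeg (adj G x z) Rat.0≤1) z ⟩
  sum (λ z → if adj G x z then 1ℚ else 0ℚ)     ≡⟨ Rat.sum-tabulate (adj G x) ⟩
  ⟦ degree G x ⟧                               ≡⟨ cong ⟦_⟧ d≡0 ⟩
  0ℚ                                           ∎)))
  where open ℚₚ.≤-Reasoning

module _ {n} (G : Graph n) (c t : ℚ) (k : ℕ) (good : Good c k G) (0≤t : 0ℚ ℚ.≤ t)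
  (β x : ℝ) (0≤β : 0ℝ ≤ β) (0<x : 0ℝ < x) (c≤tx : fromℚ c ≤ fromℚ t * x)
  (B : Matrix n) (stochastic : IsStochastic B) (supported : SupportedOnEdges G B)
  (π π-Q : Fin n → ℝ) (stationary : IsStationary (simpleRandomWalk G) π)
  (stationary-Q : IsStationary (biasedWalk G (β / x ⟨ 0<x ⟩) B) π-Q)
  where

  private
    B≤1 : ∀ u v → B u v ≤ 1ℝ
    B≤1 u v = ≤-trans {B u v} {∑ (B u)} {1ℝ} (term≤∑ {n} {B u} (IsStochastic.nonNeg stochastic u) v)
      (proj₁ (IsStochastic.rowSum stochastic u))

    degree≤ : ∀ u → fromℚ ⟦ degree G u ⟧ ≤ fromℚ t * x
    degree≤ u = ≤-trans {fromℚ ⟦ degree G u ⟧} {fromℚ c} {fromℚ t * x} (fromℚ-mono (proj₁ good u)) c≤tx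

    entry : ∀ u v → biasedWalk G (β / x ⟨ 0<x ⟩) B u v ≤ (1ℝ + β * fromℚ t) * fromℚ (walkMatrix G u v)
    entry u v = ≤-trans {biasedWalk G (β / x ⟨ 0<x ⟩) B u v}
      {(1ℝ - β * inv x 0<x) * (if adj G u v then recipℕ (degree G u) else 0ℝ) + β * inv x 0<x * B u v} {(1ℝ + β * fromℚ t) * fromℚ (walkMatrix G u v)}
      (≤-≗ {biasedWalk G (β / x ⟨ 0<x ⟩) B u v}
           {(1ℝ - β * inv x 0<x) * (if adj G u v then recipℕ (degree G u) else 0ℝ) + β * inv x 0<x * B u v} (λ m → refl))
      (≤-trans {(1ℝ - β * inv x 0<x) * (if adj G u v then recipℕ (degree G u) else 0ℝ) + β * inv x 0<x * B u v}
        {(1ℝ + β * fromℚ t) * fromℚ (if adj G u v then reciprocal (degree G u) else 0ℚ)} {(1ℝ + β * fromℚ t) * fromℚ (walkMatrix G u v)}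
        (biased-entry (adj G u v) (degree G u) β x (inv x 0<x) (B u v) t 0≤β (inv-nonNeg x 0<x) 0≤t (*inv≤1 x 0<x)
          (degree≤ u) (B≤1 u v) (supported u v) (adjacent⇒degree G u v))
        (≤-≗ {(1ℝ + β * fromℚ t) * fromℚ (if adj G u v then reciprocal (degree G u) else 0ℚ)} {(1ℝ + β * fromℚ t) * fromℚ (walkMatrix G u v)} (λ m → refl)))

    step-Q : ∀ v → π-Q v ≤ (1ℝ + β * fromℚ t) * push π-Q (walkMatrix G) v
    step-Q v = ≤-trans {π-Q v} {∑ (λ u → π-Q u * biasedWalk G (β / x ⟨ 0<x ⟩) B u v)} {(1ℝ + β * fromℚ t) * push π-Q (walkMatrix G) v}
      (proj₂ (IsStationary.invariant stationary-Q v))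
      (≤-trans {∑ (λ u → π-Q u * biasedWalk G (β / x ⟨ 0<x ⟩) B u v)}
        {∑ (λ u → π-Q u * ((1ℝ + β * fromℚ t) * fromℚ (walkMatrix G u v)))} {(1ℝ + β * fromℚ t) * push π-Q (walkMatrix G) v}
        (∑-mono {n} {λ u → π-Q u * biasedWalk G (β / x ⟨ 0<x ⟩) B u v} {λ u → π-Q u * ((1ℝ + β * fromℚ t) * fromℚ (walkMatrix G u v))}
          (λ u → *-monoˡ {biasedWalk G (β / x ⟨ 0<x ⟩) B u v} {(1ℝ + β * fromℚ t) * fromℚ (walkMatrix G u v)} {π-Q u}
            (IsStationary.nonNeg stationary-Q u) (entry u v)))
        (≤-≗ {∑ (λ u → π-Q u * ((1ℝ + β * fromℚ t) * fromℚ (walkMatrix G u v)))} {(1ℝ + β * fromℚ t) * push π-Q (walkMatrix G) v} λ m → begin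
          seq (∑ (λ u → π-Q u * ((1ℝ + β * fromℚ t) * fromℚ (walkMatrix G u v)))) m
            ≡⟨ seq-∑ (λ u → π-Q u * ((1ℝ + β * fromℚ t) * fromℚ (walkMatrix G u v))) m ⟩
          sum (λ u → seq (π-Q u) m ℚ.* (seq (1ℝ + β * fromℚ t) m ℚ.* walkMatrix G u v))
            ≡⟨ Rat.sum-cong-≗ (λ u → solve 3 (λ a b c → a :* (b :* c) := b :* (a :* c)) refl (seq (π-Q u) m) (seq (1ℝ + β * fromℚ t) m) (walkMatrix G u v)) ⟩
          sum (λ u → seq (1ℝ + β * fromℚ t) m ℚ.* (seq (π-Q u) m ℚ.* walkMatrix G u v))
            ≡⟨ Rat.*-distribˡ-sum (seq (1ℝ + β * fromℚ t) m) (λ u → seq (π-Q u) m ℚ.* walkMatrix G u v) ⟨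
          seq (1ℝ + β * fromℚ t) m ℚ.* sum (λ u → seq (π-Q u) m ℚ.* walkMatrix G u v)
            ≡⟨ cong (seq (1ℝ + β * fromℚ t) m ℚ.*_) (seq-push π-Q (walkMatrix G) v m) ⟨
          seq ((1ℝ + β * fromℚ t) * push π-Q (walkMatrix G) v) m ∎))
      where open ≡-Reasoning

    step : ∀ v → push π (walkMatrix G) v ≤ π v
    step v = ≤-trans {push π (walkMatrix G) v} {∑ (λ u → π u * simpleRandomWalk G u v)} {π v}
      (≤-≗ {push π (walkMatrix G) v} {∑ (λ u → π u * simpleRandomWalk G u v)} λ m → begin
        seq (push π (walkMatrix G) v) m
          ≡⟨ seq-push π (walkMatrix G) v m ⟩
        sum (λ u → seq (π u) m ℚ.* walkMatrix G u v)
          ≡⟨ Rat.sum-cong-≗ (λ u → cong (seq (π u) m ℚ.*_) (if-recipℕ (adj G u v) (degree G u) m)) ⟨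
        sum (λ u → seq (π u) m ℚ.* seq (simpleRandomWalk G u v) m)
          ≡⟨ seq-∑ (λ u → π u * simpleRandomWalk G u v) m ⟨
        seq (∑ (λ u → π u * simpleRandomWalk G u v)) m ∎)
      (proj₁ (IsStationary.invariant stationary v))
      where open ≡-Reasoning

    0≤factor : 0ℝ ≤ (1ℝ + β * fromℚ t)
    0≤factor = +-nonNeg {1ℝ} {β * fromℚ t} (fromℚ-mono Rat.0≤1) (*-nonNeg {β} {fromℚ t} 0≤β (fromℚ-mono 0≤t))

  stationary-ratio : ∀ u → π-Q u ≤ (1ℝ + β * fromℚ t) ^ k * (fromℚ 2ℚ * π u)
  stationary-ratio u = ≤-trans {π-Q u} {(1ℝ + β * fromℚ t) ^ k * push π-Q (pow (walkMatrix G) k) u} {(1ℝ + β * fromℚ t) ^ k * (fromℚ 2ℚ * π u)}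
    (push-pow-upper (walkMatrix G) (Rat.walkMatrix-nonNeg G) π-Q (1ℝ + β * fromℚ t) 0≤factor step-Q k u)
    (*-monoˡ {push π-Q (pow (walkMatrix G) k) u} {fromℚ 2ℚ * π u} {(1ℝ + β * fromℚ t) ^ k} (^-nonNeg {1ℝ + β * fromℚ t} k 0≤factor)
      (push-pow-ratio (walkMatrix G) (Rat.walkMatrix-nonNeg G) k (proj₁ (proj₂ good)) π-Q π
        (IsStationary.nonNeg stationary-Q) (proj₁ (IsStationary.total stationary-Q))
        (IsStationary.nonNeg stationary) (proj₂ (IsStationary.total stationary)) step u))

  -- As t ≥ 1, 1 + βt ≤ t (1 + β), which separates tᵏ ≤ 3/2 from (1 + β)ᵏ; then 3/2 · 2 = 3. The
  -- form K ^ 1 is what `IsPower` yields for the fraction k/1.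
  stationary-bound : ∀ K → (1ℝ + β) ^ k ≤ K ^ 1 → 1ℚ ℚ.≤ t → t ^ℚ k ℚ.≤ + 3 ℚ./ 2 → ∀ u → π-Q u ≤ fromℕ 3 * K * π u
  stationary-bound K bᵏ≤K 1≤t tᵏ≤ u =
    ≤-trans {π-Q u} {(1ℝ + β * fromℚ t) ^ k * (fromℚ 2ℚ * π u)} {fromℕ 3 * K * π u} (stationary-ratio u)
      (≤-trans {(1ℝ + β * fromℚ t) ^ k * (fromℚ 2ℚ * π u)} {fromℚ (+ 3 ℚ./ 2) * K ^ 1 * (fromℚ 2ℚ * π u)} {fromℕ 3 * K * π u}
        (*-monoʳ {(1ℝ + β * fromℚ t) ^ k} {fromℚ (+ 3 ℚ./ 2) * K ^ 1} {fromℚ 2ℚ * π u}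
          (*-nonNeg {fromℚ 2ℚ} {π u} (fromℚ-mono (Rat.⟦⟧-nonNeg 2)) (IsStationary.nonNeg stationary u)) Cᵏ≤)
        (≤-≗ {fromℚ (+ 3 ℚ./ 2) * K ^ 1 * (fromℚ 2ℚ * π u)} {fromℕ 3 * K * π u} λ m →
          solve 2 (λ K p → con (+ 3 ℚ./ 2) :* (K :* con 1ℚ) :* (con 2ℚ :* p) := con 3ℚ :* K :* p) refl (seq K m) (seq (π u) m)))
    where
    0≤1+β : 0ℝ ≤ 1ℝ + β
    0≤1+β = +-nonNeg {1ℝ} {β} (fromℚ-mono Rat.0≤1) 0≤β

    Cᵏ≤ : (1ℝ + β * fromℚ t) ^ k ≤ fromℚ (+ 3 ℚ./ 2) * K ^ 1
    Cᵏ≤ = ≤-trans {(1ℝ + β * fromℚ t) ^ k} {(fromℚ t * (1ℝ + β)) ^ k} {fromℚ (+ 3 ℚ./ 2) * K ^ 1}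
      (^-mono-≤ {1ℝ + β * fromℚ t} {fromℚ t * (1ℝ + β)} k 0≤factor
        (≤-because {1ℝ + β * fromℚ t} {fromℚ t * (1ℝ + β)} {fromℚ (t ℚ.- 1ℚ)} (fromℚ-mono (Rat.≤⇒0≤- 1≤t))
          (λ m → solve 2 (λ t b → t :* (con 1ℚ :+ b) :- (con 1ℚ :+ b :* t) := t :- con 1ℚ) refl t (seq β m))))
      (≤-trans {(fromℚ t * (1ℝ + β)) ^ k} {fromℚ (t ^ℚ k) * (1ℝ + β) ^ k} {fromℚ (+ 3 ℚ./ 2) * K ^ 1}
        (≤-≗ {(fromℚ t * (1ℝ + β)) ^ k} {fromℚ (t ^ℚ k) * (1ℝ + β) ^ k} λ m →
          trans (seq-^ (fromℚ t * (1ℝ + β)) k m) (trans (Rat.^-distrib-* t (seq (1ℝ + β) m) k)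
            (cong (t ^ℚ k ℚ.*_) (sym (seq-^ (1ℝ + β) k m)))))
        (*-mono {fromℚ (t ^ℚ k)} {fromℚ (+ 3 ℚ./ 2)} {(1ℝ + β) ^ k} {K ^ 1}
          (fromℚ-mono (Rat.^-nonNeg k 0≤t))
          (≤-trans {0ℝ} {(1ℝ + β) ^ k} {K ^ 1} (^-nonNeg {1ℝ + β} k 0≤1+β) bᵏ≤K)
          (fromℚ-mono tᵏ≤) bᵏ≤K))

-- Probabilities as limits of rational expectations

indicator : Bool → ℚ
indicator b = if b then 1ℚ else 0ℚ

sumL : ∀ {A : Set} → (A → ℚ) → List A → ℚ
sumL f []       = 0ℚ
sumL f (x ∷ xs) = f x ℚ.+ sumL f xs

sumL-cong : ∀ {A : Set} {f g : A → ℚ} → (∀ x → f x ≡ g x) → ∀ xs → sumL f xs ≡ sumL g xs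
sumL-cong f≡g []       = refl
sumL-cong f≡g (x ∷ xs) = cong₂ ℚ._+_ (f≡g x) (sumL-cong f≡g xs)

sumL-* : ∀ {A : Set} c (f : A → ℚ) xs → sumL (λ x → c ℚ.* f x) xs ≡ c ℚ.* sumL f xs
sumL-* c f []       = sym (ℚₚ.*-zeroʳ c)
sumL-* c f (x ∷ xs) = trans (cong (λ z → c ℚ.* f x ℚ.+ z) (sumL-* c f xs)) (sym (ℚₚ.*-distribˡ-+ c (f x) (sumL f xs)))

sumL-map-++ : ∀ {A B : Set} (f : B → ℚ) (h : A → B) xs ys → sumL f (List.map h xs ++ ys) ≡ sumL (f ∘ h) xs ℚ.+ sumL f ys
sumL-map-++ f h []       ys = sym (ℚₚ.+-identityˡ (sumL f ys))
sumL-map-++ f h (x ∷ xs) ys = trans (cong (λ z → f (h x) ℚ.+ z) (sumL-map-++ f h xs ys)) (sym (ℚₚ.+-assoc (f (h x)) (sumL (f ∘ h) xs) (sumL f ys)))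

sumL-product : ∀ {A B C : Set} (f : C → ℚ) (h : A → B → C) xs ys →
  sumL f (cartesianProductWith h xs ys) ≡ sumL (λ x → sumL (λ y → f (h x y)) ys) xs
sumL-product f h []       ys = refl
sumL-product f h (x ∷ xs) ys = trans (sumL-map-++ f (h x) ys (cartesianProductWith h xs ys))
  (cong (λ z → sumL (f ∘ h x) ys ℚ.+ z) (sumL-product f h xs ys))

seq-filter : ∀ {A : Set} (w : A → ℝ) (D : A → Bool) m xs →
  seq (List.foldr _+_ 0ℝ (List.map w (filterᵇ D xs))) m ≡ sumL (λ x → seq (w x) m ℚ.* indicator (D x)) xs
seq-filter w D m []       = refl
seq-filter w D m (x ∷ xs) with D x
... | true  = cong₂ ℚ._+_ (sym (ℚₚ.*-identityʳ (seq (w x) m))) (seq-filter w D m xs)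
... | false = trans (seq-filter w D m xs) (trans (sym (ℚₚ.+-identityˡ _))
  (cong (ℚ._+ sumL (λ x → seq (w x) m ℚ.* indicator (D x)) xs) (sym (ℚₚ.*-zeroʳ (seq (w x) m)))))

module _ (p : ℝ) (m : ℕ) (0≤q : 0ℚ ℚ.≤ seq p m) (q≤1 : seq p m ℚ.≤ 1ℚ) where

  open ErdősRényi (seq p m) 0≤q q≤1

  sumL-subsets : ∀ n (F : Subset n → ℚ) → sumL (λ S → seq (edgesWeight p S) m ℚ.* F S) (subsets n) ≡ 𝔼 (subset n) F
  sumL-subsets zero    F = trans (ℚₚ.+-identityʳ _) (ℚₚ.*-identityˡ (F []))
  sumL-subsets (suc n) F = begin
    sumL f (cartesianProductWith _∷_ (true ∷ false ∷ []) (subsets n))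
      ≡⟨ sumL-product f _∷_ (true ∷ false ∷ []) (subsets n) ⟩
    sumL (λ S → seq p m ℚ.* w S ℚ.* F (true ∷ S)) (subsets n) ℚ.+ (sumL (λ S → (1ℚ ℚ.- seq p m) ℚ.* w S ℚ.* F (false ∷ S)) (subsets n) ℚ.+ 0ℚ)
      ≡⟨ cong₂ ℚ._+_ (slice (seq p m) true) (trans (ℚₚ.+-identityʳ _) (slice (1ℚ ℚ.- seq p m) false)) ⟩
    𝔼 (subset (suc n)) F ∎
    where
    open ≡-Reasoning
    w : Subset n → ℚ
    w S = seq (edgesWeight p S) m

    f : Subset (suc n) → ℚ
    f S = seq (edgesWeight p S) m ℚ.* F S

    slice : ∀ c b → sumL (λ S → c ℚ.* w S ℚ.* F (b ∷ S)) (subsets n) ≡ c ℚ.* 𝔼 (subset n) (λ S → F (b ∷ S))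
    slice c b = trans (sumL-cong (λ S → ℚₚ.*-assoc c (w S) (F (b ∷ S))) (subsets n))
      (trans (sumL-* c (λ S → w S ℚ.* F (b ∷ S)) (subsets n)) (cong (c ℚ.*_) (sumL-subsets n (λ S → F (b ∷ S)))))

  sumL-graphs : ∀ n (F : Graph n → ℚ) → sumL (λ G → seq (weight p G) m ℚ.* F G) (graphs n) ≡ 𝔼 (graph n) F
  sumL-graphs zero    F = trans (ℚₚ.+-identityʳ _) (ℚₚ.*-identityˡ (F ∅))
  sumL-graphs (suc n) F = begin
    sumL (λ G → seq (weight p G) m ℚ.* F G) (cartesianProductWith _▷_ (subsets n) (graphs n))
      ≡⟨ sumL-product (λ G → seq (weight p G) m ℚ.* F G) _▷_ (subsets n) (graphs n) ⟩
    sumL (λ S → sumL (λ G → seq (edgesWeight p S) m ℚ.* seq (weight p G) m ℚ.* F (S ▷ G)) (graphs n)) (subsets n)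
      ≡⟨ sumL-cong (λ S → trans (sumL-cong (λ G → ℚₚ.*-assoc (seq (edgesWeight p S) m) (seq (weight p G) m) (F (S ▷ G))) (graphs n))
           (trans (sumL-* (seq (edgesWeight p S) m) (λ G → seq (weight p G) m ℚ.* F (S ▷ G)) (graphs n))
             (cong (seq (edgesWeight p S) m ℚ.*_) (sumL-graphs n (λ G → F (S ▷ G)))))) (subsets n) ⟩
    sumL (λ S → seq (edgesWeight p S) m ℚ.* 𝔼 (graph n) (λ G → F (S ▷ G))) (subsets n)
      ≡⟨ sumL-subsets n (λ S → 𝔼 (graph n) (λ G → F (S ▷ G))) ⟩
    𝔼 (graph (suc n)) F ∎
    where open ≡-Reasoning

  -- `Pr` is a polynomial in p, so its m-th term is that polynomial at the m-th term of p, exactly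
  -- and not only in the limit.
  seq-Pr : ∀ {n} (D : Graph n → Bool) → seq (Pr p D) m ≡ 𝔼 (graph n) (λ G → indicator (D G))
  seq-Pr {n} D = trans (seq-filter (weight p) D m (graphs n)) (sumL-graphs n (λ G → indicator (D G)))

-- Probabilities under equal reals, and terms capped at 1

neg-antimono : ∀ {x y} → x ≤ y → (- y) ≤ (- x)
neg-antimono {x} {y} x≤y = ≤-because { - y} { - x} {y - x} (≤⇒0≤- {x} {y} x≤y)
  (λ m → solve 2 (λ x y → (:- x) :- (:- y) := y :- x) refl (seq x m) (seq y m))

-- z has no sign, but z + A ≥ 0 eventually for a suitable A. In (y - x) z = (y - x)(z + A) + (x - y)
-- A both terms are nonnegative, because y - x and x - y are.
*-cong-≤ : ∀ {x y} → x ≤ y → y ≤ x → ∀ z → x * z ≤ y * z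
*-cong-≤ {x} {y} x≤y y≤x z = ≤-because {x * z} {y * z} {(y - x) * (z + fromℚ A) + (x - y) * fromℚ A}
  (+-nonNeg {(y - x) * (z + fromℚ A)} {(x - y) * fromℚ A}
    (*-nonNeg {y - x} {z + fromℚ A} (≤⇒0≤- {x} {y} x≤y)
      (≤-eventually {0ℝ} {z + fromℚ A} N (λ m N≤m → Rat.≤-because (Rat.≤⇒0≤- (-z≤A m N≤m))
        (solve 2 (λ z a → z :+ a :- con 0ℚ := a :- :- z) refl (seq z m) A))))
    (*-nonNeg {x - y} {fromℚ A} (≤⇒0≤- {y} {x} y≤x) (fromℚ-mono 0≤A)))
  (λ m → solve 4 (λ x y z a → y :* z :- x :* z := (y :- x) :* (z :+ a) :+ (x :- y) :* a) refl (seq x m) (seq y m) (seq z m) A)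
  where
  bound : ∃ λ A → 0ℚ ℚ.≤ A × ∃ λ N → ∀ m → N ℕ.≤ m → seq (- z) m ℚ.≤ A
  bound = upperBound (- z)

  A : ℚ
  A = proj₁ bound

  0≤A : 0ℚ ℚ.≤ A
  0≤A = proj₁ (proj₂ bound)

  N : ℕ
  N = proj₁ (proj₂ (proj₂ bound))

  -z≤A : ∀ m → N ℕ.≤ m → seq (- z) m ℚ.≤ A
  -z≤A = proj₂ (proj₂ (proj₂ bound))

*-cong-≃ : ∀ {x y z w} → x ≃ y → z ≃ w → x * z ≃ y * w
*-cong-≃ {x} {y} {z} {w} (x≤y , y≤x) (z≤w , w≤z) = transfer x y z w x≤y y≤x z≤w w≤z , transfer y x w z y≤x x≤y w≤z z≤w
  where
  transfer : ∀ x y z w → x ≤ y → y ≤ x → z ≤ w → w ≤ z → x * z ≤ y * w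
  transfer x y z w x≤y y≤x z≤w w≤z = ≤-trans {x * z} {y * z} {y * w} (*-cong-≤ {x} {y} x≤y y≤x z)
    (≤-trans {y * z} {z * y} {y * w} (≤-≗ {y * z} {z * y} (λ m → ℚₚ.*-comm (seq y m) (seq z m)))
      (≤-trans {z * y} {w * y} {y * w} (*-cong-≤ {z} {w} z≤w w≤z y)
        (≤-≗ {w * y} {y * w} (λ m → ℚₚ.*-comm (seq w m) (seq y m)))))

module _ {p p′ : ℝ} (p≃p′ : p ≃ p′) where

  edge-cong : ∀ (b : Bool) → (if b then p else 1ℝ - p) ≃ (if b then p′ else 1ℝ - p′)
  edge-cong true  = p≃p′
  edge-cong false =
    +-mono-≤ {1ℝ} {1ℝ} { - p} { - p′} (≤-refl {1ℝ}) (neg-antimono {p′} {p} (proj₂ p≃p′)) ,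
    +-mono-≤ {1ℝ} {1ℝ} { - p′} { - p} (≤-refl {1ℝ}) (neg-antimono {p} {p′} (proj₁ p≃p′))

  edgesWeight-cong : ∀ {n} (S : Subset n) → edgesWeight p S ≃ edgesWeight p′ S
  edgesWeight-cong []      = ≤-refl {1ℝ} , ≤-refl {1ℝ}
  edgesWeight-cong (b ∷ S) = *-cong-≃ {if b then p else 1ℝ - p} {if b then p′ else 1ℝ - p′} {edgesWeight p S} {edgesWeight p′ S}
    (edge-cong b) (edgesWeight-cong S)

  weight-cong : ∀ {n} (G : Graph n) → weight p G ≃ weight p′ G
  weight-cong ∅       = ≤-refl {1ℝ} , ≤-refl {1ℝ}
  weight-cong (S ▷ G) = *-cong-≃ {edgesWeight p S} {edgesWeight p′ S} {weight p G} {weight p′ G} (edgesWeight-cong S) (weight-cong G)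

  total-cong : ∀ {n} (Gs : List (Graph n)) → List.foldr _+_ 0ℝ (List.map (weight p) Gs) ≃ List.foldr _+_ 0ℝ (List.map (weight p′) Gs)
  total-cong []       = ≤-refl {0ℝ} , ≤-refl {0ℝ}
  total-cong (G ∷ Gs) =
    +-mono-≤ {weight p G} {weight p′ G} {List.foldr _+_ 0ℝ (List.map (weight p) Gs)} {List.foldr _+_ 0ℝ (List.map (weight p′) Gs)}
      (proj₁ (weight-cong G)) (proj₁ (total-cong Gs)) ,
    +-mono-≤ {weight p′ G} {weight p G} {List.foldr _+_ 0ℝ (List.map (weight p′) Gs)} {List.foldr _+_ 0ℝ (List.map (weight p) Gs)}
      (proj₂ (weight-cong G)) (proj₂ (total-cong Gs))

  Pr-cong : ∀ {n} (D : Graph n → Bool) → Pr p D ≃ Pr p′ D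
  Pr-cong {n} D = total-cong (filterᵇ D (graphs n))

⊓1-close : ∀ a b → ℚ.∣ a ℚ.⊓ 1ℚ ℚ.- b ℚ.⊓ 1ℚ ∣ ℚ.≤ ℚ.∣ a ℚ.- b ∣
⊓1-close a b = either (ℚₚ.∣p∣≡p∨∣p∣≡-p (a ℚ.⊓ 1ℚ ℚ.- b ℚ.⊓ 1ℚ))
  where
  one-sided : ∀ a b → a ℚ.⊓ 1ℚ ℚ.- b ℚ.⊓ 1ℚ ℚ.≤ ℚ.∣ a ℚ.- b ∣
  one-sided a b with ℚₚ.≤-total b 1ℚ
  ... | inj₁ b≤1 = ℚₚ.≤-trans (ℚₚ.+-mono-≤ (ℚₚ.p⊓q≤p a 1ℚ) (ℚₚ.≤-reflexive (cong ℚ.-_ (ℚₚ.p≤q⇒p⊓q≡p b≤1)))) (p≤∣p∣ (a ℚ.- b))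
  ... | inj₂ 1≤b = ℚₚ.≤-trans (ℚₚ.+-mono-≤ (ℚₚ.p⊓q≤q a 1ℚ) (ℚₚ.≤-reflexive (cong ℚ.-_ (ℚₚ.p≥q⇒p⊓q≡q 1≤b)))) (ℚₚ.0≤∣p∣ (a ℚ.- b))

  swap : ∀ a b → ℚ.- (a ℚ.- b) ≡ b ℚ.- a
  swap = solve 2 (λ a b → :- (a :- b) := b :- a) refl

  either : ∀ {x} → x ≡ a ℚ.⊓ 1ℚ ℚ.- b ℚ.⊓ 1ℚ ⊎ x ≡ ℚ.- (a ℚ.⊓ 1ℚ ℚ.- b ℚ.⊓ 1ℚ) → x ℚ.≤ ℚ.∣ a ℚ.- b ∣
  either (inj₁ refl) = one-sided a b
  either (inj₂ refl) = subst₂ ℚ._≤_ (sym (swap (a ℚ.⊓ 1ℚ) (b ℚ.⊓ 1ℚ)))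
    (trans (cong ℚ.∣_∣ (sym (swap a b))) (ℚₚ.∣-p∣≡∣p∣ (a ℚ.- b))) (one-sided b a)

-- A sequence representing p ≤ 1 may exceed 1, where it is not a probability.
capped : ℝ → ℝ
capped x = mkℝ (λ m → seq x m ℚ.⊓ 1ℚ) λ ε 0<ε → proj₁ (cauchy x ε 0<ε) , λ m n N≤m N≤n →
  ℚₚ.≤-trans (⊓1-close (seq x m) (seq x n)) (proj₂ (cauchy x ε 0<ε) m n N≤m N≤n)

capped-≃ : ∀ x → x ≤ 1ℝ → x ≃ capped x
capped-≃ x x≤1 = below , ≤-pointwise {capped x} {x} (λ m → ℚₚ.p⊓q≤p (seq x m) 1ℚ)
  where
  below : x ≤ capped x
  below ε 0<ε with x≤1 ε 0<ε
  ... | N , x≤1+ε = N , λ m N≤m → go m (x≤1+ε m N≤m) (ℚₚ.≤-total (seq x m) 1ℚ)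
    where
    go : ∀ m → seq x m ℚ.≤ 1ℚ ℚ.+ ε → seq x m ℚ.≤ 1ℚ ⊎ 1ℚ ℚ.≤ seq x m → seq x m ℚ.≤ seq x m ℚ.⊓ 1ℚ ℚ.+ ε
    go m _ (inj₁ x≤1) = subst (λ z → seq x m ℚ.≤ z ℚ.+ ε) (sym (ℚₚ.p≤q⇒p⊓q≡p x≤1))
      (Rat.≤-because (ℚₚ.<⇒≤ 0<ε) (solve 2 (λ x e → x :+ e :- x := e) refl (seq x m) ε))
    go m h (inj₂ 1≤x) = subst (λ z → seq x m ℚ.≤ z ℚ.+ ε) (sym (ℚₚ.p≥q⇒p⊓q≡q 1≤x)) h

-- Growth of np in terms of a rational exponent

/-*-cancel : ∀ r s .{{_ : ℕ.NonZero s}} → + r ℚ./ s ℚ.* ⟦ s ⟧ ≡ ⟦ r ⟧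
/-*-cancel r s@(suc s-1) = ℚₚ.toℚᵘ-injective (begin
  ℚ.toℚᵘ (+ r ℚ./ s ℚ.* ⟦ s ⟧)
    ≈⟨ ℚₚ.toℚᵘ-homo-* (+ r ℚ./ s) ⟦ s ⟧ ⟩
  ℚ.toℚᵘ (+ r ℚ./ s) ℚᵘ.* ℚ.toℚᵘ ⟦ s ⟧
    ≈⟨ ℚᵘₚ.*-cong (ℚₚ.toℚᵘ-fromℚᵘ (ℚᵘ.mkℚᵘ (+ r) s-1)) (Rat.toℚᵘ-/1 (+ s)) ⟩
  ℚᵘ.mkℚᵘ (+ r) s-1 ℚᵘ.* ℚᵘ.mkℚᵘ (+ s) 0
    ≈⟨ ℚᵘ.*≡* (trans (ℤₚ.*-identityʳ _) (cong (+ r ℤ.*_) (cong +_ (sym (ℕₚ.*-identityʳ s))))) ⟩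
  ℚᵘ.mkℚᵘ (+ r) 0
    ≈⟨ Rat.toℚᵘ-/1 (+ r) ⟨
  ℚ.toℚᵘ ⟦ r ⟧ ∎)
  where open ℚᵘₚ.≃-Reasoning

positive-fraction : ∀ p → 0ℚ ℚ.< p → ∃ λ r → ∃ λ s → p ≡ + suc r ℚ./ suc s
positive-fraction (ℚ.mkℚ (+ 0)       d c) 0<p with () ← ℤ.Positive.pos (ℚ.positive 0<p)
positive-fraction (ℚ.mkℚ ℤ.+[1+ r ]  d c) 0<p = r , d , sym (ℚₚ.↥p/↧p≡p (ℚ.mkℚ ℤ.+[1+ r ] d c))
positive-fraction (ℚ.mkℚ ℤ.-[1+ r ]  d c) 0<p with () ← ℤ.Positive.pos (ℚ.positive 0<p)

-- The last hypothesis says nq ≳ n^(r/s). Its k-th power is compared with the s-th power of the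
-- claim, so that all exponents are integers. If the claim failed, then n · n³ˢ ≤ n^(kr) ≤ c₀
-- (nq)^(ks) < c₀ Ωˢ n³ˢ ≤ n · n³ˢ: the spare factor n provided by 3s < kr absorbs all constants.
growth : ∀ n q r s k Ω .{{_ : ℕ.NonZero s}} → 0ℚ ℚ.≤ q → 3 ℕ.* s ℕ.< k ℕ.* r → 1 ℕ.≤ n →
  2 ℕ.^ k ℕ.* (2 ℕ.^ s) ℕ.^ k ℕ.* Ω ℕ.^ s ℕ.≤ n →
  ⟦ n ⟧ ^ℚ r ℚ.≤ 2ℚ ℚ.* (2ℚ ℚ.* (⟦ n ⟧ ℚ.* q)) ^ℚ s →
  ⟦ Ω ⟧ ℚ.* (⟦ n ⟧ ^ℚ 3) ℚ.≤ (⟦ n ⟧ ℚ.* q) ^ℚ k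
growth n q r s k Ω 0≤q 3s<kr 1≤n X≤n nʳ≤ = ℚₚ.≮⇒≥ λ small → ℚₚ.<-irrefl refl (begin-strict
  N ℚ.* (N ^ℚ 3) ^ℚ s
    ≡⟨ cong (N ℚ.*_) (Rat.^-assocʳ N 3 s) ⟩
  N ^ℚ suc (3 ℕ.* s)
    ≤⟨ N-mono 3s<kr ⟩
  N ^ℚ (k ℕ.* r)
    ≡⟨ trans (cong (N ^ℚ_) (ℕₚ.*-comm k r)) (sym (Rat.^-assocʳ N r k)) ⟩
  (N ^ℚ r) ^ℚ k
    ≤⟨ Rat.^-mono-≤ k (Rat.^-nonNeg r 0≤N) nʳ≤ ⟩
  (2ℚ ℚ.* (2ℚ ℚ.* y) ^ℚ s) ^ℚ k
    ≡⟨ trans (Rat.^-distrib-* 2ℚ ((2ℚ ℚ.* y) ^ℚ s) k) (cong (2ℚ ^ℚ k ℚ.*_) (trans (cong (_^ℚ k) (Rat.^-distrib-* 2ℚ y s)) (Rat.^-distrib-* (2ℚ ^ℚ s) (y ^ℚ s) k))) ⟩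
  2ℚ ^ℚ k ℚ.* ((2ℚ ^ℚ s) ^ℚ k ℚ.* (y ^ℚ s) ^ℚ k)
    ≡⟨ ℚₚ.*-assoc (2ℚ ^ℚ k) ((2ℚ ^ℚ s) ^ℚ k) ((y ^ℚ s) ^ℚ k) ⟨
  c₀ ℚ.* (y ^ℚ s) ^ℚ k
    ≡⟨ cong (c₀ ℚ.*_) (trans (Rat.^-assocʳ y s k) (trans (cong (y ^ℚ_) (ℕₚ.*-comm s k)) (sym (Rat.^-assocʳ y k s)))) ⟩
  c₀ ℚ.* (y ^ℚ k) ^ℚ s
    <⟨ ℚₚ.*-monoʳ-<-pos c₀ {{ℚ.positive 0<c₀}} (Rat.^-mono-< s (Rat.^-nonNeg k (Rat.*-nonNeg 0≤N 0≤q)) small) ⟩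
  c₀ ℚ.* (⟦ Ω ⟧ ℚ.* (N ^ℚ 3)) ^ℚ s
    ≡⟨ trans (cong (c₀ ℚ.*_) (Rat.^-distrib-* ⟦ Ω ⟧ (N ^ℚ 3) s)) (sym (ℚₚ.*-assoc c₀ (⟦ Ω ⟧ ^ℚ s) ((N ^ℚ 3) ^ℚ s))) ⟩
  c₀ ℚ.* ⟦ Ω ⟧ ^ℚ s ℚ.* (N ^ℚ 3) ^ℚ s
    ≡⟨ cong (ℚ._* (N ^ℚ 3) ^ℚ s) X≡ ⟨
  ⟦ 2 ℕ.^ k ℕ.* (2 ℕ.^ s) ℕ.^ k ℕ.* Ω ℕ.^ s ⟧ ℚ.* (N ^ℚ 3) ^ℚ s
    ≤⟨ Rat.*-monoʳ (Rat.^-nonNeg s (Rat.^-nonNeg 3 0≤N)) (Rat.⟦⟧-mono X≤n) ⟩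
  N ℚ.* (N ^ℚ 3) ^ℚ s ∎)
  where
  open ℚₚ.≤-Reasoning
  N y c₀ : ℚ
  N  = ⟦ n ⟧
  y  = N ℚ.* q
  c₀ = 2ℚ ^ℚ k ℚ.* (2ℚ ^ℚ s) ^ℚ k

  0≤N : 0ℚ ℚ.≤ N
  0≤N = Rat.⟦⟧-nonNeg n

  0<c₀ : 0ℚ ℚ.< c₀
  0<c₀ = Rat.*-pos (Rat.^-pos k (Rat.⟦⟧-pos 2)) (Rat.^-pos k (Rat.^-pos s (Rat.⟦⟧-pos 2)))

  N-mono : ∀ {a b} → a ℕ.≤ b → N ^ℚ a ℚ.≤ N ^ℚ b
  N-mono {a} {b} a≤b = subst₂ ℚ._≤_ (ℚₚ.*-identityʳ (N ^ℚ a)) (trans (sym (Rat.^-homo-* N a (b ℕ.∸ a))) (cong (N ^ℚ_) (ℕₚ.m+[n∸m]≡n a≤b)))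
    (Rat.*-monoˡ (Rat.^-nonNeg a 0≤N) (Rat.1≤^ (b ℕ.∸ a) (Rat.⟦⟧-mono 1≤n)))

  X≡ : ⟦ 2 ℕ.^ k ℕ.* (2 ℕ.^ s) ℕ.^ k ℕ.* Ω ℕ.^ s ⟧ ≡ c₀ ℚ.* ⟦ Ω ⟧ ^ℚ s
  X≡ = trans (Rat.⟦⟧-* (2 ℕ.^ k ℕ.* (2 ℕ.^ s) ℕ.^ k) (Ω ℕ.^ s)) (cong₂ ℚ._*_
    (trans (Rat.⟦⟧-* (2 ℕ.^ k) ((2 ℕ.^ s) ℕ.^ k)) (cong₂ ℚ._*_ (Rat.⟦⟧-^ 2 k) (trans (Rat.⟦⟧-^ (2 ℕ.^ s) k) (cong (_^ℚ k) (Rat.⟦⟧-^ 2 s)))))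
    (Rat.⟦⟧-^ Ω s))

-- Choice of the exponent and of the scales

-- `IsPower` compares nᵅ with powers at rational exponents, so α is represented by a fraction r/s ≤
-- α; `3s<kr` is k > 3 s/r without division.
record Exponent (α : ℝ) (0<α : 0ℝ < α) : Set where
  field
    r s k-1 : ℕ
    {{s≢0}} : ℕ.NonZero s

  k : ℕ
  k = suc k-1

  field
    below  : fromℚ (+ r ℚ./ s) ≤ α
    3s<kr  : 3 ℕ.* s ℕ.< k ℕ.* r
    k≤6/α  : fromℚ (+ k ℚ./ 1) ≤ fromℕ 6 / α ⟨ 0<α ⟩

fromℚ-cancel-≤ : ∀ {p q} → fromℚ p ≤ fromℚ q → p ℚ.≤ q
fromℚ-cancel-≤ {p} {q} p≤q = ℚₚ.≮⇒≥ λ q<p →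
  let e   = ½ ℚ.* (p ℚ.- q)
      0<d = subst (ℚ._< p ℚ.- q) (ℚₚ.+-inverseʳ q) (ℚₚ.+-monoˡ-< (ℚ.- q) q<p)
      0<e = Rat.*-pos (ℚₚ.positive⁻¹ ½) 0<d
      N , p≤q+e = p≤q e 0<e
  in ℚₚ.<-irrefl refl (ℚₚ.<-≤-trans 0<e (Rat.0≤-⇒≤ (subst (0ℚ ℚ.≤_)
       (solve 2 (λ p q → q :+ con ½ :* (p :- q) :- p := con 0ℚ :- con ½ :* (p :- q)) refl p q)
       (Rat.≤⇒0≤- (p≤q+e N ℕₚ.≤-refl)))))

-- k = ⌊3/ρ⌋ + 1 with ρ = r/s.
ceiling : ∀ r s .{{_ : ℕ.NonZero r}} .{{_ : ℕ.NonZero s}} → + r ℚ./ s ℚ.≤ 1ℚ →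
  ∃ λ k-1 → 3 ℕ.* s ℕ.< suc k-1 ℕ.* r × ⟦ suc k-1 ⟧ ℚ.* (+ r ℚ./ s) ℚ.≤ ⟦ 4 ⟧
ceiling r s ρ≤1 = j , 3s<kr , kρ≤4
  where
  j : ℕ
  j = (3 ℕ.* s) ℕ./ r

  ρ : ℚ
  ρ = + r ℚ./ s

  3s<kr : 3 ℕ.* s ℕ.< suc j ℕ.* r
  3s<kr = subst (ℕ._< r ℕ.+ j ℕ.* r) (sym (m≡m%n+[m/n]*n (3 ℕ.* s) r)) (ℕₚ.+-monoˡ-< (j ℕ.* r) (m%n<n (3 ℕ.* s) r))

  -- k - 1 ≤ 3/ρ gives k ρ ≤ 3 + ρ ≤ 4.
  kρ≤4 : ⟦ suc j ⟧ ℚ.* ρ ℚ.≤ ⟦ 4 ⟧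
  kρ≤4 = Rat.*-cancelˡ (Rat.⟦⟧-pos s) (begin
    ⟦ s ⟧ ℚ.* (⟦ suc j ⟧ ℚ.* ρ)      ≡⟨ solve 3 (λ s k r → s :* (k :* r) := k :* (r :* s)) refl ⟦ s ⟧ ⟦ suc j ⟧ ρ ⟩
    ⟦ suc j ⟧ ℚ.* (ρ ℚ.* ⟦ s ⟧)      ≡⟨ cong (⟦ suc j ⟧ ℚ.*_) (/-*-cancel r s) ⟩
    ⟦ suc j ⟧ ℚ.* ⟦ r ⟧              ≡⟨ Rat.⟦⟧-* (suc j) r ⟨
    ⟦ r ℕ.+ j ℕ.* r ⟧                ≤⟨ Rat.⟦⟧-mono (ℕₚ.+-monoʳ-≤ r (m/n*n≤m (3 ℕ.* s) r)) ⟩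
    ⟦ r ℕ.+ 3 ℕ.* s ⟧                ≡⟨ trans (Rat.⟦⟧-+ r (3 ℕ.* s)) (cong₂ ℚ._+_ (sym (/-*-cancel r s)) (Rat.⟦⟧-* 3 s)) ⟩
    ρ ℚ.* ⟦ s ⟧ ℚ.+ 3ℚ ℚ.* ⟦ s ⟧     ≤⟨ ℚₚ.+-monoˡ-≤ (3ℚ ℚ.* ⟦ s ⟧) (Rat.*-monoʳ (Rat.⟦⟧-nonNeg s) ρ≤1) ⟩
    1ℚ ℚ.* ⟦ s ⟧ ℚ.+ 3ℚ ℚ.* ⟦ s ⟧    ≡⟨ solve 1 (λ s → con 1ℚ :* s :+ con 3ℚ :* s := s :* con ⟦ 4 ⟧) refl ⟦ s ⟧ ⟩
    ⟦ s ⟧ ℚ.* ⟦ 4 ⟧                  ∎)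
    where open ℚₚ.≤-Reasoning

-- Let a be a term of α after which all terms stay within d/10 ≤ a/10 of it, and ρ = 9a/10. Then ρ ≤
-- α, while eventually α ≤ 11a/10 = (11/9) ρ, so that k ρ ≤ 4 gives k α ≤ 44/9 < 6.
exponent : ∀ α (0<α : 0ℝ < α) → α ≤ 1ℝ → Exponent α 0<α
exponent α 0<α@(d , 0<d , N₁ , d≤α) α≤1 = record
  { r = r ; s = s ; k-1 = proj₁ k-data
  ; below = ρ≤α ; 3s<kr = proj₁ (proj₂ k-data) ; k≤6/α = k≤ }
  where
  e : ℚ
  e = (+ 1 ℚ./ 10) ℚ.* d

  close : ∃ λ N → ∀ m n → N ℕ.≤ m → N ℕ.≤ n → ℚ.∣ seq α m ℚ.- seq α n ∣ ℚ.≤ e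
  close = cauchy α e (Rat.*-pos (ℚₚ.positive⁻¹ (+ 1 ℚ./ 10)) 0<d)

  N : ℕ
  N = N₁ ℕ.⊔ proj₁ close

  a : ℚ
  a = seq α N

  d≤a : d ℚ.≤ a
  d≤a = subst (ℚ._≤ a) (ℚₚ.+-identityˡ d) (d≤α N (ℕₚ.m≤m⊔n N₁ (proj₁ close)))

  near : ∀ m → N ℕ.≤ m → (ℚ.- e ℚ.≤ seq α m ℚ.- a) × (seq α m ℚ.- a ℚ.≤ e)
  near m N≤m = Rat.∣p∣≤⇒ e (proj₂ close m N (ℕₚ.m⊔n≤o⇒n≤o N₁ (proj₁ close) N≤m) (ℕₚ.m≤n⊔m N₁ (proj₁ close)))

  fraction : ∃ λ r → ∃ λ s → (+ 9 ℚ./ 10) ℚ.* a ≡ + suc r ℚ./ suc s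
  fraction = positive-fraction ((+ 9 ℚ./ 10) ℚ.* a) (Rat.*-pos (ℚₚ.positive⁻¹ (+ 9 ℚ./ 10)) (ℚₚ.<-≤-trans 0<d d≤a))

  r s : ℕ
  r = suc (proj₁ fraction)
  s = suc (proj₁ (proj₂ fraction))

  ρ : ℚ
  ρ = + r ℚ./ s

  ρ≡ : (+ 9 ℚ./ 10) ℚ.* a ≡ ρ
  ρ≡ = proj₂ (proj₂ fraction)

  ρ≤α : fromℚ ρ ≤ α
  ρ≤α = ≤-eventually {fromℚ ρ} {α} N λ m N≤m → subst (ℚ._≤ seq α m) ρ≡
    (Rat.≤-because (Rat.+-nonNeg (Rat.≤⇒0≤- (proj₁ (near m N≤m))) (Rat.*-nonNeg (ℚₚ.nonNegative⁻¹ (+ 1 ℚ./ 10)) (Rat.≤⇒0≤- d≤a)))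
      (solve 3 (λ x a d → x :- con (+ 9 ℚ./ 10) :* a := (x :- a) :- (:- (con (+ 1 ℚ./ 10) :* d)) :+ con (+ 1 ℚ./ 10) :* (a :- d)) refl (seq α m) a d))

  k-data : ∃ λ k-1 → 3 ℕ.* s ℕ.< suc k-1 ℕ.* r × ⟦ suc k-1 ⟧ ℚ.* ρ ℚ.≤ ⟦ 4 ⟧
  k-data = ceiling r s (fromℚ-cancel-≤ (≤-trans {fromℚ ρ} {α} {1ℝ} ρ≤α α≤1))

  κ : ℚ
  κ = ⟦ suc (proj₁ k-data) ⟧

  0≤κ : 0ℚ ℚ.≤ κ
  0≤κ = Rat.⟦⟧-nonNeg (suc (proj₁ k-data))

  κα≤6 : ∀ m → N ℕ.≤ m → κ ℚ.* seq α m ℚ.≤ ⟦ 6 ⟧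
  κα≤6 m N≤m = begin
    κ ℚ.* seq α m
      ≤⟨ Rat.*-monoˡ 0≤κ (Rat.≤-because
           (Rat.+-nonNeg (Rat.≤⇒0≤- (proj₂ (near m N≤m))) (Rat.*-nonNeg (ℚₚ.nonNegative⁻¹ (+ 1 ℚ./ 10)) (Rat.≤⇒0≤- d≤a)))
           (solve 3 (λ x a d → con (+ 11 ℚ./ 9) :* (con (+ 9 ℚ./ 10) :* a) :- x :=
             con (+ 1 ℚ./ 10) :* d :- (x :- a) :+ con (+ 1 ℚ./ 10) :* (a :- d)) refl (seq α m) a d)) ⟩
    κ ℚ.* ((+ 11 ℚ./ 9) ℚ.* ((+ 9 ℚ./ 10) ℚ.* a))
      ≡⟨ trans (cong (λ z → κ ℚ.* ((+ 11 ℚ./ 9) ℚ.* z)) ρ≡) (solve 2 (λ k p → k :* (con (+ 11 ℚ./ 9) :* p) := con (+ 11 ℚ./ 9) :* (k :* p)) refl κ ρ) ⟩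
    (+ 11 ℚ./ 9) ℚ.* (κ ℚ.* ρ)
      ≤⟨ Rat.*-monoˡ (ℚₚ.nonNegative⁻¹ (+ 11 ℚ./ 9)) (proj₂ (proj₂ k-data)) ⟩
    (+ 11 ℚ./ 9) ℚ.* ⟦ 4 ⟧
      ≤⟨ ℚₚ.≤ᵇ⇒≤ {(+ 11 ℚ./ 9) ℚ.* ⟦ 4 ⟧} {⟦ 6 ⟧} _ ⟩
    ⟦ 6 ⟧ ∎
    where open ℚₚ.≤-Reasoning

  k≤ : fromℚ κ ≤ fromℕ 6 / α ⟨ 0<α ⟩
  k≤ = ≤-eventually {fromℚ κ} {fromℕ 6 / α ⟨ 0<α ⟩} (N ℕ.⊔ M) λ m NM≤m → begin
    κ
      ≡⟨ trans (cong (κ ℚ.*_) (proj₂ (*-inv α 0<α) m (ℕₚ.m⊔n≤o⇒n≤o N M NM≤m))) (ℚₚ.*-identityʳ κ) ⟨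
    κ ℚ.* (seq α m ℚ.* seq (inv α 0<α) m)
      ≡⟨ ℚₚ.*-assoc κ (seq α m) (seq (inv α 0<α) m) ⟨
    κ ℚ.* seq α m ℚ.* seq (inv α 0<α) m
      ≤⟨ Rat.*-monoʳ (inv-pointwise m) (κα≤6 m (ℕₚ.m⊔n≤o⇒m≤o N M NM≤m)) ⟩
    ⟦ 6 ⟧ ℚ.* seq (inv α 0<α) m ∎
    where
    open ℚₚ.≤-Reasoning
    M : ℕ
    M = proj₁ (*-inv α 0<α)
    inv-pointwise : ∀ m → 0ℚ ℚ.≤ seq (inv α 0<α) m
    inv-pointwise = inv-seq-nonNeg α 0<α

-- Bernoulli gives (1 - x)ᵏ ≥ 2/3, and (1 - x)ᵏ (1 + x)ᵏ = (1 - x²)ᵏ ≤ 1.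
^-upper : ∀ {x} k → 0ℚ ℚ.≤ x → x ℚ.≤ 1ℚ → ⟦ k ⟧ ℚ.* x ℚ.≤ + 1 ℚ./ 3 → (1ℚ ℚ.+ x) ^ℚ k ℚ.≤ + 3 ℚ./ 2
^-upper {x} k 0≤x x≤1 kx≤ = Rat.*-cancelˡ (ℚₚ.positive⁻¹ (+ 2 ℚ./ 3)) (begin
  (+ 2 ℚ./ 3) ℚ.* (1ℚ ℚ.+ x) ^ℚ k
    ≤⟨ Rat.*-monoʳ {+ 2 ℚ./ 3} {(1ℚ ℚ.- x) ^ℚ k} (Rat.^-nonNeg k (Rat.+-nonNeg Rat.0≤1 0≤x)) (ℚₚ.≤-trans
         (Rat.≤-because (Rat.≤⇒0≤- kx≤) (solve 1 (λ y → con 1ℚ :- y :- con (+ 2 ℚ./ 3) := con (+ 1 ℚ./ 3) :- y) refl (⟦ k ⟧ ℚ.* x)))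
         (Rat.bernoulli k 0≤x x≤1)) ⟩
  (1ℚ ℚ.- x) ^ℚ k ℚ.* (1ℚ ℚ.+ x) ^ℚ k
    ≡⟨ Rat.^-distrib-* (1ℚ ℚ.- x) (1ℚ ℚ.+ x) k ⟨
  ((1ℚ ℚ.- x) ℚ.* (1ℚ ℚ.+ x)) ^ℚ k
    ≤⟨ Rat.^-≤1 k (Rat.*-nonNeg (Rat.≤⇒0≤- x≤1) (Rat.+-nonNeg Rat.0≤1 0≤x))
         (Rat.≤-because (Rat.square-nonNeg x) (solve 1 (λ d → con 1ℚ :- (con 1ℚ :- d) :* (con 1ℚ :+ d) := d :* d) refl x)) ⟩
  (+ 2 ℚ./ 3) ℚ.* (+ 3 ℚ./ 2) ∎)
  where open ℚₚ.≤-Reasoning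

module Scale (k : ℕ) .{{_ : ℕ.NonZero k}} where

  -- The inverses of τ and δ. The value 100 k makes k τ = 1/100, and the factor 3ᵏ makes 3ᵏ δ = τ.
  a d : ℕ
  a = 100 ℕ.* k
  d = 3 ℕ.^ k ℕ.* a

  instance
    a≢0 : ℕ.NonZero a
    a≢0 = ℕₚ.m*n≢0 100 k

    d≢0 : ℕ.NonZero d
    d≢0 = ℕₚ.m*n≢0 (3 ℕ.^ k) a {{ℕₚ.m^n≢0 3 k}}

  -- Of the 2δ in t, one δ is the deviation of the degrees from np; the other absorbs the
  -- replacement of p by a rational number.
  τ δ t : ℚ
  τ = reciprocal a
  δ = reciprocal d
  t = 1ℚ ℚ.+ 2ℚ ℚ.* δ

  ττ⁻¹≡1 : τ ℚ.* ⟦ a ⟧ ≡ 1ℚ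
  ττ⁻¹≡1 = trans (ℚₚ.*-comm τ ⟦ a ⟧) (Rat.reciprocal-inverse a)

  δδ⁻¹≡1 : δ ℚ.* ⟦ d ⟧ ≡ 1ℚ
  δδ⁻¹≡1 = trans (ℚₚ.*-comm δ ⟦ d ⟧) (Rat.reciprocal-inverse d)

  0≤τ : 0ℚ ℚ.≤ τ
  0≤τ = Rat.reciprocal-nonNeg a

  0≤δ : 0ℚ ℚ.≤ δ
  0≤δ = Rat.reciprocal-nonNeg d

  3ᵏδ≡τ : 3ℚ ^ℚ k ℚ.* δ ≡ τ
  3ᵏδ≡τ = begin
    3ℚ ^ℚ k ℚ.* δ                          ≡⟨ ℚₚ.*-identityʳ _ ⟨
    3ℚ ^ℚ k ℚ.* δ ℚ.* 1ℚ                   ≡⟨ cong (3ℚ ^ℚ k ℚ.* δ ℚ.*_) ττ⁻¹≡1 ⟨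
    3ℚ ^ℚ k ℚ.* δ ℚ.* (τ ℚ.* ⟦ a ⟧)        ≡⟨ solve 4 (λ b d t a → b :* d :* (t :* a) := d :* (b :* a) :* t) refl (3ℚ ^ℚ k) δ τ ⟦ a ⟧ ⟩
    δ ℚ.* (3ℚ ^ℚ k ℚ.* ⟦ a ⟧) ℚ.* τ        ≡⟨ cong (λ z → δ ℚ.* z ℚ.* τ) (trans (Rat.⟦⟧-* (3 ℕ.^ k) a) (cong (ℚ._* ⟦ a ⟧) (Rat.⟦⟧-^ 3 k))) ⟨
    δ ℚ.* ⟦ d ⟧ ℚ.* τ                      ≡⟨ cong (ℚ._* τ) δδ⁻¹≡1 ⟩
    1ℚ ℚ.* τ                               ≡⟨ ℚₚ.*-identityˡ τ ⟩
    τ                                      ∎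
    where open ≡-Reasoning

  kτ≡ : ⟦ k ⟧ ℚ.* τ ≡ + 1 ℚ./ 100
  kτ≡ = begin
    ⟦ k ⟧ ℚ.* τ                                       ≡⟨ solve 2 (λ k t → k :* t := con (+ 1 ℚ./ 100) :* (t :* (con ⟦ 100 ⟧ :* k))) refl ⟦ k ⟧ τ ⟩
    (+ 1 ℚ./ 100) ℚ.* (τ ℚ.* (⟦ 100 ⟧ ℚ.* ⟦ k ⟧))     ≡⟨ cong (λ z → (+ 1 ℚ./ 100) ℚ.* (τ ℚ.* z)) (Rat.⟦⟧-* 100 k) ⟨
    (+ 1 ℚ./ 100) ℚ.* (τ ℚ.* ⟦ a ⟧)                   ≡⟨ cong ((+ 1 ℚ./ 100) ℚ.*_) ττ⁻¹≡1 ⟩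
    + 1 ℚ./ 100                                       ∎
    where open ≡-Reasoning

  τ≤ : τ ℚ.≤ + 1 ℚ./ 100
  τ≤ = subst₂ ℚ._≤_ (ℚₚ.*-identityˡ τ) kτ≡ (Rat.*-monoʳ 0≤τ (Rat.⟦⟧-mono {1} {k} (ℕ.>-nonZero⁻¹ k)))

  δ≤τ : δ ℚ.≤ τ
  δ≤τ = subst₂ ℚ._≤_ (ℚₚ.*-identityˡ δ) 3ᵏδ≡τ (Rat.*-monoʳ 0≤δ (Rat.1≤^ k (Rat.⟦⟧-mono {1} {3} (ℕ.s≤s ℕ.z≤n))))

  δ≤ : δ ℚ.≤ + 1 ℚ./ 100
  δ≤ = ℚₚ.≤-trans δ≤τ τ≤

  0≤2δ : 0ℚ ℚ.≤ 2ℚ ℚ.* δ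
  0≤2δ = Rat.*-nonNeg (Rat.⟦⟧-nonNeg 2) 0≤δ

  1≤t : 1ℚ ℚ.≤ t
  1≤t = Rat.≤-because 0≤2δ (solve 1 (λ d → con 1ℚ :+ con 2ℚ :* d :- con 1ℚ := con 2ℚ :* d) refl δ)

  0≤t : 0ℚ ℚ.≤ t
  0≤t = ℚₚ.≤-trans Rat.0≤1 1≤t

  tᵏ≤ : t ^ℚ k ℚ.≤ + 3 ℚ./ 2
  tᵏ≤ = ^-upper k 0≤2δ
    (ℚₚ.≤-trans (Rat.*-monoˡ (Rat.⟦⟧-nonNeg 2) δ≤) (ℚₚ.≤ᵇ⇒≤ {2ℚ ℚ.* (+ 1 ℚ./ 100)} {1ℚ} _))
    (begin
      ⟦ k ⟧ ℚ.* (2ℚ ℚ.* δ)   ≤⟨ Rat.*-monoˡ (Rat.⟦⟧-nonNeg k) (Rat.*-monoˡ (Rat.⟦⟧-nonNeg 2) δ≤τ) ⟩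
      ⟦ k ⟧ ℚ.* (2ℚ ℚ.* τ)   ≡⟨ solve 2 (λ k t → k :* (con 2ℚ :* t) := con 2ℚ :* (k :* t)) refl ⟦ k ⟧ τ ⟩
      2ℚ ℚ.* (⟦ k ⟧ ℚ.* τ)   ≡⟨ cong (2ℚ ℚ.*_) kτ≡ ⟩
      2ℚ ℚ.* (+ 1 ℚ./ 100)   ≤⟨ ℚₚ.≤ᵇ⇒≤ {2ℚ ℚ.* (+ 1 ℚ./ 100)} {+ 1 ℚ./ 3} _ ⟩
      + 1 ℚ./ 3              ∎)
    where open ℚₚ.≤-Reasoning

  loss : ℚ
  loss = ⟦ walkConst (k ℕ.+ k) 0 ⟧ ℚ.* (⟦ a ⟧ ℚ.* ⟦ a ⟧ ℚ.+ ⟦ d ⟧ ^ℚ (k ℕ.+ k))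

  -- With q an approximation of p, this has to stay below t np and yet exceed (1 + δ) n q' for the
  -- later terms q' of p. Errors of ½ in n q, multiplied by t, are less than 2 in the first
  -- comparison; in the second, δ n q' ≥ 4 makes up for the subtracted 2.
  degreeBound : ℕ → ℚ → ℚ
  degreeBound n q = t ℚ.* (⟦ n ⟧ ℚ.* q) ℚ.- 2ℚ

  -- 1/Ω is the bound on n³ κᵏ in `good-probability`. In addition (4d)ᵏ ≤ Ω ≤ (nq)ᵏ forces nq ≥ 4d,
  -- that is δ nq ≥ 4, which the degree bound requires.
  good-likely : ∀ n q q₀ Ω ε (0≤q : 0ℚ ℚ.≤ q) (q≤1 : q ℚ.≤ 1ℚ) → 1 ℕ.≤ n → (4 ℕ.* d) ℕ.^ k ℕ.≤ Ω →
    ⟦ Ω ⟧ ℚ.* (⟦ n ⟧ ^ℚ 3) ℚ.≤ (⟦ n ⟧ ℚ.* q) ^ℚ k → ⟦ n ⟧ ℚ.* q ℚ.≤ ⟦ n ⟧ ℚ.* q₀ ℚ.+ ½ → loss ℚ.≤ ε ℚ.* ⟦ Ω ⟧ →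
    1ℚ ℚ.- ε ℚ.≤ 𝔼 (ErdősRényi.graph q 0≤q q≤1 n) (λ G → indicator (does (Rat.good? (degreeBound n q₀) k G)))
  good-likely n q q₀ Ω ε 0≤q q≤1 1≤n ℓᵏ≤Ω Ωn³≤νᵏ near loss≤ = begin
    1ℚ ℚ.- ε                      ≤⟨ ℚₚ.+-monoʳ-≤ 1ℚ (ℚₚ.neg-antimono-≤ loss*≤) ⟩
    1ℚ ℚ.- loss ℚ.* Ω⁻¹
      ≤⟨ Rat.good-probability {n} q κ ι δ τ (degreeBound n q₀) k 0≤q q≤1 (ℚₚ.<⇒≤ 0<κ) κ≤1 refl nι≡1 0<ι 0≤δ
           (ℚₚ.≤-reflexive 3ᵏδ≡τ) (ℚₚ.≤-reflexive kτ≡) τ≤ degreeBound≥ ⟦ a ⟧ ⟦ d ⟧ ττ⁻¹≡1 δδ⁻¹≡1 Ω⁻¹ (Rat.⟦⟧-mono 1≤n) n³κᵏ≤ ⟩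
    𝔼 (ErdősRényi.graph q 0≤q q≤1 n) (λ G → indicator (does (Rat.good? (degreeBound n q₀) k G))) ∎
    where
    open ℚₚ.≤-Reasoning
    N ν ℓ : ℚ
    N = ⟦ n ⟧
    ν = N ℚ.* q
    ℓ = ⟦ 4 ℕ.* d ⟧

    0≤N : 0ℚ ℚ.≤ N
    0≤N = Rat.⟦⟧-nonNeg n

    0≤ν : 0ℚ ℚ.≤ ν
    0≤ν = Rat.*-nonNeg 0≤N 0≤q

    4d≢0 : ℕ.NonZero (4 ℕ.* d)
    4d≢0 = ℕₚ.m*n≢0 4 d

    1≤ℓ : 1ℚ ℚ.≤ ℓ
    1≤ℓ = Rat.⟦⟧-mono {1} {4 ℕ.* d} (ℕ.>-nonZero⁻¹ (4 ℕ.* d) {{4d≢0}})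

    ℓᵏ≤ : ℓ ^ℚ k ℚ.≤ ⟦ Ω ⟧
    ℓᵏ≤ = subst (ℚ._≤ ⟦ Ω ⟧) (Rat.⟦⟧-^ (4 ℕ.* d) k) (Rat.⟦⟧-mono ℓᵏ≤Ω)

    0<Ω : 0ℚ ℚ.< ⟦ Ω ⟧
    0<Ω = ℚₚ.<-≤-trans Rat.0<1 (ℚₚ.≤-trans (Rat.1≤^ k 1≤ℓ) ℓᵏ≤)

    ℓ≤ν : ℓ ℚ.≤ ν
    ℓ≤ν = Rat.^-cancel-≤ k 0≤ν (ℚₚ.≤-trans ℓᵏ≤ (ℚₚ.≤-trans
      (subst (ℚ._≤ ⟦ Ω ⟧ ℚ.* (N ^ℚ 3)) (ℚₚ.*-identityʳ ⟦ Ω ⟧) (Rat.*-monoˡ (ℚₚ.<⇒≤ 0<Ω) (Rat.1≤^ 3 (Rat.⟦⟧-mono 1≤n)))) Ωn³≤νᵏ))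

    0<ν : 0ℚ ℚ.< ν
    0<ν = ℚₚ.<-≤-trans Rat.0<1 (ℚₚ.≤-trans 1≤ℓ ℓ≤ν)

    κ ι Ω⁻¹ : ℚ
    κ   = proj₁ (inverse ν 0<ν)
    ι   = q ℚ.* κ
    Ω⁻¹ = proj₁ (inverse ⟦ Ω ⟧ 0<Ω)

    0<κ : 0ℚ ℚ.< κ
    0<κ = proj₁ (proj₂ (inverse ν 0<ν))

    νκ≡1 : ν ℚ.* κ ≡ 1ℚ
    νκ≡1 = proj₂ (proj₂ (inverse ν 0<ν))

    0<Ω⁻¹ : 0ℚ ℚ.< Ω⁻¹
    0<Ω⁻¹ = proj₁ (proj₂ (inverse ⟦ Ω ⟧ 0<Ω))

    ΩΩ⁻¹≡1 : ⟦ Ω ⟧ ℚ.* Ω⁻¹ ≡ 1ℚ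
    ΩΩ⁻¹≡1 = proj₂ (proj₂ (inverse ⟦ Ω ⟧ 0<Ω))

    κ≤1 : κ ℚ.≤ 1ℚ
    κ≤1 = subst₂ ℚ._≤_ (ℚₚ.*-identityˡ κ) νκ≡1 (Rat.*-monoʳ (ℚₚ.<⇒≤ 0<κ) (ℚₚ.≤-trans 1≤ℓ ℓ≤ν))

    nι≡1 : N ℚ.* ι ≡ 1ℚ
    nι≡1 = trans (sym (ℚₚ.*-assoc N q κ)) νκ≡1

    0<ι : 0ℚ ℚ.< ι
    0<ι = proj₂ (pos-*⇒pos 0≤N (Rat.*-nonNeg 0≤q (ℚₚ.<⇒≤ 0<κ)) (subst (0ℚ ℚ.<_) (sym nι≡1) Rat.0<1))

    4≤δν : ⟦ 4 ⟧ ℚ.≤ δ ℚ.* ν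
    4≤δν = begin
      ⟦ 4 ⟧                       ≡⟨ ℚₚ.*-identityʳ ⟦ 4 ⟧ ⟨
      ⟦ 4 ⟧ ℚ.* 1ℚ                ≡⟨ cong (⟦ 4 ⟧ ℚ.*_) δδ⁻¹≡1 ⟨
      ⟦ 4 ⟧ ℚ.* (δ ℚ.* ⟦ d ⟧)     ≡⟨ solve 2 (λ d e → con ⟦ 4 ⟧ :* (d :* e) := d :* (con ⟦ 4 ⟧ :* e)) refl δ ⟦ d ⟧ ⟩
      δ ℚ.* (⟦ 4 ⟧ ℚ.* ⟦ d ⟧)     ≡⟨ cong (δ ℚ.*_) (Rat.⟦⟧-* 4 d) ⟨
      δ ℚ.* ℓ                     ≤⟨ Rat.*-monoˡ 0≤δ ℓ≤ν ⟩
      δ ℚ.* ν                     ∎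

    degreeBound≥ : (1ℚ ℚ.+ δ) ℚ.* ν ℚ.≤ degreeBound n q₀
    degreeBound≥ = Rat.≤-because
      (Rat.+-nonNeg (Rat.+-nonNeg (Rat.+-nonNeg (Rat.*-nonNeg 0≤t (Rat.≤⇒0≤- near)) (Rat.≤⇒0≤- 4≤δν)) (Rat.≤⇒0≤- δ≤)) (ℚₚ.nonNegative⁻¹ (+ 149 ℚ./ 100)))
      (solve 3 (λ d v w → (con 1ℚ :+ con 2ℚ :* d) :* w :- con 2ℚ :- (con 1ℚ :+ d) :* v :=
        (con 1ℚ :+ con 2ℚ :* d) :* (w :+ con ½ :- v) :+ (d :* v :- con ⟦ 4 ⟧) :+ (con (+ 1 ℚ./ 100) :- d) :+ con (+ 149 ℚ./ 100)) refl δ ν (N ℚ.* q₀))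

    n³κᵏ≤ : N ℚ.* N ℚ.* N ℚ.* κ ^ℚ k ℚ.≤ Ω⁻¹
    n³κᵏ≤ = begin
      N ℚ.* N ℚ.* N ℚ.* κ ^ℚ k
        ≡⟨ ℚₚ.*-identityˡ _ ⟨
      1ℚ ℚ.* (N ℚ.* N ℚ.* N ℚ.* κ ^ℚ k)
        ≡⟨ cong (ℚ._* (N ℚ.* N ℚ.* N ℚ.* κ ^ℚ k)) ΩΩ⁻¹≡1 ⟨
      ⟦ Ω ⟧ ℚ.* Ω⁻¹ ℚ.* (N ℚ.* N ℚ.* N ℚ.* κ ^ℚ k)
        ≡⟨ solve 4 (λ w v n k → w :* v :* (n :* n :* n :* k) := v :* (w :* (n :* (n :* (n :* con 1ℚ))) :* k)) refl ⟦ Ω ⟧ Ω⁻¹ N (κ ^ℚ k) ⟩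
      Ω⁻¹ ℚ.* (⟦ Ω ⟧ ℚ.* (N ^ℚ 3) ℚ.* κ ^ℚ k)
        ≤⟨ Rat.*-monoˡ (ℚₚ.<⇒≤ 0<Ω⁻¹) (Rat.*-monoʳ (Rat.^-nonNeg k (ℚₚ.<⇒≤ 0<κ)) Ωn³≤νᵏ) ⟩
      Ω⁻¹ ℚ.* (ν ^ℚ k ℚ.* κ ^ℚ k)
        ≡⟨ cong (Ω⁻¹ ℚ.*_) (trans (sym (Rat.^-distrib-* ν κ k)) (trans (cong (_^ℚ k) νκ≡1) (Rat.1^ k))) ⟩
      Ω⁻¹ ℚ.* 1ℚ
        ≡⟨ ℚₚ.*-identityʳ Ω⁻¹ ⟩
      Ω⁻¹ ∎

    loss*≤ : loss ℚ.* Ω⁻¹ ℚ.≤ ε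
    loss*≤ = begin
      loss ℚ.* Ω⁻¹               ≤⟨ Rat.*-monoʳ (ℚₚ.<⇒≤ 0<Ω⁻¹) loss≤ ⟩
      ε ℚ.* ⟦ Ω ⟧ ℚ.* Ω⁻¹        ≡⟨ ℚₚ.*-assoc ε ⟦ Ω ⟧ Ω⁻¹ ⟩
      ε ℚ.* (⟦ Ω ⟧ ℚ.* Ω⁻¹)      ≡⟨ cong (ε ℚ.*_) ΩΩ⁻¹≡1 ⟩
      ε ℚ.* 1ℚ                   ≡⟨ ℚₚ.*-identityʳ ε ⟩
      ε                          ∎

-- From np ∼ nᵅ to the rational terms of p

<⇒0≤ : ∀ {x} → 0ℝ < x → 0ℝ ≤ x
<⇒0≤ {x} (d , 0<d , N , d≤x) = ≤-eventually {0ℝ} {x} N λ m N≤m →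
  ℚₚ.≤-trans (ℚₚ.<⇒≤ 0<d) (subst (ℚ._≤ seq x m) (ℚₚ.+-identityˡ d) (d≤x m N≤m))

-- Of the limit of np/nᵅ only the lower bound ½ is taken, since `growth` absorbs constant factors.
half-power≤ : ∀ n (p y : ℝ) (0<y : 0ℝ < y) → p ≤ 1ℝ → 1ℝ - fromℚ ½ ≤ fromℕ n * p / y ⟨ 0<y ⟩ →
  y ≤ fromℚ 2ℚ * (fromℕ n * capped p)
half-power≤ n p y 0<y p≤1 half≤ =
  ≤-trans {y} {fromℚ 2ℚ * (y * (1ℝ - fromℚ ½))} {fromℚ 2ℚ * (fromℕ n * capped p)}
    (≤-≗ {y} {fromℚ 2ℚ * (y * (1ℝ - fromℚ ½))} (λ m → solve 1 (λ y → y := con 2ℚ :* (y :* (con 1ℚ :- con ½))) refl (seq y m)))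
    (*-monoˡ {y * (1ℝ - fromℚ ½)} {fromℕ n * capped p} {fromℚ 2ℚ} (fromℚ-mono (Rat.⟦⟧-nonNeg 2))
      (≤-trans {y * (1ℝ - fromℚ ½)} {y * (fromℕ n * p / y ⟨ 0<y ⟩)} {fromℕ n * capped p}
        (*-monoˡ {1ℝ - fromℚ ½} {fromℕ n * p / y ⟨ 0<y ⟩} {y} (<⇒0≤ {y} 0<y) half≤)
        (≤-trans {y * (fromℕ n * p / y ⟨ 0<y ⟩)} {fromℕ n * p} {fromℕ n * capped p}
          (≤-eventually {y * (fromℕ n * p / y ⟨ 0<y ⟩)} {fromℕ n * p} (proj₁ (*-inv y 0<y)) λ m N≤m →
            ℚₚ.≤-reflexive (cancel (seq y m) (seq (fromℕ n * p) m) (seq (inv y 0<y) m) (proj₂ (*-inv y 0<y) m N≤m)))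
          (*-monoˡ {p} {capped p} {fromℕ n} (fromℚ-mono (Rat.⟦⟧-nonNeg n)) (proj₁ (capped-≃ p p≤1))))))
  where
  cancel : ∀ y f i → y ℚ.* i ≡ 1ℚ → y ℚ.* (f ℚ.* i) ≡ f
  cancel y f i yi≡1 = trans (solve 3 (λ y f i → y :* (f :* i) := f :* (y :* i)) refl y f i)
    (trans (cong (f ℚ.*_) yi≡1) (ℚₚ.*-identityʳ f))

-- y ≥ d > 0 and y ≤ 2np make the terms of p eventually nonnegative. A real inequality holds for
-- terms only up to an error; here the error ½ is absorbed by the outer factor 2, because nʳ ≥ 1.
rate : ∀ n r s (p y : ℝ) (0<y : 0ℝ < y) → 1 ℕ.≤ n → p ≤ 1ℝ → fromℕ n ^ r ≤ y ^ s →
  1ℝ - fromℚ ½ ≤ fromℕ n * p / y ⟨ 0<y ⟩ →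
  ∃ λ M → ∀ m → M ℕ.≤ m → 0ℚ ℚ.≤ seq (capped p) m ×
    ⟦ n ⟧ ^ℚ r ℚ.≤ 2ℚ ℚ.* (2ℚ ℚ.* (⟦ n ⟧ ℚ.* seq (capped p) m)) ^ℚ s
rate n r s p y 0<y@(d , 0<d , N , d≤y) 1≤n p≤1 nʳ≤yˢ half≤ = (N ℕ.⊔ proj₁ positive) ℕ.⊔ proj₁ large , λ m M≤m →
  q-nonNeg (seq (capped p) m)
    (d≤y m (ℕₚ.m⊔n≤o⇒m≤o N (proj₁ positive) (ℕₚ.m⊔n≤o⇒m≤o (N ℕ.⊔ proj₁ positive) (proj₁ large) M≤m)))
    (proj₂ positive m (ℕₚ.m⊔n≤o⇒n≤o N (proj₁ positive) (ℕₚ.m⊔n≤o⇒m≤o (N ℕ.⊔ proj₁ positive) (proj₁ large) M≤m))) ,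
  q-large (seq (capped p) m) (subst₂ (λ a b → a ℚ.≤ b ℚ.+ ½) (seq-^ (fromℕ n) r m) (seq-^ (fromℚ 2ℚ * (fromℕ n * capped p)) s m)
    (proj₂ large m (ℕₚ.m⊔n≤o⇒n≤o (N ℕ.⊔ proj₁ positive) (proj₁ large) M≤m)))
  where
  y≤ : y ≤ fromℚ 2ℚ * (fromℕ n * capped p)
  y≤ = half-power≤ n p y 0<y p≤1 half≤

  positive : ∃ λ M → ∀ m → M ℕ.≤ m → seq y m ℚ.≤ 2ℚ ℚ.* (⟦ n ⟧ ℚ.* seq (capped p) m) ℚ.+ ½ ℚ.* d
  positive = y≤ (½ ℚ.* d) (Rat.*-pos (ℚₚ.positive⁻¹ ½) 0<d)

  large : ∃ λ M → ∀ m → M ℕ.≤ m → seq (fromℕ n ^ r) m ℚ.≤ seq ((fromℚ 2ℚ * (fromℕ n * capped p)) ^ s) m ℚ.+ ½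
  large = ≤-trans {fromℕ n ^ r} {y ^ s} {(fromℚ 2ℚ * (fromℕ n * capped p)) ^ s} nʳ≤yˢ
    (^-mono-≤ {y} {fromℚ 2ℚ * (fromℕ n * capped p)} s (<⇒0≤ {y} 0<y) y≤) ½ (ℚₚ.positive⁻¹ ½)

  q-nonNeg : ∀ {yₘ} q → 0ℚ ℚ.+ d ℚ.≤ yₘ → yₘ ℚ.≤ 2ℚ ℚ.* (⟦ n ⟧ ℚ.* q) ℚ.+ ½ ℚ.* d → 0ℚ ℚ.≤ q
  q-nonNeg {yₘ} q d≤ ≤q = Rat.*-cancelˡ {0ℚ} {q} {2ℚ ℚ.* ⟦ n ⟧} (Rat.*-pos (Rat.⟦⟧-pos 2) (ℚₚ.<-≤-trans Rat.0<1 (Rat.⟦⟧-mono {1} {n} 1≤n)))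
    (Rat.≤-because (Rat.+-nonNeg (Rat.+-nonNeg (Rat.≤⇒0≤- d≤) (Rat.≤⇒0≤- ≤q)) (Rat.*-nonNeg (ℚₚ.nonNegative⁻¹ ½) (ℚₚ.<⇒≤ 0<d)))
      (solve 4 (λ n q y d → con 2ℚ :* n :* q :- con 2ℚ :* n :* con 0ℚ :=
        y :- (con 0ℚ :+ d) :+ (con 2ℚ :* (n :* q) :+ con ½ :* d :- y) :+ con ½ :* d) refl ⟦ n ⟧ q yₘ d))

  q-large : ∀ q → ⟦ n ⟧ ^ℚ r ℚ.≤ (2ℚ ℚ.* (⟦ n ⟧ ℚ.* q)) ^ℚ s ℚ.+ ½ → ⟦ n ⟧ ^ℚ r ℚ.≤ 2ℚ ℚ.* (2ℚ ℚ.* (⟦ n ⟧ ℚ.* q)) ^ℚ s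
  q-large q h = Rat.≤-because (Rat.+-nonNeg (Rat.*-nonNeg (Rat.⟦⟧-nonNeg 2) (Rat.≤⇒0≤- h)) (Rat.≤⇒0≤- (Rat.1≤^ r (Rat.⟦⟧-mono {1} {n} 1≤n))))
    (solve 2 (λ a w → con 2ℚ :* w :- a := con 2ℚ :* (w :+ con ½ :- a) :+ (a :- con 1ℚ)) refl (⟦ n ⟧ ^ℚ r) ((2ℚ ℚ.* (⟦ n ⟧ ℚ.* q)) ^ℚ s))

-- Events have to be decidable, so p is replaced in their definition by a rational number within
-- 1/(2n) of it.
module Approximation (p : ℝ) (n : ℕ) where

  private
    e : ℚ
    e = ½ ℚ.* reciprocal (suc n)

    Ne≤½ : ⟦ n ⟧ ℚ.* e ℚ.≤ ½
    Ne≤½ = begin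
      ⟦ n ⟧ ℚ.* (½ ℚ.* reciprocal (suc n))       ≤⟨ Rat.*-monoʳ (Rat.*-nonNeg (ℚₚ.nonNegative⁻¹ ½) (Rat.reciprocal-nonNeg (suc n))) (Rat.⟦⟧-mono (ℕₚ.n≤1+n n)) ⟩
      ⟦ suc n ⟧ ℚ.* (½ ℚ.* reciprocal (suc n))   ≡⟨ solve 2 (λ n r → n :* (con ½ :* r) := con ½ :* (n :* r)) refl ⟦ suc n ⟧ (reciprocal (suc n)) ⟩
      ½ ℚ.* (⟦ suc n ⟧ ℚ.* reciprocal (suc n))   ≡⟨ cong (½ ℚ.*_) (Rat.reciprocal-inverse (suc n)) ⟩
      ½                                          ∎
      where open ℚₚ.≤-Reasoning

    close : ∃ λ N → ∀ i j → N ℕ.≤ i → N ℕ.≤ j → ℚ.∣ seq (capped p) i ℚ.- seq (capped p) j ∣ ℚ.≤ e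
    close = cauchy (capped p) e (Rat.*-pos {½} {reciprocal (suc n)} (ℚₚ.positive⁻¹ ½) (ℚₚ.positive⁻¹ (reciprocal (suc n)) {{ℚₚ.normalize-pos 1 (suc n)}}))

  index : ℕ
  index = proj₁ close

  approx : ℚ
  approx = seq (capped p) index

  approx-close : ∀ m → index ℕ.≤ m →
    ⟦ n ⟧ ℚ.* seq (capped p) m ℚ.≤ ⟦ n ⟧ ℚ.* approx ℚ.+ ½ × ⟦ n ⟧ ℚ.* approx ℚ.≤ ⟦ n ⟧ ℚ.* seq (capped p) m ℚ.+ ½
  approx-close m index≤m =
    bound (seq (capped p) m) approx (proj₂ close m index index≤m ℕₚ.≤-refl) ,
    bound approx (seq (capped p) m) (proj₂ close index m ℕₚ.≤-refl index≤m)
    where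
    bound : ∀ x y → ℚ.∣ x ℚ.- y ∣ ℚ.≤ e → ⟦ n ⟧ ℚ.* x ℚ.≤ ⟦ n ⟧ ℚ.* y ℚ.+ ½
    bound x y ∣x-y∣≤e = Rat.≤-because
      (Rat.+-nonNeg (Rat.≤⇒0≤- Ne≤½) (Rat.*-nonNeg (Rat.⟦⟧-nonNeg n) (Rat.≤⇒0≤- (ℚₚ.≤-trans (p≤∣p∣ (x ℚ.- y)) ∣x-y∣≤e))))
      (solve 4 (λ n x y e → n :* y :+ con ½ :- n :* x := (con ½ :- n :* e) :+ n :* (e :- (x :- y))) refl ⟦ n ⟧ x y e)

-- The typical event and its probability

threshold : ℕ → ℕ → ℕ → ℕ
threshold k s Ω = 2 ℕ.^ k ℕ.* (2 ℕ.^ s) ℕ.^ k ℕ.* Ω ℕ.^ s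

module _ (k : ℕ) .{{_ : ℕ.NonZero k}} (p : ℝ) (n : ℕ) where

  open Scale k
  open Approximation p n

  event : Graph n → Bool
  event G = does (Rat.good? (degreeBound n approx) k G)

  event⇒good : ∀ G → T (event G) → Good (degreeBound n approx) k G
  event⇒good G = toGood (Rat.good? (degreeBound n approx) k G)
    where
    toGood : ∀ {A : Set} (A? : Dec A) → T (does A?) → A
    toGood (yes a) _ = a

  degreeBound≤ : fromℚ (degreeBound n approx) ≤ fromℚ t * (fromℕ n * p)
  degreeBound≤ = ≤-eventually {fromℚ (degreeBound n approx)} {fromℚ t * (fromℕ n * p)} index λ m index≤m →
    Rat.≤-because
      (Rat.+-nonNeg (Rat.+-nonNeg (Rat.+-nonNeg
        (Rat.*-nonNeg 0≤t (Rat.≤⇒0≤- (proj₂ (approx-close m index≤m))))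
        (Rat.*-nonNeg (Rat.*-nonNeg 0≤t (Rat.⟦⟧-nonNeg n)) (Rat.≤⇒0≤- (ℚₚ.p⊓q≤p (seq p m) 1ℚ))))
        (Rat.≤⇒0≤- δ≤)) (ℚₚ.nonNegative⁻¹ (+ 149 ℚ./ 100)))
      (solve 5 (λ d n a x y → (con 1ℚ :+ con 2ℚ :* d) :* (n :* x) :- ((con 1ℚ :+ con 2ℚ :* d) :* (n :* a) :- con 2ℚ) :=
        (con 1ℚ :+ con 2ℚ :* d) :* (n :* y :+ con ½ :- n :* a) :+ (con 1ℚ :+ con 2ℚ :* d) :* n :* (x :- y) :+ (con (+ 1 ℚ./ 100) :- d) :+ con (+ 149 ℚ./ 100))
        refl δ ⟦ n ⟧ approx (seq p m) (seq (capped p) m))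

  event-likely : ∀ r s Ω ε .{{_ : ℕ.NonZero s}} → 3 ℕ.* s ℕ.< k ℕ.* r → 1 ℕ.≤ n → p ≤ 1ℝ →
    threshold k s Ω ℕ.≤ n → (4 ℕ.* d) ℕ.^ k ℕ.≤ Ω → loss ℚ.≤ ε ℚ.* ⟦ Ω ⟧ →
    ∀ m → index ℕ.≤ m → 0ℚ ℚ.≤ seq (capped p) m →
    ⟦ n ⟧ ^ℚ r ℚ.≤ 2ℚ ℚ.* (2ℚ ℚ.* (⟦ n ⟧ ℚ.* seq (capped p) m)) ^ℚ s →
    1ℚ ℚ.- ε ℚ.≤ seq (Pr (capped p) event) m × seq (Pr (capped p) event) m ℚ.≤ 1ℚ
  event-likely r s Ω ε 3s<kr 1≤n p≤1 X≤n ℓᵏ≤Ω loss≤ m index≤m 0≤q nʳ≤ =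
    subst (1ℚ ℚ.- ε ℚ.≤_) (sym Pr≡)
      (good-likely n q approx Ω ε 0≤q q≤1 1≤n ℓᵏ≤Ω (growth n q r s k Ω 0≤q 3s<kr 1≤n X≤n nʳ≤) (proj₁ (approx-close m index≤m)) loss≤) ,
    subst (ℚ._≤ 1ℚ) (sym Pr≡) (ℚₚ.≤-trans (𝔼-mono (graph n) (λ G → indicator≤1 (event G))) (ℚₚ.≤-reflexive (𝔼-const (graph n) 1ℚ)))
    where
    q : ℚ
    q = seq (capped p) m

    q≤1 : q ℚ.≤ 1ℚ
    q≤1 = ℚₚ.p⊓q≤q (seq p m) 1ℚ

    open ErdősRényi q 0≤q q≤1

    Pr≡ : seq (Pr (capped p) event) m ≡ 𝔼 (graph n) (λ G → indicator (event G))
    Pr≡ = seq-Pr (capped p) m 0≤q q≤1 event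

    indicator≤1 : ∀ b → indicator b ℚ.≤ 1ℚ
    indicator≤1 true  = ℚₚ.≤-refl
    indicator≤1 false = Rat.0≤1

  Pr-event : ∀ r s Ω ε (ε′ : ℝ) .{{_ : ℕ.NonZero s}} → 3 ℕ.* s ℕ.< k ℕ.* r → 1 ℕ.≤ n → p ≤ 1ℝ →
    threshold k s Ω ℕ.≤ n → (4 ℕ.* d) ℕ.^ k ℕ.≤ Ω → 0ℚ ℚ.≤ ε → loss ℚ.≤ ε ℚ.* ⟦ Ω ⟧ → fromℚ ε ≤ ε′ →
    (∃ λ M → ∀ m → M ℕ.≤ m → 0ℚ ℚ.≤ seq (capped p) m × ⟦ n ⟧ ^ℚ r ℚ.≤ 2ℚ ℚ.* (2ℚ ℚ.* (⟦ n ⟧ ℚ.* seq (capped p) m)) ^ℚ s) →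
    1ℝ - ε′ ≤ Pr p event × Pr p event ≤ 1ℝ + ε′
  Pr-event r s Ω ε ε′ 3s<kr 1≤n p≤1 X≤n ℓᵏ≤Ω 0≤ε loss≤ ε≤ε′ (M , rate-M) =
    ≤-trans {1ℝ - ε′} {fromℚ (1ℚ ℚ.- ε)} {Pr p event}
      (≤-because {1ℝ - ε′} {fromℚ (1ℚ ℚ.- ε)} {ε′ - fromℚ ε} (≤⇒0≤- {fromℚ ε} {ε′} ε≤ε′)
        (λ m → solve 2 (λ e f → con 1ℚ :- e :- (con 1ℚ :- f) := f :- e) refl ε (seq ε′ m)))
      (≤-trans {fromℚ (1ℚ ℚ.- ε)} {Pr (capped p) event} {Pr p event}
        (≤-eventually {fromℚ (1ℚ ℚ.- ε)} {Pr (capped p) event} (M ℕ.⊔ index) (λ m M≤m → proj₁ (likely m M≤m)))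
        (proj₂ (Pr-cong {p} {capped p} (capped-≃ p p≤1) event))) ,
    ≤-trans {Pr p event} {Pr (capped p) event} {1ℝ + ε′}
      (proj₁ (Pr-cong {p} {capped p} (capped-≃ p p≤1) event))
      (≤-trans {Pr (capped p) event} {1ℝ} {1ℝ + ε′}
        (≤-eventually {Pr (capped p) event} {1ℝ} (M ℕ.⊔ index) (λ m M≤m → proj₂ (likely m M≤m)))
        (≤-because {1ℝ} {1ℝ + ε′} {ε′} (≤-trans {0ℝ} {fromℚ ε} {ε′} (fromℚ-mono 0≤ε) ε≤ε′)
          (λ m → solve 1 (λ f → con 1ℚ :+ f :- con 1ℚ := f) refl (seq ε′ m))))
    where
    likely : ∀ m → M ℕ.⊔ index ℕ.≤ m → 1ℚ ℚ.- ε ℚ.≤ seq (Pr (capped p) event) m × seq (Pr (capped p) event) m ℚ.≤ 1ℚ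
    likely m M≤m = event-likely r s Ω ε 3s<kr 1≤n p≤1 X≤n ℓᵏ≤Ω loss≤ m (ℕₚ.m⊔n≤o⇒n≤o M index M≤m)
      (proj₁ (rate-M m (ℕₚ.m⊔n≤o⇒m≤o M index M≤m))) (proj₂ (rate-M m (ℕₚ.m⊔n≤o⇒m≤o M index M≤m)))

-- The limit over n and the conclusion

module Proof {α : ℝ} {0<α : 0ℝ < α} (exponents : Exponent α 0<α) (p : ℕ → ℝ) where

  open Exponent exponents
  open Scale k

  event⇒bound : ∀ β → 0ℝ ≤ β → ∀ K → IsPower (1ℝ + β) (fromℕ 6 / α ⟨ 0<α ⟩) K → ∀ n G → T (event k (p n) n G) → Connected G ×
    ((0<np : 0ℝ < fromℕ n * p n) →
    (B : Matrix n) → IsStochastic B → SupportedOnEdges G B →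
    (π π-Q : Fin n → ℝ) →
    IsStationary (simpleRandomWalk G) π →
    IsStationary (biasedWalk G (β / (fromℕ n * p n) ⟨ 0<np ⟩) B) π-Q →
    (u : Fin n) → π-Q u ≤ fromℕ 3 * K * π u)
  event⇒bound β 0≤β K K-power n G G∈event = good⇒connected {k = k} G good , λ 0<np B stochastic supported π π-Q stationary stationary-Q →
    stationary-bound G (degreeBound n (Approximation.approx (p n) n)) t k good 0≤t β (fromℕ n * p n) 0≤β 0<np
      (degreeBound≤ k (p n) n) B stochastic supported π π-Q stationary stationary-Q
      K (IsPower.above K-power k 1 k≤6/α) 1≤t tᵏ≤
    where
    good : Good (degreeBound n (Approximation.approx (p n) n)) k G
    good = event⇒good k (p n) n G G∈event

  limit-half : (np∼nᵅ : (λ n → fromℕ n * p n) ∼n^ α) → ∃ λ N → ∀ j → N ℕ.≤ j →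
    1ℝ - fromℚ ½ ≤ fromℕ (suc j) * p (suc j) / _∼n^_.power np∼nᵅ (suc j) ⟨ IsPower.positive (_∼n^_.isPower np∼nᵅ (suc j)) ⟩
  limit-half np∼nᵅ = proj₁ at-half , λ j N≤j → proj₁ (proj₂ at-half j N≤j)
    where
    at-half = _∼n^_.limit np∼nᵅ (fromℚ ½) (½ , ℚₚ.positive⁻¹ ½ , 0 , λ _ _ → ℚₚ.≤-refl)

  -- The events and the scales τ, δ are the same for all tolerances; only the threshold on n depends
  -- on ε, through Ω.
  tends : (∀ n → 0ℝ ≤ p n × p n ≤ 1ℝ) → (λ n → fromℕ n * p n) ∼n^ α → TendsTo (λ n → Pr (p n) (event k (p n) n)) 1ℝ
  -- The limit runs along n = j + 1: the `suc` translates its index and excludes n = 0.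
  tends 0≤p≤1 np∼nᵅ ε (e , 0<e , M , e≤ε) = suc (proj₁ (limit-half np∼nᵅ)) ℕ.⊔ threshold k s Ω , λ
    { zero    N≤n → contradiction (ℕₚ.m⊔n≤o⇒m≤o (suc (proj₁ (limit-half np∼nᵅ))) (threshold k s Ω) N≤n) λ ()
    ; (suc j) N≤n → Pr-event k (p (suc j)) (suc j) r s Ω e ε 3s<kr (ℕ.s≤s ℕ.z≤n) (proj₂ (0≤p≤1 (suc j)))
        (ℕₚ.m⊔n≤o⇒n≤o (suc (proj₁ (limit-half np∼nᵅ))) (threshold k s Ω) N≤n) (ℕₚ.m≤n+m ((4 ℕ.* d) ℕ.^ k) (proj₁ large)) (ℚₚ.<⇒≤ 0<e) loss≤
        (≤-eventually {fromℚ e} {ε} M (λ m M≤m → subst (ℚ._≤ seq ε m) (ℚₚ.+-identityˡ e) (e≤ε m M≤m)))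
        (rate (suc j) r s (p (suc j)) (_∼n^_.power np∼nᵅ (suc j)) (IsPower.positive (_∼n^_.isPower np∼nᵅ (suc j)))
          (ℕ.s≤s ℕ.z≤n) (proj₂ (0≤p≤1 (suc j))) (IsPower.above (_∼n^_.isPower np∼nᵅ (suc j)) r s below)
          (proj₂ (limit-half np∼nᵅ) j (ℕₚ.≤-pred (ℕₚ.m⊔n≤o⇒m≤o (suc (proj₁ (limit-half np∼nᵅ))) (threshold k s Ω) N≤n))))
    }
    where
    e⁻¹ : ∃ λ i → 0ℚ ℚ.< i × e ℚ.* i ≡ 1ℚ
    e⁻¹ = inverse e 0<e

    large : ∃ λ n → loss ℚ.* proj₁ e⁻¹ ℚ.≤ ⟦ n ⟧
    large = Rat.archimedean (loss ℚ.* proj₁ e⁻¹)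

    -- The first summand brings loss/Ω below e, and the second ensures (4d)ᵏ ≤ Ω.
    Ω : ℕ
    Ω = proj₁ large ℕ.+ (4 ℕ.* d) ℕ.^ k

    loss≤ : loss ℚ.≤ e ℚ.* ⟦ Ω ⟧
    loss≤ = begin
      loss                              ≡⟨ ℚₚ.*-identityʳ loss ⟨
      loss ℚ.* 1ℚ                       ≡⟨ cong (loss ℚ.*_) (proj₂ (proj₂ e⁻¹)) ⟨
      loss ℚ.* (e ℚ.* proj₁ e⁻¹)        ≡⟨ solve 3 (λ l e i → l :* (e :* i) := e :* (l :* i)) refl loss e (proj₁ e⁻¹) ⟩
      e ℚ.* (loss ℚ.* proj₁ e⁻¹)        ≤⟨ Rat.*-monoˡ (ℚₚ.<⇒≤ 0<e) (ℚₚ.≤-trans (proj₂ large) (Rat.⟦⟧-mono (ℕₚ.m≤m+n (proj₁ large) ((4 ℕ.* d) ℕ.^ k)))) ⟩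
      e ℚ.* ⟦ Ω ⟧                       ∎
      where open ℚₚ.≤-Reasoning

proposition4p9 : (α β : ℝ) (0<α : 0ℝ < α) → α ≤ 1ℝ → 0ℝ ≤ β →
    (p : ℕ → ℝ) → (∀ n → 0ℝ ≤ p n × p n ≤ 1ℝ) →
    (λ n → fromℕ n * p n) ∼n^ α →
    (K : ℝ) → IsPower (1ℝ + β) (fromℕ 6 / α ⟨ 0<α ⟩) K →
    WithHighProbability p (λ n G →
    Connected G ×
    ((0<np : 0ℝ < fromℕ n * p n) →
    (B : Matrix n) → IsStochastic B → SupportedOnEdges G B →
    (π π-Q : Fin n → ℝ) →
    IsStationary (simpleRandomWalk G) π →
    IsStationary (biasedWalk G (β / (fromℕ n * p n) ⟨ 0<np ⟩) B) π-Q →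
    (u : Fin n) → π-Q u ≤ fromℕ 3 * K * π u))
proposition4p9 α β 0<α α≤1 0≤β p 0≤p≤1 np∼nᵅ K K-power =
  (λ n → event (Exponent.k exponents) (p n) n) , event⇒bound β 0≤β K K-power , tends 0≤p≤1 np∼nᵅ
  where
  exponents : Exponent α 0<α
  exponents = exponent α 0<α α≤1

  open Proof exponents p
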